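{- Let $n\ge0$ and let $\sigma,\tau\in\mathrm{Typ}(n)$ be types of $n$. The coefficient of $E^+_\tau$ in the expansion of $P_\sigma$ in the basis $\{E^+_\rho:\rho\in\mathrm{Typ}(n)\}$ is $$\sum_{T\in \mathcal{PT}^{\mathrm{dyad}}_{\mathrm{sing}}(\sigma, \tau)} (-1)^{\ell(\tau)-\ell(\sigma)}\, \mathfrak{L}^*(T).$$
   Context: A type of $n$ is a sequence $\tau=(\tau|^1,\tau|^2,\dots)$ of (possibly empty) integer partitions with $\sum_{i\ge1} i\,|\tau|^i|=n$, where $|\tau|^i|$ is the size of the partition $\tau|^i$; $\mathrm{Typ}(n)$ is the set of types of $n$. Its length is $\ell(\tau)=\sum_i\ell(\tau|^i)$. Each part $d$ of $\tau|^r$ gives a block $d^r$ of $\tau$ (degree $d$, multiplicity $r$; not exponentiation); a type is thus a multiset of blocks. Let $x_{i,j}$ ($i,j\ge 1$) be indeterminates with $\deg x_{i,j}=i$; all series have rational coefficients. A monomial is square-free if every exponent is at most $1$. $E^+_d$ is the sum of all square-free monomials of degree $d$; for $d\ge1$, $P_d=\sum_{k\mid d}\sum_{j\ge1}k\,x_{k,j}^{d/k}$. For $F\in\{P,E^+\}$, $F_{d^r}$ is obtained from $F_d$ by replacing each $x_{i,j}$ by $x_{i,j}^r$, and $F_\tau=\prod F_{d^r}$ over all blocks $d^r$ of $\tau$ (counted with repetition; empty product $=1$). It is known that $\{F_\tau\}_{\tau\in\mathrm{Typ}(n)}$ is, for each such $F$, a $\mathbb{Q}$-basis of the space $\mathrm{PSym}(n)$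 of polysymmetric functions of degree $n$ (power series homogeneous of degree $n$ that are symmetric separately in each variable set $\{x_{i,j}\}_{j\ge1}$). The diagram of a partition $\lambda$ has left-justified rows of $\lambda_1,\lambda_2,\dots$ cells; the tensor diagram of $\sigma$ is the sequence of diagrams of $\sigma|^1,\sigma|^2,\dots$, the $i$th one being called the $i$th tensor factor. A brick is a nonempty set of consecutive cells in one row; its length is its number of cells. For $k\ge0$, a $k$-brick is a brick whose length is a multiple of $2^k$, carrying the marking $k$. A dyadic polybrick tabloid of shape $\sigma$ and content $\tau$ is a decomposition of the tensor diagram of $\sigma$ into disjoint $k$-bricks (for various $k\ge0$, the markings being part of the data) such that, in each row, whenever $k'>k$ every $k'$-brick appears to the right of every $k$-brick, and such that $\tau$ is the multiset of blocks obtained by taking a block $b^{2^k m}$ for each $k$-brick of length $2^k b$ in the $m$th tensor factor. It is called singular if, in each row, all the bricks are $k$-bricks for the same $k$ (which may depend on the row). $\mathcal{PT}^{\mathrm{dyad}}_{\mathrm{sing}}(\sigma,\tau)$ is the set of singular dyadic polybrick tabloids of shape $\sigma$ and content $\tau$. For such $T$, $\mathfrak{L}^*(T)$ is the product, over all rows of all tensor factors, of the length (number of cells) of the last (rightmost) brick in the row. -}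

module Defs where

open import Data.Bool.Base using (if_then_else_)
open import Data.Integer.Base as ℤ using (ℤ)
open import Data.Irrelevant using ([_])
open import Data.List.Base using (List; []; _∷_; _++_; map; foldr;
  length; upTo; cartesianProductWith; deduplicate)
open import Data.List.Membership.Propositional using (_∈_)
open import Data.List.Membership.Propositional.Properties
  using (∈-upTo⁺; ∈-∃++; ∈-cartesianProductWith⁺; ∈-deduplicate⁺)
import Data.List.Membership.DecPropositional as DecMembership
open import Data.List.NonEmpty.Base as List⁺ using (List⁺; toList)
import Data.List.Properties as List
open import Data.List.Relation.Binary.Permutation.Propositional
  using (_↭_; ↭-refl; ↭-sym; ↭-trans; ↭-prep)
open import Data.List.Relation.Binary.Permutation.Propositional.Properties
  using (∈-resp-↭; drop-∷; ¬x∷xs↭[]; shift)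
open import Data.List.Relation.Unary.All as All using (All; []; _∷_)
open import Data.List.Relation.Unary.AllPairs using (AllPairs; allPairs?)
open import Data.List.Relation.Unary.Any using (here; there)
open import Data.List.Relation.Unary.Linked using (Linked; linked?)
open import Data.List.Relation.Unary.Unique.Propositional using (Unique)
open import Data.List.Relation.Unary.Unique.DecPropositional.Properties using (deduplicate-!)
open import Data.Nat as ℕ using (ℕ; zero; suc; NonZero; _+_; _*_; _∸_; _^_; _⊔_;
  _≤_; _<_; _≥_; z≤n; s≤s; _≤?_; _<?_; _≥?_)
open import Data.Nat.Divisibility using (_∣_; _∣?_)
open import Data.Nat.ListAction using (sum; product)
open import Data.Nat.Properties
open import Data.Product.Base using (_×_; _,_; ∃; proj₁; proj₂)
open import Data.Product.Properties using (≡-dec)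
open import Data.Rational.Base as ℚ using (ℚ; 0ℚ; 1ℚ)
open import Data.Refinement.Base using (Refinement-syntax; _,_; value)
open import Data.Vec.Base as Vec using (Vec; []; _∷_)
import Data.Vec.Properties as Vec
open import Data.Vec.Relation.Unary.All as VAll using ([]; _∷_) renaming (All to VAll)
open import Function.Base using (_∘_)
open import Relation.Binary.Definitions using (DecidableEquality)
open import Relation.Binary.PropositionalEquality using (_≡_; refl; sym; cong; subst)
open import Relation.Nullary.Decidable using (Dec; yes; no; does; map′; recompute; _×-dec_)
open import Relation.Nullary.Negation using (contradiction)
open import Relation.Unary using (Decidable)

private
  variable
    A : Set

------------------------------------------------------------------------
-- Finite sums

record Enumeration (A : Set) : Set where
  field
    elements : List A
    unique   : Unique elements
    complete : ∀ x → x ∈ elements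

open Enumeration public

sumℚ : List ℚ → ℚ
sumℚ = foldr ℚ._+_ 0ℚ

sumℤ : List ℤ → ℤ
sumℤ = foldr ℤ._+_ ℤ.0ℤ

∑ℚ : Enumeration A → (A → ℚ) → ℚ
∑ℚ xs f = sumℚ (map f (elements xs))

∑ℤ : Enumeration A → (A → ℤ) → ℤ
∑ℤ xs f = sumℤ (map f (elements xs))

syntax ∑ℚ xs (λ x → e) = ∑ℚ[ x ∈ xs ] e
syntax ∑ℤ xs (λ x → e) = ∑ℤ[ x ∈ xs ] e

------------------------------------------------------------------------
-- Partitions and types

Partition : Set
Partition = [ λs ∈ List ℕ ∣ All (0 <_) λs × Linked _≥_ λs ]

parts : Partition → List ℕ
parts = value

size : Partition → ℕ
size = sum ∘ parts

weightFrom : ∀ {n} → ℕ → Vec Partition n → ℕ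
weightFrom i []       = 0
weightFrom i (μ ∷ μs) = i * size μ + weightFrom (suc i) μs

-- Only the first n partitions of a type of n can be nonempty, so the
-- sequence is cut off there. Position i of the vector (counted from 0)
-- holds τ|^(i+1).
Typ : ℕ → Set
Typ n = [ τ ∈ Vec Partition n ∣ weightFrom 1 τ ≡ n ]

ℓ : ∀ {n} → Typ n → ℕ
ℓ τ = Vec.sum (Vec.map (length ∘ parts) (value τ))

-- The block d^r has degree d and multiplicity r.
record Block : Set where
  constructor block
  field
    degree       : ℕ
    multiplicity : ℕ
    .{{nonZero}} : NonZero multiplicity

open Block public

blocksFrom : ∀ {n} (i : ℕ) .{{_ : NonZero i}} → Vec Partition n → List Block
blocksFrom i []       = []
blocksFrom i (μ ∷ μs) = map (λ d → block d i) (parts μ) ++ blocksFrom (suc i) μs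

blocks : ∀ {n} → Typ n → List Block
blocks τ = blocksFrom 1 (value τ)

------------------------------------------------------------------------
-- Power series in the indeterminates x_{i,j}, i, j ≥ 1

-- Entry j of row i (both counted from 0) is the exponent of x_{i+1,j+1};
-- absent entries are 0. Rows may be ragged and trailing zeros are allowed,
-- so a monomial has several codes; every series built below takes the same
-- value at all codes of a monomial.
Monomial : Set
Monomial = List (List ℕ)

rowSupport : ℕ → ℕ → List ℕ → List (ℕ × ℕ × ℕ)
rowSupport i j []           = []
rowSupport i j (zero  ∷ es) = rowSupport i (suc j) es
rowSupport i j (suc e ∷ es) = (i , j , suc e) ∷ rowSupport i (suc j) es

supportFrom : ℕ → Monomial → List (ℕ × ℕ × ℕ)
supportFrom i []         = []
supportFrom i (es ∷ ess) = rowSupport i 1 es ++ supportFrom (suc i) ess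

-- The triples (i , j , e) such that x_{i,j} has exponent e > 0, in
-- lexicographic order. This does not depend on the code of the monomial.
support : Monomial → List (ℕ × ℕ × ℕ)
support = supportFrom 1

deg : Monomial → ℕ
deg m = sum (map (λ (i , _ , e) → i * e) (support m))

SquareFree : Monomial → Set
SquareFree = All (All (_≤ 1))

squareFree? : Decidable SquareFree
squareFree? = All.all? (All.all? (_≤? 1))

_≟ˢ_ : DecidableEquality (List (ℕ × ℕ × ℕ))
_≟ˢ_ = List.≡-dec (≡-dec ℕ._≟_ (≡-dec ℕ._≟_ ℕ._≟_))

-- A bound on the second indices of the indeterminates occurring in a monomial.
width : Monomial → ℕ
width m = foldr _⊔_ 0 (map length m)

PowerSeries : Set
PowerSeries = Monomial → ℚ

infix 4 _≈_
_≈_ : PowerSeries → PowerSeries → Set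
F ≈ G = ∀ m → F m ≡ G m

when : {P : Set} → Dec P → ℚ → ℚ
when P? q = if does P? then q else 0ℚ

fromℕ : ℕ → ℚ
fromℕ n = ℤ.+ n ℚ./ 1

𝟙 : PowerSeries
𝟙 m = when (support m ≟ˢ []) 1ℚ

splitsℕ : ℕ → List (ℕ × ℕ)
splitsℕ e = map (λ a → a , e ∸ a) (upTo (suc e))

splits : (A → List (A × A)) → List A → List (List A × List A)
splits s []       = ([] , []) ∷ []
splits s (x ∷ xs) =
  cartesianProductWith (λ (a , b) (as , bs) → (a ∷ as , b ∷ bs)) (s x) (splits s xs)

-- All pairs of monomials with product m, each listed once.
factorisations : Monomial → List (Monomial × Monomial)
factorisations = splits (splits splitsℕ)

infixl 7 _·_
_·_ : PowerSeries → PowerSeries → PowerSeries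
(F · G) m = sumℚ (map (λ (a , b) → F a ℚ.* G b) (factorisations m))

-- F with every x_{i,j} replaced by x_{i,j}^r.
dilate : (r : ℕ) .{{_ : NonZero r}} → PowerSeries → PowerSeries
dilate r F m = when (All.all? (All.all? (r ∣?_)) m) (F (map (map (ℕ._/ r)) m))

E⁺ : ℕ → PowerSeries
E⁺ d m = when (squareFree? m ×-dec deg m ℕ.≟ d) 1ℚ

-- The coefficient at m of ∑_{k ∣ d} ∑_{j ≥ 1} k x_{k,j}^{d/k}, for d ≥ 1.
-- Indices j > width m are omitted as x_{k,j} does not occur in m.
P : ℕ → PowerSeries
P d m =
  sumℚ (map (λ k-1 → let k = suc k-1 in
    sumℚ (map (λ j-1 → let j = suc j-1 in
      when (k ∣? d ×-dec support m ≟ˢ ((k , j , d ℕ./ k) ∷ [])) (fromℕ k))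
    (upTo (width m))))
  (upTo d))

-- F_τ, for F a sequence of series F_d.
atType : (ℕ → PowerSeries) → ∀ {n} → Typ n → PowerSeries
atType F τ = foldr _·_ 𝟙 (map (λ (block d r) → dilate r (F d)) (blocks τ))

E⁺[_] : ∀ {n} → Typ n → PowerSeries
E⁺[_] = atType E⁺

P[_] : ∀ {n} → Typ n → PowerSeries
P[_] = atType P

------------------------------------------------------------------------
-- Dyadic polybrick tabloids

-- A k-brick of length 2^k b has marking k and quotient b.
record Brick : Set where
  constructor brick
  field
    marking      : ℕ
    quotient     : ℕ
    .{{nonZero}} : NonZero quotient

open Brick public hiding (nonZero)

brickLength : Brick → ℕ
brickLength (brick k b) = 2 ^ k * b

Fills : ℕ → List⁺ Brick → Set
Fills d bs = sum (map brickLength (toList bs)) ≡ d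

MarkingsIncrease : List⁺ Brick → Set
MarkingsIncrease bs = AllPairs (λ b c → marking b ≤ marking c) (toList bs)

-- The decompositions of a row of d cells; bricks are listed left to right.
Row : ℕ → Set
Row d = [ bs ∈ List⁺ Brick ∣ Fills d bs × MarkingsIncrease bs ]

-- The blocks d^m of σ correspond to the rows of the tensor diagram of σ:
-- d is the length of the row and m the index of its tensor factor.
TabloidOn : List Block → Set
TabloidOn = All (Row ∘ degree)

Tabloid : ∀ {n} → Typ n → Set
Tabloid σ = TabloidOn (blocks σ)

brickBlock : (m : ℕ) .{{_ : NonZero m}} → Brick → Block
brickBlock m (brick k b) = block b (2 ^ k * m) {{m*n≢0 (2 ^ k) m {{m^n≢0 2 k}}}}

content : ∀ {βs} → TabloidOn βs → List Block
content []                         = []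
content {block _ m ∷ _} (row ∷ T) = map (brickBlock m) (toList (value row)) ++ content T

rows : ∀ {βs} → TabloidOn βs → List (List⁺ Brick)
rows = All.reduce value

SingularRow : List⁺ Brick → Set
SingularRow bs = ∃ λ k → All (λ b → marking b ≡ k) (toList bs)

Singular : ∀ {βs} → TabloidOn βs → Set
Singular T = All SingularRow (rows T)

PTdyad-sing : ∀ {n} → Typ n → Typ n → Set
PTdyad-sing σ τ = [ T ∈ Tabloid σ ∣ Singular T × content T ↭ blocks τ ]

𝔏* : ∀ {βs} → TabloidOn βs → ℕ
𝔏* T = product (map (brickLength ∘ List⁺.last) (rows T))

------------------------------------------------------------------------
-- Decidability

_≟ᴾ_ : DecidableEquality Partition
(λs , _) ≟ᴾ (μs , _) = map′ (λ { refl → refl }) (cong value) (List.≡-dec ℕ._≟_ λs μs)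

_≟ᵀ_ : ∀ {n} → DecidableEquality (Typ n)
(σ , _) ≟ᵀ (τ , _) = map′ (λ { refl → refl }) (cong value) (Vec.≡-dec _≟ᴾ_ σ τ)

_≟ᴮ_ : DecidableEquality Block
block d r ≟ᴮ block d′ r′ =
  map′ (λ { (refl , refl) → refl }) (λ { refl → refl , refl }) (d ℕ.≟ d′ ×-dec r ℕ.≟ r′)

_≟ᵇ_ : DecidableEquality Brick
brick k b ≟ᵇ brick k′ b′ =
  map′ (λ { (refl , refl) → refl }) (λ { refl → refl , refl }) (k ℕ.≟ k′ ×-dec b ℕ.≟ b′)

_≟ᴿ_ : ∀ {d} → DecidableEquality (Row d)
(bs , _) ≟ᴿ (cs , _) = map′ (λ { refl → refl }) (cong value) (bs ≟⁺ cs)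
  where
  _≟⁺_ : DecidableEquality (List⁺ Brick)
  (b List⁺.∷ bs) ≟⁺ (c List⁺.∷ cs) =
    map′ (λ { (refl , refl) → refl }) (λ { refl → refl , refl })
         (b ≟ᵇ c ×-dec List.≡-dec _≟ᵇ_ bs cs)

_≟ᵗ_ : ∀ {βs} → DecidableEquality (TabloidOn βs)
[]      ≟ᵗ []      = yes refl
(r ∷ T) ≟ᵗ (s ∷ U) =
  map′ (λ { (refl , refl) → refl }) (λ { refl → refl , refl }) (r ≟ᴿ s ×-dec T ≟ᵗ U)

_↭?_ : (βs γs : List Block) → Dec (βs ↭ γs)
[]       ↭? []      = yes ↭-refl
[]       ↭? (γ ∷ γs) = no (¬x∷xs↭[] ∘ ↭-sym)
(β ∷ βs) ↭? γs with DecMembership._∈?_ _≟ᴮ_ β γs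
... | no  β∉γs = no λ p → β∉γs (∈-resp-↭ p (here refl))
... | yes β∈γs with xs , ys , refl ← ∈-∃++ β∈γs =
  map′ (λ p → ↭-trans (↭-prep β p) (↭-sym (shift β xs ys)))
       (λ p → drop-∷ (↭-trans p (shift β xs ys)))
       (βs ↭? (xs ++ ys))

isPartition? : Decidable (λ λs → All (0 <_) λs × Linked _≥_ λs)
isPartition? λs = All.all? (0 <?_) λs ×-dec linked? _≥?_ λs

isRow? : ∀ d → Decidable (λ bs → Fills d bs × MarkingsIncrease bs)
isRow? d bs = _ ℕ.≟ d ×-dec allPairs? (λ b c → marking b ≤? marking c) (toList bs)

singularRow? : Decidable SingularRow
singularRow? (b List⁺.∷ bs) =
  map′ (λ ps → marking b , refl ∷ ps) (λ { (_ , refl ∷ ps) → ps })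
       (All.all? (λ c → marking c ℕ.≟ marking b) bs)

inPTdyad-sing? : ∀ {n} (σ τ : Typ n) →
              Decidable (λ (T : Tabloid σ) → Singular T × content T ↭ blocks τ)
inPTdyad-sing? σ τ T = All.all? singularRow? (rows T) ×-dec content T ↭? blocks τ

------------------------------------------------------------------------
-- Enumerations of Typ n and of the singular dyadic polybrick tabloids

enumerate : DecidableEquality A → (xs : List A) → (∀ x → x ∈ xs) → Enumeration A
enumerate _≟_ xs ∈xs = record
  { elements = deduplicate _≟_ xs
  ; unique   = deduplicate-! _≟_ xs
  ; complete = λ x → ∈-deduplicate⁺ _≟_ (∈xs x)
  }

module _ {Q : A → Set} (Q? : Decidable Q) where

  refine : List A → List [ x ∈ A ∣ Q x ]
  refine []       = []
  refine (x ∷ xs) with Q? x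
  ... | yes q = (x , [ q ]) ∷ refine xs
  ... | no  _ = refine xs

  ∈-refine : ∀ {x xs} .(q : Q x) → x ∈ xs → (x , [ q ]) ∈ refine xs
  ∈-refine {x} q (here {xs = xs} refl) with Q? x
  ... | yes _ = here refl
  ... | no ¬q = contradiction (recompute (Q? x) q) λ q′ → ¬q q′
  ∈-refine q (there {x = y} x∈xs) with Q? y
  ... | yes _ = there (∈-refine q x∈xs)
  ... | no  _ = ∈-refine q x∈xs

  ∈-refine′ : ∀ {xs} → (∀ {x} → Q x → x ∈ xs) → ∀ x → x ∈ refine xs
  ∈-refine′ Q⊆xs (x , [ q ]) = ∈-refine q (Q⊆xs (recompute (Q? x) q))

listsUpTo : ℕ → List A → List (List A)
listsUpTo zero    xs = [] ∷ []
listsUpTo (suc n) xs = [] ∷ cartesianProductWith _∷_ xs (listsUpTo n xs)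

∈-listsUpTo : ∀ {n} {xs ys : List A} → length ys ≤ n → All (_∈ xs) ys → ys ∈ listsUpTo n xs
∈-listsUpTo {n = zero}  z≤n     []       = here refl
∈-listsUpTo {n = suc n} z≤n     []       = here refl
∈-listsUpTo {n = suc n} (s≤s p) (q ∷ qs) =
  there (∈-cartesianProductWith⁺ _∷_ q (∈-listsUpTo p qs))

vecs : ∀ n → List A → List (Vec A n)
vecs zero    xs = [] ∷ []
vecs (suc n) xs = cartesianProductWith _∷_ xs (vecs n xs)

∈-vecs : ∀ {n} {xs : List A} {v : Vec A n} → VAll (_∈ xs) v → v ∈ vecs n xs
∈-vecs []       = here refl
∈-vecs (p ∷ ps) = ∈-cartesianProductWith⁺ _∷_ p (∈-vecs ps)

length≤sum : (f : A → ℕ) {xs : List A} → All (λ x → 0 < f x) xs → length xs ≤ sum (map f xs)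
length≤sum f []       = z≤n
length≤sum f (p ∷ ps) = +-mono-≤ p (length≤sum f ps)

all≤sum : (f : A → ℕ) (xs : List A) → All (λ x → f x ≤ sum (map f xs)) xs
all≤sum f []       = []
all≤sum f (x ∷ xs) =
  m≤m+n (f x) _ ∷ All.map (λ p → ≤-trans p (m≤n+m _ (f x))) (all≤sum f xs)

partitionsUpTo : ℕ → List Partition
partitionsUpTo n = refine isPartition? (listsUpTo n (upTo (suc n)))

∈-partitionsUpTo : ∀ {n} μ → size μ ≤ n → μ ∈ partitionsUpTo n
∈-partitionsUpTo {n} (λs , [ p ]) λs≤n = ∈-refine isPartition? p (∈-listsUpTo
  (≤-trans (length≤sum _ (proj₁ (recompute (isPartition? λs) p))) sum≤n)
  (All.map (λ q → ∈-upTo⁺ (s≤s (≤-trans q sum≤n))) (all≤sum _ λs)))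
  where
  sum≤n : sum (map (λ d → d) λs) ≤ n
  sum≤n = subst (λ μs → sum μs ≤ n) (sym (List.map-id λs)) λs≤n

factors≤weight : ∀ {n} i .{{_ : NonZero i}} (v : Vec Partition n) →
                 VAll (λ μ → size μ ≤ weightFrom i v) v
factors≤weight i []       = []
factors≤weight i (μ ∷ μs) =
  ≤-trans (m≤n*m (size μ) i) (m≤m+n _ _) ∷
  VAll.map (λ p → ≤-trans p (m≤n+m _ _)) (factors≤weight (suc i) μs)

types : ∀ n → Enumeration (Typ n)
types n = enumerate _≟ᵀ_ (refine weight? (vecs n (partitionsUpTo n)))
  (∈-refine′ weight? λ {v} w≡n → ∈-vecs (VAll.map
    (λ {μ} p → ∈-partitionsUpTo μ (≤-trans p (≤-reflexive w≡n)))
    (factors≤weight 1 v)))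
  where
  weight? : Decidable (λ (v : Vec Partition n) → weightFrom 1 v ≡ n)
  weight? v = weightFrom 1 v ℕ.≟ n

brickOf : ℕ → ℕ → Brick
brickOf k b = brick k (suc b)

bricksUpTo : ℕ → List Brick
bricksUpTo d = cartesianProductWith brickOf (upTo d) (upTo d)

n<2^n : ∀ n → n < 2 ^ n
n<2^n zero    = s≤s z≤n
n<2^n (suc n) = ≤-trans (+-mono-≤ (≤-trans (s≤s z≤n) (n<2^n n)) (n<2^n n))
  (≤-reflexive (cong (2 ^ n +_) (sym (+-identityʳ (2 ^ n)))))

∈-bricksUpTo : ∀ {d} β → brickLength β ≤ d → β ∈ bricksUpTo d
∈-bricksUpTo (brick k (suc b)) p = ∈-cartesianProductWith⁺ brickOf
  (∈-upTo⁺ (≤-trans (n<2^n k) (≤-trans (m≤m*n (2 ^ k) (suc b)) p)))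
  (∈-upTo⁺ (≤-trans (m≤n*m (suc b) (2 ^ k) {{m^n≢0 2 k}}) p))

0<brickLength : ∀ β → 0 < brickLength β
0<brickLength (brick k (suc b)) =
  ℕ.>-nonZero⁻¹ _ {{m*n≢0 (2 ^ k) (suc b) {{m^n≢0 2 k}}}}

rowCandidates : ℕ → List (List⁺ Brick)
rowCandidates d = cartesianProductWith List⁺._∷_ (bricksUpTo d) (listsUpTo d (bricksUpTo d))

∈-rowCandidates : ∀ {d} bs → Fills d bs → bs ∈ rowCandidates d
∈-rowCandidates (b List⁺.∷ bs) refl with p ∷ ps ← all≤sum brickLength (b ∷ bs) =
  ∈-cartesianProductWith⁺ List⁺._∷_ (∈-bricksUpTo b p) (∈-listsUpTo
    (≤-trans (length≤sum brickLength (All.universal 0<brickLength bs)) (m≤n+m _ (brickLength b)))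
    (All.map (λ {c} → ∈-bricksUpTo c) ps))

rowsOf : ∀ d → List (Row d)
rowsOf d = refine (isRow? d) (rowCandidates d)

∈-rowsOf : ∀ {d} (r : Row d) → r ∈ rowsOf d
∈-rowsOf {d} = ∈-refine′ (isRow? d) λ {bs} → ∈-rowCandidates bs ∘ proj₁

tabloidsOn : ∀ βs → List (TabloidOn βs)
tabloidsOn []       = [] ∷ []
tabloidsOn (β ∷ βs) = cartesianProductWith _∷_ (rowsOf (degree β)) (tabloidsOn βs)

∈-tabloidsOn : ∀ {βs} (T : TabloidOn βs) → T ∈ tabloidsOn βs
∈-tabloidsOn []      = here refl
∈-tabloidsOn (r ∷ T) = ∈-cartesianProductWith⁺ _∷_ (∈-rowsOf r) (∈-tabloidsOn T)

singularTabloids : ∀ {n} (σ τ : Typ n) → Enumeration (PTdyad-sing σ τ)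
singularTabloids σ τ = enumerate _≟ˢᵗ_
  (refine (inPTdyad-sing? σ τ) (tabloidsOn (blocks σ)))
  (∈-refine′ (inPTdyad-sing? σ τ) λ {T} _ → ∈-tabloidsOn T)
  where
  _≟ˢᵗ_ : DecidableEquality (PTdyad-sing σ τ)
  (T , _) ≟ˢᵗ (U , _) = map′ (λ { refl → refl }) (cong value) (T ≟ᵗ U)

------------------------------------------------------------------------
-- Coefficients with respect to a family of series

linearCombination : ∀ {n} → (Typ n → ℚ) → (Typ n → PowerSeries) → PowerSeries
linearCombination {n} a B m = ∑ℚ[ ρ ∈ types n ] (a ρ ℚ.* B ρ m)

-- c is the coefficient of B τ in the expansion of F: F is a linear
-- combination of the B ρ, and B τ has coefficient c in every linear
-- combination equal to F.
IsCoefficient : ∀ {n} → (Typ n → PowerSeries) → PowerSeries → Typ n → ℚ → Set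
IsCoefficient B F τ c =
  (∃ λ a → F ≈ linearCombination a B) ×
  (∀ a → F ≈ linearCombination a B → a τ ≡ c)

module Submission where

{-
P and E⁺ are compared through E⁺(t) = ∑ E⁺_d t^d = ∏ (1 + x_{i,j} t^i). Writing
t d/dt log E⁺(t) = ∑ Q_d t^d, we have Q_d = ∑ i (-1)^{e-1} x_{i,j}^e over ie = d,
and Newton's identity d E⁺_d = ∑ E⁺_i Q_{d-i} expands Q_d over the rows made of
0-bricks only, with the weight (-1)^{bricks-1} (length of the last brick). The
signs of Q are removed by P_d = Q_d + 2 P_{d/2}(x²), which accounts for the rows
of k-bricks with k > 0; multiplying over the blocks of σ gives the tabloids.

The E⁺_ρ are independent: let the energy of a type be the sum of the squares of
the multiplicities of its blocks, and the energy of a monomial the sum of the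
squares of its exponents. A monomial in the support of E⁺_ρ has at least the
energy of ρ, with equality only if it is a product of distinct x_{d,j}^r, one for
each block d^r of ρ. So evaluating at one such monomial for each type is triangular.
-}

open import Defs
open import Data.Nat using (ℕ; ∣_-_∣)
open import Data.Integer using (+_; -1ℤ; _^_; _*_)
open import Data.Rational using (_/_)
open import Data.Refinement using (value)

import Data.Nat.Properties as ℕ
open import Algebra.Properties.CommutativeSemigroup ℕ.+-commutativeSemigroup using (interchange)
open import Data.Bool.Base using (true; false)
open import Data.Integer.Base as ℤ using (ℤ; 1ℤ)
import Data.Integer.Properties as ℤ
open import Data.Irrelevant using ([_])
open import Data.List.Base using (List; []; _∷_; _++_; map; filter; foldr; length; upTo; applyUpTo;
  cartesianProductWith; initLast; _∷ʳ′_)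
open import Data.List.Membership.Propositional using (_∈_)
open import Data.List.Membership.Propositional.Properties
open import Data.List.Membership.Propositional.Properties.WithK using (unique∧set⇒bag)
open import Data.List.NonEmpty.Base as List⁺ using (List⁺; _∷_; toList; _∷⁺_)
import Data.List.Properties as List
open import Data.List.Relation.Binary.BagAndSetEquality using (∼bag⇒↭)
import Data.List.Relation.Binary.Permutation.Homogeneous as Homogeneous
open import Data.List.Relation.Binary.Permutation.Propositional as Perm
  using (_↭_; ↭-sym; ↭-trans; ↭-refl; ↭-reflexive; prep; ↭⇒↭ₛ)
import Data.List.Relation.Binary.Permutation.Propositional.Properties as Perm
import Data.List.Relation.Binary.Pointwise as Pointwise
open import Data.List.Relation.Unary.All as All using (All; []; _∷_)
import Data.List.Relation.Unary.All.Properties as All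
open import Data.List.Relation.Unary.AllPairs using (AllPairs; []; _∷_)
open import Data.List.Relation.Unary.Any using (here; there)
open import Data.List.Relation.Unary.Linked using (Linked)
import Data.List.Relation.Unary.Sorted.TotalOrder.Properties as Sorted
open import Data.List.Relation.Unary.Unique.Propositional using (Unique)
import Data.List.Relation.Unary.Unique.Propositional.Properties as Unique
import Data.List.Sort as Sort
open import Data.Nat.Base as ℕ using (zero; suc; pred; _∸_; NonZero; s≤s; z≤n; _≤_; _<_; _≥_)
open import Data.Nat.Divisibility using (_∣_; _∣?_; divides; m∣m*n; ∣m∣n⇒∣m+n; ∣m+n∣m⇒∣n;
  m*n∣⇒m∣; m*n∣o⇒n∣o/m; m∣n/o⇒o*m∣n)
import Data.Nat.DivMod as ℕ
open import Data.Nat.Induction using (<-rec)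
open import Data.Nat.ListAction using (sum)
import Data.Nat.ListAction.Properties as ℕ
open import Data.Product.Base using (_×_; _,_; ∃; ∃₂; proj₁; proj₂)
open import Data.Rational.Base as ℚ using (ℚ; 0ℚ; 1ℚ)
import Data.Rational.Properties as ℚ
open import Data.Rational.Solver using (module +-*-Solver)
import Data.Rational.Unnormalised.Base as ℚᵘ
import Data.Rational.Unnormalised.Properties as ℚᵘ
open import Data.Refinement.Base using (Refinement; _,_)
open import Data.Sum.Base using (_⊎_; inj₁; inj₂)
open import Data.Vec.Base as Vec using (Vec; []; _∷_)
open import Function.Base using (_∘_; id)
open import Function.Bundles using (mk⇔)
open import Relation.Binary.Bundles using (DecTotalOrder)
import Relation.Binary.Construct.Flip.Ord as Flip
open import Relation.Binary.PropositionalEquality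
open import Relation.Nullary.Decidable using (Dec; yes; no; does; recompute; _×-dec_; ¬?; dec-true; dec-false)
open import Relation.Nullary.Negation using (¬_; contradiction)
open import Relation.Unary using (Decidable)

open +-*-Solver using (solve; _:+_; _:*_; :-_; _:=_; con)
open ≡-Reasoning

-- The obstacle is a mismatch of signs: the logarithmic derivative of 1 + x yields x/(1 + x),
-- whereas `P` calls for x/(1 - x). The link is x/(1 - x) = x/(1 + x) + 2 x²/(1 - x²). Iterated, it
-- puts 2^k in front of the substitution of x^(2^k) for x, and this is the origin of the dyadic
-- markings: raising all markings of a row by one doubles the last brick, which absorbs a factor 2,
-- and doubles every multiplicity, which is the substitution of x².
--
-- Series are bare functions on codes of monomials, multiplied by convolution over `factorisations`.
-- Their laws are therefore proved for the splittings of one exponent and carried through `splits`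
-- twice, to rows and to monomials. Newton's identity takes the same way, from (1 + x) · x/(1 + x) =
-- x in a single indeterminate.
--
-- Squares suit the independence argument because a sum of squares grows strictly both when two
-- powers of one indeterminate are multiplied and when one r-th power is replaced by several.
-- Products of `E⁺` have natural coefficients, so nothing cancels on the diagonal.

private
  variable
    A B C : Set
    F G F′ G′ : PowerSeries

-- Finite sums of rationals

∑ : List A → (A → ℚ) → ℚ
∑ xs f = sumℚ (map f xs)

∑² : List (A × B) → (A → B → ℚ) → ℚ
∑² xs f = ∑ xs (λ p → f (proj₁ p) (proj₂ p))

∑-cong-∈ : ∀ (xs : List A) {f g} → (∀ {x} → x ∈ xs → f x ≡ g x) → ∑ xs f ≡ ∑ xs g
∑-cong-∈ []       f≗g = refl
∑-cong-∈ (x ∷ xs) f≗g = cong₂ ℚ._+_ (f≗g (here refl)) (∑-cong-∈ xs (f≗g ∘ there))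

∑-cong : ∀ (xs : List A) {f g} → (∀ x → f x ≡ g x) → ∑ xs f ≡ ∑ xs g
∑-cong xs f≗g = ∑-cong-∈ xs (λ {x} _ → f≗g x)

∑²-cong : ∀ (xs : List (A × B)) {f g} → (∀ a b → f a b ≡ g a b) → ∑² xs f ≡ ∑² xs g
∑²-cong xs f≗g = ∑-cong xs (λ p → f≗g (proj₁ p) (proj₂ p))

∑-++ : ∀ (xs ys : List A) f → ∑ (xs ++ ys) f ≡ ∑ xs f ℚ.+ ∑ ys f
∑-++ []       ys f = sym (ℚ.+-identityˡ _)
∑-++ (x ∷ xs) ys f = trans (cong (f x ℚ.+_) (∑-++ xs ys f)) (sym (ℚ.+-assoc (f x) _ _))

∑-map : ∀ (g : A → B) xs f → ∑ (map g xs) f ≡ ∑ xs (f ∘ g)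
∑-map g []       f = refl
∑-map g (x ∷ xs) f = cong (f (g x) ℚ.+_) (∑-map g xs f)

∑-zero : ∀ (xs : List A) {f} → (∀ {x} → x ∈ xs → f x ≡ 0ℚ) → ∑ xs f ≡ 0ℚ
∑-zero []       f≡0 = refl
∑-zero (x ∷ xs) f≡0 = trans (cong₂ ℚ._+_ (f≡0 (here refl)) (∑-zero xs (f≡0 ∘ there))) (ℚ.+-identityˡ 0ℚ)

∑-+ : ∀ (xs : List A) f g → ∑ xs (λ x → f x ℚ.+ g x) ≡ ∑ xs f ℚ.+ ∑ xs g
∑-+ []       f g = sym (ℚ.+-identityˡ 0ℚ)
∑-+ (x ∷ xs) f g = trans (cong (f x ℚ.+ g x ℚ.+_) (∑-+ xs f g))
  (solve 4 (λ a b c d → (a :+ b) :+ (c :+ d) := (a :+ c) :+ (b :+ d)) refl (f x) (g x) (∑ xs f) (∑ xs g))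

∑-*ˡ : ∀ c (xs : List A) f → ∑ xs (λ x → c ℚ.* f x) ≡ c ℚ.* ∑ xs f
∑-*ˡ c []       f = sym (ℚ.*-zeroʳ c)
∑-*ˡ c (x ∷ xs) f = trans (cong (c ℚ.* f x ℚ.+_) (∑-*ˡ c xs f)) (sym (ℚ.*-distribˡ-+ c (f x) _))

∑-*ʳ : ∀ c (xs : List A) f → ∑ xs (λ x → f x ℚ.* c) ≡ ∑ xs f ℚ.* c
∑-*ʳ c xs f = trans (∑-cong xs (λ x → ℚ.*-comm (f x) c)) (trans (∑-*ˡ c xs f) (ℚ.*-comm c _))

∑-swap : ∀ (xs : List A) (ys : List B) (f : A → B → ℚ) →
         ∑ xs (λ x → ∑ ys (f x)) ≡ ∑ ys (λ y → ∑ xs (λ x → f x y))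
∑-swap []       ys f = sym (∑-zero ys (λ _ → refl))
∑-swap (x ∷ xs) ys f = trans (cong (∑ ys (f x) ℚ.+_) (∑-swap xs ys f)) (sym (∑-+ ys (f x) _))

∑-cartesianProductWith : ∀ (g : A → B → C) xs ys (f : C → ℚ) →
  ∑ (cartesianProductWith g xs ys) f ≡ ∑ xs (λ x → ∑ ys (λ y → f (g x y)))
∑-cartesianProductWith g []       ys f = refl
∑-cartesianProductWith g (x ∷ xs) ys f =
  trans (∑-++ (map (g x) ys) _ f)
        (cong₂ ℚ._+_ (∑-map (g x) ys f) (∑-cartesianProductWith g xs ys f))

∑-↭ : ∀ {xs ys : List A} f → xs ↭ ys → ∑ xs f ≡ ∑ ys f
∑-↭ f Perm.refl         = refl
∑-↭ f (Perm.prep x p)   = cong (f x ℚ.+_) (∑-↭ f p)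
∑-↭ f (Perm.swap x y p) = trans (cong (λ s → f x ℚ.+ (f y ℚ.+ s)) (∑-↭ f p))
  (solve 3 (λ a b c → a :+ (b :+ c) := b :+ (a :+ c)) refl (f x) (f y) _)
∑-↭ f (Perm.trans p q)  = trans (∑-↭ f p) (∑-↭ f q)

∑-set : ∀ {xs ys : List A} f → Unique xs → Unique ys →
        (∀ {x} → x ∈ xs → x ∈ ys) → (∀ {x} → x ∈ ys → x ∈ xs) → ∑ xs f ≡ ∑ ys f
∑-set f xs! ys! to from = ∑-↭ f (∼bag⇒↭ (unique∧set⇒bag xs! ys! (mk⇔ to from)))

-- Conditional terms and sums over subsets.

when-true : {P : Set} (P? : Dec P) {q : ℚ} → P → when P? q ≡ q
when-true P? p rewrite dec-true P? p = refl

when-false : {P : Set} (P? : Dec P) {q : ℚ} → ¬ P → when P? q ≡ 0ℚ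
when-false P? ¬p rewrite dec-false P? ¬p = refl

when-⇔ : {P Q : Set} (P? : Dec P) (Q? : Dec Q) {q : ℚ} → (P → Q) → (Q → P) → when P? q ≡ when Q? q
when-⇔ (yes p) Q? to from = sym (when-true Q? (to p))
when-⇔ (no ¬p) Q? to from = sym (when-false Q? (¬p ∘ from))

when-× : {P Q : Set} (P? : Dec P) (Q? : Dec Q) (q : ℚ) →
         when (P? ×-dec Q?) q ≡ when P? (when Q? q)
when-× P? Q? q with does P?
... | true  = refl
... | false = refl

when-0 : {P : Set} (P? : Dec P) → when P? 0ℚ ≡ 0ℚ
when-0 P? with does P?
... | true  = refl
... | false = refl

when-cong : {P : Set} (P? : Dec P) {q r : ℚ} → (P → q ≡ r) → when P? q ≡ when P? r
when-cong (yes p) q≡r = q≡r p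
when-cong (no ¬p) q≡r = refl

when-swap : {P Q : Set} (P? : Dec P) (Q? : Dec Q) (q : ℚ) →
            when P? (when Q? q) ≡ when Q? (when P? q)
when-swap P? Q? q with does P? | does Q?
... | true  | true  = refl
... | true  | false = refl
... | false | true  = refl
... | false | false = refl

when-+ : {P : Set} (P? : Dec P) (q r : ℚ) → when P? (q ℚ.+ r) ≡ when P? q ℚ.+ when P? r
when-+ P? q r with does P?
... | true  = refl
... | false = sym (ℚ.+-identityˡ 0ℚ)

when-*ˡ : {P : Set} (P? : Dec P) (q r : ℚ) → when P? q ℚ.* r ≡ when P? (q ℚ.* r)
when-*ˡ P? q r with does P?
... | true  = refl
... | false = ℚ.*-zeroˡ r

when-*ʳ : {P : Set} (P? : Dec P) (q r : ℚ) → q ℚ.* when P? r ≡ when P? (q ℚ.* r)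
when-*ʳ P? q r with does P?
... | true  = refl
... | false = ℚ.*-zeroʳ q

when-≢0 : {P : Set} (P? : Dec P) {q : ℚ} → when P? q ≢ 0ℚ → P × q ≢ 0ℚ
when-≢0 (yes p) q≢0 = p , q≢0
when-≢0 (no ¬p) q≢0 = contradiction refl q≢0

∑-when : {P : Set} (P? : Dec P) (xs : List A) (f : A → ℚ) →
         ∑ xs (λ x → when P? (f x)) ≡ when P? (∑ xs f)
∑-when P? xs f with does P?
... | true  = refl
... | false = ∑-zero xs (λ _ → refl)

∑-filter : {P : A → Set} (P? : Decidable P) (xs : List A) (f : A → ℚ) →
           ∑ (filter P? xs) f ≡ ∑ xs (λ x → when (P? x) (f x))
∑-filter P? []       f = refl
∑-filter P? (x ∷ xs) f with does (P? x)
... | true  = cong (f x ℚ.+_) (∑-filter P? xs f)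
... | false = trans (∑-filter P? xs f) (sym (ℚ.+-identityˡ _))

∑-isolate : ∀ {xs : List A} {x} f → Unique xs → x ∈ xs →
            (∀ {y} → y ∈ xs → y ≢ x → f y ≡ 0ℚ) → ∑ xs f ≡ f x
∑-isolate {xs = x ∷ xs} f (x∉ ∷ xs!) (here refl) f≡0 =
  trans (cong (f x ℚ.+_) (∑-zero xs (λ y∈ → f≡0 (there y∈) (≢-sym (All.lookup x∉ y∈)))))
        (ℚ.+-identityʳ _)
∑-isolate {xs = y ∷ xs} {x} f (y∉ ∷ xs!) (there x∈) f≡0 =
  trans (cong (ℚ._+ ∑ xs f) (f≡0 (here refl) (All.lookup y∉ x∈)))
        (trans (ℚ.+-identityˡ _) (∑-isolate f xs! x∈ (f≡0 ∘ there)))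

-- `φ` and `ψ` need to be inverse only on the two lists. Since `φ` undoes `ψ` on `ys`, `map ψ ys`
-- has no repetitions; it has the members of the filtered `xs`, so both sums run over the same
-- finite set.
∑-reindex : ∀ {P : A → Set} (P? : Decidable P) {xs : List A} {ys : List B} (φ : A → B) (ψ : B → A) f →
            Unique xs → Unique ys →
            (∀ {x} → x ∈ xs → P x → φ x ∈ ys × ψ (φ x) ≡ x) →
            (∀ {y} → y ∈ ys → ψ y ∈ xs × P (ψ y) × φ (ψ y) ≡ y) →
            ∑ xs (λ x → when (P? x) (f (φ x))) ≡ ∑ ys f
∑-reindex P? {xs} {ys} φ ψ f xs! ys! to from = begin
  ∑ xs (λ x → when (P? x) (f (φ x)))  ≡⟨ ∑-filter P? xs (f ∘ φ) ⟨
  ∑ (filter P? xs) (f ∘ φ)            ≡⟨ ∑-set (f ∘ φ) (Unique.filter⁺ P? xs!) ψys! to′ from′ ⟩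
  ∑ (map ψ ys) (f ∘ φ)                ≡⟨ ∑-map ψ ys (f ∘ φ) ⟩
  ∑ ys (f ∘ φ ∘ ψ)                    ≡⟨ ∑-cong-∈ ys (λ y∈ → cong f (proj₂ (proj₂ (from y∈)))) ⟩
  ∑ ys f                              ∎
  where
  to′ : ∀ {x} → x ∈ filter P? xs → x ∈ map ψ ys
  to′ x∈ with x∈xs , p ← ∈-filter⁻ P? {xs = xs} x∈ with y∈ , ψφ ← to x∈xs p =
    subst (_∈ map ψ ys) ψφ (∈-map⁺ ψ y∈)

  from′ : ∀ {x} → x ∈ map ψ ys → x ∈ filter P? xs
  from′ x∈ with y , y∈ , refl ← ∈-map⁻ ψ x∈ with ψy∈ , p , _ ← from y∈ = ∈-filter⁺ P? ψy∈ p

  mapψ! : ∀ {zs} → (∀ {z} → z ∈ zs → z ∈ ys) → Unique zs → Unique (map ψ zs)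
  mapψ! {[]}     zs⊆ [] = []
  mapψ! {z ∷ zs} zs⊆ (z∉ ∷ zs!) =
    All.tabulate (λ x∈ ψz≡x → let w , w∈ , x≡ψw = ∈-map⁻ ψ x∈ in
      All.lookup z∉ w∈ (trans (sym (proj₂ (proj₂ (from (zs⊆ (here refl))))))
        (trans (cong φ (trans ψz≡x x≡ψw)) (proj₂ (proj₂ (from (zs⊆ (there w∈))))))))
    ∷ mapψ! (zs⊆ ∘ there) zs!

  ψys! : Unique (map ψ ys)
  ψys! = mapψ! (λ y∈ → y∈) ys!

∑-≢0 : ∀ (xs : List A) f → ∑ xs f ≢ 0ℚ → ∃ λ x → x ∈ xs × f x ≢ 0ℚ
∑-≢0 []       f ∑≢0 = contradiction refl ∑≢0
∑-≢0 (x ∷ xs) f ∑≢0 with f x ℚ.≟ 0ℚ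
... | no fx≢0 = x , here refl , fx≢0
... | yes fx≡0 with y , y∈ , fy≢0 ← ∑-≢0 xs f
                     (λ ∑≡0 → ∑≢0 (trans (cong₂ ℚ._+_ fx≡0 ∑≡0) (ℚ.+-identityˡ 0ℚ))) =
  y , there y∈ , fy≢0

-- Splittings

-- A comultiplication: the ways to write an element as a product of two. The product of series is
-- its convolution, so the laws below are those of a coalgebra, dual to the laws of the algebra of
-- series. Each is tested against an arbitrary `H`, which makes the order of the lists immaterial.
Splitting : Set → Set
Splitting A = A → List (A × A)

∑²-splits : ∀ (s : Splitting A) x xs (H : List A → List A → ℚ) →
  ∑² (splits s (x ∷ xs)) H ≡ ∑² (s x) (λ a b → ∑² (splits s xs) (λ as bs → H (a ∷ as) (b ∷ bs)))
∑²-splits s x xs H = ∑-cartesianProductWith _ (s x) (splits s xs) (λ p → H (proj₁ p) (proj₂ p))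

Cocommutative : Splitting A → Set
Cocommutative {A} s = ∀ x (H : A → A → ℚ) → ∑² (s x) H ≡ ∑² (s x) (λ a b → H b a)

Coassociative : Splitting A → Set
Coassociative {A} s = ∀ x (H : A → A → A → ℚ) →
  ∑² (s x) (λ a b → ∑² (s a) (λ c d → H c d b)) ≡
  ∑² (s x) (λ a b → ∑² (s b) (λ c d → H a c d))

-- The unit is a predicate and not an element: the factors of a code have the shape of that code, so
-- every shape has its own code of 1.
Counital : Splitting A → {Z : A → Set} → Decidable Z → Set
Counital {A} s Z? = ∀ x (H : A → ℚ) → ∑² (s x) (λ a b → when (Z? a) (H b)) ≡ H x

-- Meant for `R` divisibility by r and `q` division by r: the splittings of x into two multiples of
-- r are those of the quotient, scaled by r, and there are none when r does not divide x.
Dilates : Splitting A → {R : A → Set} → Decidable R → (A → A) → Set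
Dilates {A} s R? q = ∀ x (H : A → A → ℚ) →
  ∑² (s x) (λ a b → when (R? a) (when (R? b) (H (q a) (q b)))) ≡ when (R? x) (∑² (s (q x)) H)

counitalʳ : ∀ {s : Splitting A} {Z : A → Set} {Z? : Decidable Z} → Cocommutative s → Counital s Z? →
            ∀ x (H : A → ℚ) → ∑² (s x) (λ a b → when (Z? b) (H a)) ≡ H x
counitalʳ comm unit x H = trans (comm x _) (unit x H)

splits-cocommutative : {s : Splitting A} → Cocommutative s → Cocommutative (splits s)
splits-cocommutative         comm []       H = refl
splits-cocommutative {s = s} comm (x ∷ xs) H = begin
  ∑² (splits s (x ∷ xs)) H
    ≡⟨ ∑²-splits s x xs H ⟩
  ∑² (s x) (λ a b → ∑² (splits s xs) (λ as bs → H (a ∷ as) (b ∷ bs)))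
    ≡⟨ comm x _ ⟩
  ∑² (s x) (λ a b → ∑² (splits s xs) (λ as bs → H (b ∷ as) (a ∷ bs)))
    ≡⟨ ∑²-cong (s x) (λ a b → splits-cocommutative comm xs _) ⟩
  ∑² (s x) (λ a b → ∑² (splits s xs) (λ as bs → H (b ∷ bs) (a ∷ as)))
    ≡⟨ ∑²-splits s x xs _ ⟨
  ∑² (splits s (x ∷ xs)) (λ a b → H b a) ∎

-- Head and tail split independently. Exchanging the sums brings the two splittings of the head
-- together, where the law of the entries applies; the two splittings of the tail are left to the
-- induction.
splits-coassociative : {s : Splitting A} → Coassociative s → Coassociative (splits s)
splits-coassociative         assoc []       H = refl
splits-coassociative {s = s} assoc (x ∷ xs) H = begin
  ∑² (splits s (x ∷ xs)) (λ a b → ∑² (splits s a) (λ c d → H c d b))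
    ≡⟨ ∑²-splits s x xs _ ⟩
  ∑² (s x) (λ a b → ∑² S (λ as bs → ∑² (splits s (a ∷ as)) (λ c d → H c d (b ∷ bs))))
    ≡⟨ ∑²-cong (s x) (λ a b → ∑²-cong S (λ as bs → ∑²-splits s a as _)) ⟩
  ∑² (s x) (λ a b → ∑² S (λ as bs → ∑² (s a) (λ c d → ∑² (splits s as) (λ cs ds →
    H (c ∷ cs) (d ∷ ds) (b ∷ bs)))))
    ≡⟨ ∑²-cong (s x) (λ a b → ∑-swap S (s a) _) ⟩
  ∑² (s x) (λ a b → ∑² (s a) (λ c d → ∑² S (λ as bs → ∑² (splits s as) (λ cs ds →
    H (c ∷ cs) (d ∷ ds) (b ∷ bs)))))
    ≡⟨ assoc x (λ c d b → ∑² S (λ as bs → ∑² (splits s as) (λ cs ds →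
         H (c ∷ cs) (d ∷ ds) (b ∷ bs)))) ⟩
  ∑² (s x) (λ a b → ∑² (s b) (λ c d → ∑² S (λ as bs → ∑² (splits s as) (λ cs ds →
    H (a ∷ cs) (c ∷ ds) (d ∷ bs)))))
    ≡⟨ ∑²-cong (s x) (λ a b → ∑²-cong (s b) (λ c d → splits-coassociative assoc xs
         (λ as bs cs → H (a ∷ as) (c ∷ bs) (d ∷ cs)))) ⟩
  ∑² (s x) (λ a b → ∑² (s b) (λ c d → ∑² S (λ as bs → ∑² (splits s bs) (λ cs ds →
    H (a ∷ as) (c ∷ cs) (d ∷ ds)))))
    ≡⟨ ∑²-cong (s x) (λ a b → ∑-swap (s b) S _) ⟩
  ∑² (s x) (λ a b → ∑² S (λ as bs → ∑² (s b) (λ c d → ∑² (splits s bs) (λ cs ds →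
    H (a ∷ as) (c ∷ cs) (d ∷ ds)))))
    ≡⟨ ∑²-cong (s x) (λ a b → ∑²-cong S (λ as bs → ∑²-splits s b bs _)) ⟨
  ∑² (s x) (λ a b → ∑² S (λ as bs → ∑² (splits s (b ∷ bs)) (λ c d → H (a ∷ as) c d)))
    ≡⟨ ∑²-splits s x xs _ ⟨
  ∑² (splits s (x ∷ xs)) (λ a b → ∑² (splits s b) (λ c d → H a c d)) ∎
  where S = splits s xs

splits-counital : {s : Splitting A} {Z : A → Set} {Z? : Decidable Z} →
                  Counital s Z? → Counital (splits s) (All.all? Z?)
splits-counital                   unit []       H = ℚ.+-identityʳ (H [])
splits-counital {s = s} {Z? = Z?} unit (x ∷ xs) H = begin
  ∑² (splits s (x ∷ xs)) (λ a b → when (All.all? Z? a) (H b))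
    ≡⟨ ∑²-splits s x xs _ ⟩
  ∑² (s x) (λ a b → ∑² (splits s xs) (λ as bs → when (Z? a ×-dec All.all? Z? as) (H (b ∷ bs))))
    ≡⟨ ∑²-cong (s x) (λ a b → trans
         (∑²-cong (splits s xs) (λ as bs → when-× (Z? a) (All.all? Z? as) _))
         (∑-when (Z? a) (splits s xs) _)) ⟩
  ∑² (s x) (λ a b → when (Z? a) (∑² (splits s xs) (λ as bs → when (All.all? Z? as) (H (b ∷ bs)))))
    ≡⟨ unit x (λ b → ∑² (splits s xs) (λ as bs → when (All.all? Z? as) (H (b ∷ bs)))) ⟩
  ∑² (splits s xs) (λ as bs → when (All.all? Z? as) (H (x ∷ bs)))
    ≡⟨ splits-counital unit xs (λ bs → H (x ∷ bs)) ⟩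
  H (x ∷ xs) ∎

splits-dilates : {s : Splitting A} {R : A → Set} {R? : Decidable R} {q : A → A} →
                 Dilates s R? q → Dilates (splits s) (All.all? R?) (map q)
splits-dilates                           dil []       H = refl
splits-dilates {s = s} {R? = R?} {q = q} dil (x ∷ xs) H = begin
  ∑² (splits s (x ∷ xs)) (λ a b → when (R*? a) (when (R*? b) (H (map q a) (map q b))))
    ≡⟨ ∑²-splits s x xs _ ⟩
  ∑² (s x) (λ a b → ∑² S (λ as bs →
    when (R? a ×-dec R*? as) (when (R? b ×-dec R*? bs) (H (q a ∷ map q as) (q b ∷ map q bs)))))
    ≡⟨ ∑²-cong (s x) (λ a b → trans
         (∑²-cong S (λ as bs → rearrange a as b bs (H (q a ∷ map q as) (q b ∷ map q bs))))
         (trans (∑-when (R? a) S _) (when-cong (R? a) (λ _ → ∑-when (R? b) S _)))) ⟩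
  ∑² (s x) (λ a b → when (R? a) (when (R? b) (∑² S (λ as bs →
    when (R*? as) (when (R*? bs) (H (q a ∷ map q as) (q b ∷ map q bs)))))))
    ≡⟨ ∑²-cong (s x) (λ a b → when-cong (R? a) (λ _ → when-cong (R? b) (λ _ →
         splits-dilates {R? = R?} dil xs (λ as bs → H (q a ∷ as) (q b ∷ bs))))) ⟩
  ∑² (s x) (λ a b → when (R? a) (when (R? b) (when (R*? xs) (∑² (splits s (map q xs)) (λ as bs →
    H (q a ∷ as) (q b ∷ bs))))))
    ≡⟨ dil x (λ a b → when (R*? xs) (∑² (splits s (map q xs)) (λ as bs → H (a ∷ as) (b ∷ bs)))) ⟩
  when (R? x) (∑² (s (q x)) (λ a b → when (R*? xs) (∑² (splits s (map q xs)) (λ as bs →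
    H (a ∷ as) (b ∷ bs)))))
    ≡⟨ when-cong (R? x) (λ _ → ∑-when (R*? xs) (s (q x)) _) ⟩
  when (R? x) (when (R*? xs) (∑² (s (q x)) (λ a b → ∑² (splits s (map q xs)) (λ as bs →
    H (a ∷ as) (b ∷ bs)))))
    ≡⟨ when-× (R? x) (R*? xs) _ ⟨
  when (R? x ×-dec R*? xs) (∑² (s (q x)) (λ a b → ∑² (splits s (map q xs)) (λ as bs →
    H (a ∷ as) (b ∷ bs))))
    ≡⟨ when-cong (R? x ×-dec R*? xs) (λ _ → ∑²-splits s (q x) (map q xs) H) ⟨
  when (R*? (x ∷ xs)) (∑² (splits s (map q (x ∷ xs))) H) ∎
  where
  S = splits s xs
  R*? = All.all? R?

  rearrange : ∀ a as b bs h → when (R? a ×-dec R*? as) (when (R? b ×-dec R*? bs) h) ≡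
                              when (R? a) (when (R? b) (when (R*? as) (when (R*? bs) h)))
  rearrange a as b bs h = begin
    when (R? a ×-dec R*? as) (when (R? b ×-dec R*? bs) h)
      ≡⟨ when-× (R? a) (R*? as) _ ⟩
    when (R? a) (when (R*? as) (when (R? b ×-dec R*? bs) h))
      ≡⟨ when-cong (R? a) (λ _ → when-cong (R*? as) (λ _ → when-× (R? b) (R*? bs) h)) ⟩
    when (R? a) (when (R*? as) (when (R? b) (when (R*? bs) h)))
      ≡⟨ when-cong (R? a) (λ _ → when-swap (R*? as) (R? b) _) ⟩
    when (R? a) (when (R? b) (when (R*? as) (when (R*? bs) h))) ∎

-- Splittings of a single exponent.

∑²-splitsℕ-suc : ∀ e (H : ℕ → ℕ → ℚ) →
  ∑² (splitsℕ (suc e)) H ≡ H 0 (suc e) ℚ.+ ∑² (splitsℕ e) (λ a b → H (suc a) b)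
∑²-splitsℕ-suc e H = cong (H 0 (suc e) ℚ.+_) (begin
  ∑² (map (λ a → a , suc e ∸ a) (applyUpTo suc (suc e))) H
    ≡⟨ ∑-map (λ a → a , suc e ∸ a) (applyUpTo suc (suc e)) (λ p → H (proj₁ p) (proj₂ p)) ⟩
  ∑ (applyUpTo suc (suc e)) (λ a → H a (suc e ∸ a))
    ≡⟨ cong (λ xs → ∑ xs (λ a → H a (suc e ∸ a))) (sym (List.map-upTo suc (suc e))) ⟩
  ∑ (map suc (upTo (suc e))) (λ a → H a (suc e ∸ a))
    ≡⟨ ∑-map suc (upTo (suc e)) (λ a → H a (suc e ∸ a)) ⟩
  ∑ (upTo (suc e)) (λ a → H (suc a) (e ∸ a))
    ≡⟨ ∑-map (λ a → a , e ∸ a) (upTo (suc e)) (λ p → H (suc (proj₁ p)) (proj₂ p)) ⟨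
  ∑² (splitsℕ e) (λ a b → H (suc a) b) ∎)

-- The same list peeled from its other end. Exchanging the two parts reverses `splitsℕ`, so
-- cocommutativity needs both recurrences.
∑²-splitsℕ-sucʳ : ∀ e (H : ℕ → ℕ → ℚ) →
  ∑² (splitsℕ (suc e)) H ≡ ∑² (splitsℕ e) (λ a b → H a (suc b)) ℚ.+ H (suc e) 0
∑²-splitsℕ-sucʳ zero    H = solve 2 (λ a b → a :+ (b :+ con 0ℚ) := (a :+ con 0ℚ) :+ b) refl (H 0 1) (H 1 0)
∑²-splitsℕ-sucʳ (suc e) H = begin
  ∑² (splitsℕ (suc (suc e))) H
    ≡⟨ ∑²-splitsℕ-suc (suc e) H ⟩
  H 0 (suc (suc e)) ℚ.+ ∑² (splitsℕ (suc e)) (λ a b → H (suc a) b)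
    ≡⟨ cong (H 0 (suc (suc e)) ℚ.+_) (∑²-splitsℕ-sucʳ e (λ a b → H (suc a) b)) ⟩
  H 0 (suc (suc e)) ℚ.+ (∑² (splitsℕ e) (λ a b → H (suc a) (suc b)) ℚ.+ H (suc (suc e)) 0)
    ≡⟨ ℚ.+-assoc (H 0 (suc (suc e))) _ _ ⟨
  (H 0 (suc (suc e)) ℚ.+ ∑² (splitsℕ e) (λ a b → H (suc a) (suc b))) ℚ.+ H (suc (suc e)) 0
    ≡⟨ cong (ℚ._+ H (suc (suc e)) 0) (∑²-splitsℕ-suc e (λ a b → H a (suc b))) ⟨
  ∑² (splitsℕ (suc e)) (λ a b → H a (suc b)) ℚ.+ H (suc (suc e)) 0 ∎

splitsℕ-cocommutative : Cocommutative splitsℕ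
splitsℕ-cocommutative zero    H = refl
splitsℕ-cocommutative (suc e) H = begin
  ∑² (splitsℕ (suc e)) H
    ≡⟨ ∑²-splitsℕ-suc e H ⟩
  H 0 (suc e) ℚ.+ ∑² (splitsℕ e) (λ a b → H (suc a) b)
    ≡⟨ cong (H 0 (suc e) ℚ.+_) (splitsℕ-cocommutative e (λ a b → H (suc a) b)) ⟩
  H 0 (suc e) ℚ.+ ∑² (splitsℕ e) (λ a b → H (suc b) a)
    ≡⟨ ℚ.+-comm (H 0 (suc e)) _ ⟩
  ∑² (splitsℕ e) (λ a b → H (suc b) a) ℚ.+ H 0 (suc e)
    ≡⟨ ∑²-splitsℕ-sucʳ e (λ a b → H b a) ⟨
  ∑² (splitsℕ (suc e)) (λ a b → H b a) ∎

-- Triples with sum e + 1 either have first part 0 or arise from triples with sum e by raising the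
-- first part. On both sides the former amount to the splittings of e + 1 under `H 0`; the latter
-- are the induction hypothesis for a shifted `H`.
splitsℕ-coassociative : Coassociative splitsℕ
splitsℕ-coassociative zero    H = refl
splitsℕ-coassociative (suc e) H = begin
  ∑² (splitsℕ (suc e)) (λ a b → ∑² (splitsℕ a) (λ c d → H c d b))
    ≡⟨ ∑²-splitsℕ-suc e (λ a b → ∑² (splitsℕ a) (λ c d → H c d b)) ⟩
  (H 0 0 (suc e) ℚ.+ 0ℚ) ℚ.+ ∑² (splitsℕ e) (λ a b → ∑² (splitsℕ (suc a)) (λ c d → H c d b))
    ≡⟨ cong₂ ℚ._+_ (ℚ.+-identityʳ (H 0 0 (suc e))) (trans
         (∑²-cong (splitsℕ e) (λ a b → ∑²-splitsℕ-suc a (λ c d → H c d b)))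
         (∑-+ (splitsℕ e) (λ p → H 0 (suc (proj₁ p)) (proj₂ p))
           (λ p → ∑² (splitsℕ (proj₁ p)) (λ c d → H (suc c) d (proj₂ p))))) ⟩
  H 0 0 (suc e) ℚ.+ (∑² (splitsℕ e) (λ a b → H 0 (suc a) b) ℚ.+
                   ∑² (splitsℕ e) (λ a b → ∑² (splitsℕ a) (λ c d → H (suc c) d b)))
    ≡⟨ cong (λ z → H 0 0 (suc e) ℚ.+ (∑² (splitsℕ e) (λ a b → H 0 (suc a) b) ℚ.+ z))
            (splitsℕ-coassociative e (λ a b c → H (suc a) b c)) ⟩
  H 0 0 (suc e) ℚ.+ (∑² (splitsℕ e) (λ a b → H 0 (suc a) b) ℚ.+
                   ∑² (splitsℕ e) (λ a b → ∑² (splitsℕ b) (λ c d → H (suc a) c d)))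
    ≡⟨ ℚ.+-assoc (H 0 0 (suc e)) _ _ ⟨
  (H 0 0 (suc e) ℚ.+ ∑² (splitsℕ e) (λ a b → H 0 (suc a) b)) ℚ.+
                   ∑² (splitsℕ e) (λ a b → ∑² (splitsℕ b) (λ c d → H (suc a) c d))
    ≡⟨ cong (ℚ._+ ∑² (splitsℕ e) (λ a b → ∑² (splitsℕ b) (λ c d → H (suc a) c d)))
            (∑²-splitsℕ-suc e (H 0)) ⟨
  ∑² (splitsℕ (suc e)) (H 0) ℚ.+ ∑² (splitsℕ e) (λ a b → ∑² (splitsℕ b) (λ c d → H (suc a) c d))
    ≡⟨ ∑²-splitsℕ-suc e (λ a b → ∑² (splitsℕ b) (H a)) ⟨
  ∑² (splitsℕ (suc e)) (λ a b → ∑² (splitsℕ b) (λ c d → H a c d)) ∎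

splitsℕ-counital : Counital splitsℕ (ℕ._≟ 0)
splitsℕ-counital zero    H = ℚ.+-identityʳ (H 0)
splitsℕ-counital (suc e) H = begin
  ∑² (splitsℕ (suc e)) (λ a b → when (a ℕ.≟ 0) (H b))
    ≡⟨ ∑²-splitsℕ-suc e (λ a b → when (a ℕ.≟ 0) (H b)) ⟩
  H (suc e) ℚ.+ ∑² (splitsℕ e) (λ _ _ → 0ℚ)
    ≡⟨ cong (H (suc e) ℚ.+_) (∑-zero (splitsℕ e) (λ _ → refl)) ⟩
  H (suc e) ℚ.+ 0ℚ
    ≡⟨ ℚ.+-identityʳ _ ⟩
  H (suc e) ∎

∈-splitsℕ⁺ : ∀ a b → (a , b) ∈ splitsℕ (a ℕ.+ b)
∈-splitsℕ⁺ a b = subst (λ c → (a , c) ∈ splitsℕ (a ℕ.+ b)) (ℕ.m+n∸m≡n a b)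
  (∈-map⁺ _ (∈-upTo⁺ (s≤s (ℕ.m≤m+n a b))))

∈-splitsℕ⁻ : ∀ {e a b} → (a , b) ∈ splitsℕ e → a ℕ.+ b ≡ e
∈-splitsℕ⁻ {e} ab∈ with a , a∈ , refl ← ∈-map⁻ _ ab∈ = ℕ.m+[n∸m]≡n (ℕ.≤-pred (∈-upTo⁻ a∈))

splitsℕ-unique : ∀ e → Unique (splitsℕ e)
splitsℕ-unique e = Unique.map⁺ (λ p → cong proj₁ p) (Unique.upTo⁺ (suc e))

-- If r divides both parts it divides their sum, so other exponents give 0. For e = q r, division
-- and multiplication by r are inverse bijections between the splittings of e into multiples of r
-- and those of q.
splitsℕ-dilates : ∀ r .{{_ : NonZero r}} → Dilates splitsℕ (r ∣?_) (ℕ._/ r)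
splitsℕ-dilates r e H = dilated (r ∣? e)
  where
  f : ℕ × ℕ → ℚ
  f (a , b) = H (a ℕ./ r) (b ℕ./ r)

  zero-term : ¬ r ∣ e → ∀ {p} → p ∈ splitsℕ e → when (r ∣? proj₁ p) (when (r ∣? proj₂ p) (f p)) ≡ 0ℚ
  zero-term r∤e {a , b} p∈ with r ∣? a | r ∣? b
  ... | no _    | _       = refl
  ... | yes _   | no _    = refl
  ... | yes r∣a | yes r∣b = contradiction (subst (r ∣_) (∈-splitsℕ⁻ p∈) (∣m∣n⇒∣m+n r∣a r∣b)) r∤e

  cancel : ∀ m → m ℕ.* r ℕ./ r ≡ m
  cancel m = ℕ.m*n/n≡m m r

  module _ (q : ℕ) where
    to : ∀ {p} → p ∈ splitsℕ (q ℕ.* r) → r ∣ proj₁ p × r ∣ proj₂ p →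
         (proj₁ p ℕ./ r , proj₂ p ℕ./ r) ∈ splitsℕ (q ℕ.* r ℕ./ r) ×
         (proj₁ p ℕ./ r ℕ.* r , proj₂ p ℕ./ r ℕ.* r) ≡ p
    to {a , b} p∈ (divides a′ refl , divides b′ refl)
      rewrite cancel a′ | cancel b′ | cancel q =
        subst (λ c → (a′ , b′) ∈ splitsℕ c)
          (ℕ.*-cancelʳ-≡ _ q r (trans (ℕ.*-distribʳ-+ r a′ b′) (∈-splitsℕ⁻ p∈)))
          (∈-splitsℕ⁺ a′ b′) , refl

    from : ∀ {p} → p ∈ splitsℕ (q ℕ.* r ℕ./ r) →
           (proj₁ p ℕ.* r , proj₂ p ℕ.* r) ∈ splitsℕ (q ℕ.* r) ×
           (r ∣ proj₁ p ℕ.* r × r ∣ proj₂ p ℕ.* r) ×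
           (proj₁ p ℕ.* r ℕ./ r , proj₂ p ℕ.* r ℕ./ r) ≡ p
    from {a , b} p∈ =
      subst (λ c → (a ℕ.* r , b ℕ.* r) ∈ splitsℕ c)
        (trans (sym (ℕ.*-distribʳ-+ r a b))
               (cong (ℕ._* r) (trans (∈-splitsℕ⁻ p∈) (cancel q))))
        (∈-splitsℕ⁺ _ _) ,
      (divides a refl , divides b refl) ,
      cong₂ _,_ (cancel a) (cancel b)

  dilated : (d : Dec (r ∣ e)) →
    ∑ (splitsℕ e) (λ p → when (r ∣? proj₁ p) (when (r ∣? proj₂ p) (f p))) ≡
    when d (∑² (splitsℕ (e ℕ./ r)) H)
  dilated (no r∤e)               = ∑-zero (splitsℕ e) (zero-term r∤e)
  dilated (yes (divides q refl)) = begin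
    ∑ (splitsℕ (q ℕ.* r)) (λ p → when (r ∣? proj₁ p) (when (r ∣? proj₂ p) (f p)))
      ≡⟨ ∑-cong (splitsℕ (q ℕ.* r)) (λ p → when-× (r ∣? proj₁ p) (r ∣? proj₂ p) (f p)) ⟨
    ∑ (splitsℕ (q ℕ.* r)) (λ p → when (r ∣? proj₁ p ×-dec r ∣? proj₂ p) (f p))
      ≡⟨ ∑-reindex (λ p → r ∣? proj₁ p ×-dec r ∣? proj₂ p)
           (λ (a , b) → a ℕ./ r , b ℕ./ r) (λ (a , b) → a ℕ.* r , b ℕ.* r) (λ (a , b) → H a b)
           (splitsℕ-unique _) (splitsℕ-unique _) (to q) (from q) ⟩
    ∑² (splitsℕ (q ℕ.* r ℕ./ r)) H ∎

-- The algebra of power series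

IsOne : Monomial → Set
IsOne = All (All (_≡ 0))

isOne? : Decidable IsOne
isOne? = All.all? (All.all? (ℕ._≟ 0))

factorisations-cocommutative : Cocommutative factorisations
factorisations-cocommutative = splits-cocommutative (splits-cocommutative splitsℕ-cocommutative)

factorisations-coassociative : Coassociative factorisations
factorisations-coassociative = splits-coassociative (splits-coassociative splitsℕ-coassociative)

factorisations-counital : Counital factorisations isOne?
factorisations-counital = splits-counital (splits-counital splitsℕ-counital)

factorisations-dilates : ∀ r .{{_ : NonZero r}} →
  Dilates factorisations (All.all? (All.all? (r ∣?_))) (map (map (ℕ._/ r)))
factorisations-dilates r = splits-dilates (splits-dilates (splitsℕ-dilates r))

rowSupport-[]⁺ : ∀ i j {es} → All (_≡ 0) es → rowSupport i j es ≡ []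
rowSupport-[]⁺ i j []          = refl
rowSupport-[]⁺ i j (refl ∷ zs) = rowSupport-[]⁺ i (suc j) zs

rowSupport-[]⁻ : ∀ i j es → rowSupport i j es ≡ [] → All (_≡ 0) es
rowSupport-[]⁻ i j []          eq = []
rowSupport-[]⁻ i j (zero ∷ es) eq = refl ∷ rowSupport-[]⁻ i (suc j) es eq

supportFrom-[]⁺ : ∀ i {m} → IsOne m → supportFrom i m ≡ []
supportFrom-[]⁺ i []       = refl
supportFrom-[]⁺ i (z ∷ zs) = cong₂ _++_ (rowSupport-[]⁺ i 1 z) (supportFrom-[]⁺ (suc i) zs)

supportFrom-[]⁻ : ∀ i m → supportFrom i m ≡ [] → IsOne m
supportFrom-[]⁻ i []         eq = []
supportFrom-[]⁻ i (es ∷ ess) eq =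
  rowSupport-[]⁻ i 1 es (List.++-conicalˡ _ _ eq) ∷
  supportFrom-[]⁻ (suc i) ess (List.++-conicalʳ (rowSupport i 1 es) _ eq)

𝟙≈ : ∀ m → 𝟙 m ≡ when (isOne? m) 1ℚ
𝟙≈ m = when-⇔ (support m ≟ˢ []) (isOne? m) (supportFrom-[]⁻ 1 m) (supportFrom-[]⁺ 1)

·-cong : F ≈ F′ → G ≈ G′ → F · G ≈ F′ · G′
·-cong F≈ G≈ m = ∑²-cong (factorisations m) (λ a b → cong₂ ℚ._*_ (F≈ a) (G≈ b))

·-comm : ∀ F G → F · G ≈ G · F
·-comm F G m = trans (factorisations-cocommutative m (λ a b → F a ℚ.* G b))
  (∑²-cong (factorisations m) (λ a b → ℚ.*-comm (F b) (G a)))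

·-assoc : ∀ F G H → (F · G) · H ≈ F · (G · H)
·-assoc F G H m = begin
  ∑² (factorisations m) (λ a b → ∑² (factorisations a) (λ c d → F c ℚ.* G d) ℚ.* H b)
    ≡⟨ ∑²-cong (factorisations m) (λ a b → ∑-*ʳ (H b) (factorisations a) _) ⟨
  ∑² (factorisations m) (λ a b → ∑² (factorisations a) (λ c d → F c ℚ.* G d ℚ.* H b))
    ≡⟨ factorisations-coassociative m (λ a b c → F a ℚ.* G b ℚ.* H c) ⟩
  ∑² (factorisations m) (λ a b → ∑² (factorisations b) (λ c d → F a ℚ.* G c ℚ.* H d))
    ≡⟨ ∑²-cong (factorisations m) (λ a b → trans
         (∑²-cong (factorisations b) (λ c d → ℚ.*-assoc (F a) (G c) (H d)))
         (∑-*ˡ (F a) (factorisations b) _)) ⟩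
  ∑² (factorisations m) (λ a b → F a ℚ.* ∑² (factorisations b) (λ c d → G c ℚ.* H d)) ∎

·-identityˡ : ∀ F → 𝟙 · F ≈ F
·-identityˡ F m = begin
  ∑² (factorisations m) (λ a b → 𝟙 a ℚ.* F b)
    ≡⟨ ∑²-cong (factorisations m) (λ a b → trans (cong (ℚ._* F b) (𝟙≈ a))
         (trans (when-*ˡ (isOne? a) 1ℚ (F b)) (when-cong (isOne? a) (λ _ → ℚ.*-identityˡ (F b))))) ⟩
  ∑² (factorisations m) (λ a b → when (isOne? a) (F b))
    ≡⟨ factorisations-counital m F ⟩
  F m ∎

·-identityʳ : ∀ F → F · 𝟙 ≈ F
·-identityʳ F m = trans (·-comm F 𝟙 m) (·-identityˡ F m)

·-distribˡ-∑ : ∀ F (xs : List A) (c : A → ℚ) (G : A → PowerSeries) m →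
  (F · (λ m′ → ∑ xs (λ x → c x ℚ.* G x m′))) m ≡ ∑ xs (λ x → c x ℚ.* (F · G x) m)
·-distribˡ-∑ F xs c G m = begin
  ∑² (factorisations m) (λ a b → F a ℚ.* ∑ xs (λ x → c x ℚ.* G x b))
    ≡⟨ ∑²-cong (factorisations m) (λ a b → trans (sym (∑-*ˡ (F a) xs (λ x → c x ℚ.* G x b)))
         (∑-cong xs (λ x → solve 3 (λ f c g → f :* (c :* g) := c :* (f :* g)) refl (F a) (c x) (G x b)))) ⟩
  ∑² (factorisations m) (λ a b → ∑ xs (λ x → c x ℚ.* (F a ℚ.* G x b)))
    ≡⟨ ∑-swap (factorisations m) xs _ ⟩
  ∑ xs (λ x → ∑² (factorisations m) (λ a b → c x ℚ.* (F a ℚ.* G x b)))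
    ≡⟨ ∑-cong xs (λ x → ∑-*ˡ (c x) (factorisations m) _) ⟩
  ∑ xs (λ x → c x ℚ.* (F · G x) m) ∎

·-distribʳ-∑ : ∀ (xs : List A) (c : A → ℚ) (F : A → PowerSeries) G m →
  ((λ m′ → ∑ xs (λ x → c x ℚ.* F x m′)) · G) m ≡ ∑ xs (λ x → c x ℚ.* (F x · G) m)
·-distribʳ-∑ xs c F G m = begin
  ((λ m′ → ∑ xs (λ x → c x ℚ.* F x m′)) · G) m
    ≡⟨ ·-comm (λ m′ → ∑ xs (λ x → c x ℚ.* F x m′)) G m ⟩
  (G · (λ m′ → ∑ xs (λ x → c x ℚ.* F x m′))) m
    ≡⟨ ·-distribˡ-∑ G xs c F m ⟩
  ∑ xs (λ x → c x ℚ.* (G · F x) m)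
    ≡⟨ ∑-cong xs (λ x → cong (c x ℚ.*_) (·-comm G (F x) m)) ⟩
  ∑ xs (λ x → c x ℚ.* (F x · G) m) ∎

-- The substitution of x^r for x.

divisible? : ∀ r → Decidable (All (All (r ∣_)))
divisible? r = All.all? (All.all? (r ∣?_))

dilate-· : ∀ r .{{_ : NonZero r}} F G → dilate r (F · G) ≈ dilate r F · dilate r G
dilate-· r F G m = begin
  dilate r (F · G) m
    ≡⟨ factorisations-dilates r m (λ a b → F a ℚ.* G b) ⟨
  ∑² (factorisations m) (λ a b → when (divisible? r a) (when (divisible? r b) (F (q a) ℚ.* G (q b))))
    ≡⟨ ∑²-cong (factorisations m) (λ a b → trans
         (when-cong (divisible? r a) (λ _ → sym (when-*ʳ (divisible? r b) (F (q a)) (G (q b)))))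
         (sym (when-*ˡ (divisible? r a) (F (q a)) _))) ⟩
  (dilate r F · dilate r G) m ∎
  where
  q : Monomial → Monomial
  q = map (map (ℕ._/ r))

module _ {A : Set} {R S T : A → Set} {f : A → A} where

  All-split : ∀ {g h : A → A} → (∀ {x} → T x → R x × S (f x)) → (∀ {x} → T x → g (f x) ≡ h x) →
              ∀ {xs} → All T xs → (All R xs × All S (map f xs)) × map g (map f xs) ≡ map h xs
  All-split split eq []       = ([] , []) , refl
  All-split split eq (t ∷ ts) with (rs , ss) , eqs ← All-split split eq ts | r , s ← split t =
    (r ∷ rs , s ∷ ss) , cong₂ _∷_ (eq t) eqs

  All-join : (∀ {x} → R x → S (f x) → T x) → ∀ {xs} → All R xs → All S (map f xs) → All T xs
  All-join join []       []       = []
  All-join join (r ∷ rs) (s ∷ ss) = join r s ∷ All-join join rs ss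

dilate-dilate : ∀ r s .{{_ : NonZero r}} .{{_ : NonZero s}} .{{_ : NonZero (r ℕ.* s)}} F →
                dilate r (dilate s F) ≈ dilate (r ℕ.* s) F
dilate-dilate r s F m = go (divisible? (r ℕ.* s) m)
  where
  split : ∀ {es} → All (r ℕ.* s ∣_) es →
          (All (r ∣_) es × All (s ∣_) (map (ℕ._/ r) es)) ×
          map (ℕ._/ s) (map (ℕ._/ r) es) ≡ map (ℕ._/ (r ℕ.* s)) es
  split = All-split
    (λ rs∣e → m*n∣⇒m∣ r s rs∣e , m*n∣o⇒n∣o/m r s rs∣e)
    (λ {e} _ → ℕ.m/n/o≡m/[n*o] e r s)

  join : ∀ {es} → All (r ∣_) es → All (s ∣_) (map (ℕ._/ r) es) → All (r ℕ.* s ∣_) es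
  join = All-join (λ r∣e s∣e/r → m∣n/o⇒o*m∣n r∣e s∣e/r)

  go : (d : Dec (All (All (r ℕ.* s ∣_)) m)) →
       dilate r (dilate s F) m ≡ when d (F (map (map (ℕ._/ (r ℕ.* s))) m))
  go (yes rs∣m) with (r∣m , s∣m/r) , eq ← All-split {S = All (s ∣_)} {f = map (ℕ._/ r)} {g = map (ℕ._/ s)} 
                        (λ p → proj₁ (split p)) (λ p → proj₂ (split p)) rs∣m =
    trans (when-true (divisible? r m) r∣m) (trans (when-true (divisible? s _) s∣m/r) (cong F eq))
  go (no rs∤m) with divisible? r m
  ... | no _    = refl
  ... | yes r∣m = when-false (divisible? s _) (λ s∣m/r → rs∤m (All-join join r∣m s∣m/r))

-- Products over lists of blocks.

blockProduct : (ℕ → PowerSeries) → List Block → PowerSeries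
blockProduct F βs = foldr _·_ 𝟙 (map (λ (block d r) → dilate r (F d)) βs)

blockProduct-++ : ∀ F βs γs → blockProduct F (βs ++ γs) ≈ blockProduct F βs · blockProduct F γs
blockProduct-++ F []       γs m = sym (·-identityˡ (blockProduct F γs) m)
blockProduct-++ F (block d r ∷ βs) γs m = trans
  (·-cong {F = dilate r (F d)} (λ _ → refl) (blockProduct-++ F βs γs) m)
  (sym (·-assoc (dilate r (F d)) (blockProduct F βs) (blockProduct F γs) m))

-- The content of a tabloid lists its blocks in reading order, the type with these blocks in another
-- one. By commutativity the product sees only the multiset.
blockProduct-↭ : ∀ F {βs γs} → βs ↭ γs → blockProduct F βs ≈ blockProduct F γs
blockProduct-↭ F Perm.refl                       m = refl
blockProduct-↭ F (Perm.prep (block d r) p)       m =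
  ·-cong {F = dilate r (F d)} (λ _ → refl) (blockProduct-↭ F p) m
blockProduct-↭ F (Perm.swap {βs} {γs} (block d r) (block d′ r′) p) m = begin
  (X · (Y · blockProduct F βs)) m   ≡⟨ ·-assoc X Y (blockProduct F βs) m ⟨
  ((X · Y) · blockProduct F βs) m   ≡⟨ ·-cong (·-comm X Y) (blockProduct-↭ F p) m ⟩
  ((Y · X) · blockProduct F γs) m   ≡⟨ ·-assoc Y X (blockProduct F γs) m ⟩
  (Y · (X · blockProduct F γs)) m   ∎
  where
  X = dilate r (F d)
  Y = dilate r′ (F d′)
blockProduct-↭ F (Perm.trans p q)                m = trans (blockProduct-↭ F p m) (blockProduct-↭ F q m)

-- Lifting Newton's identity to lists

fromℤ : ℤ → ℚ
fromℤ i = i ℚ./ 1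

toℚᵘ-fromℤ : ∀ i → ℚ.toℚᵘ (fromℤ i) ℚᵘ.≃ ℚᵘ.mkℚᵘ i 0
toℚᵘ-fromℤ i = ℚ.toℚᵘ-fromℚᵘ (ℚᵘ.mkℚᵘ i 0)

-- Sums in `ℚ` are normalised by a gcd. Among unnormalised rationals, denominators 1 reduce the
-- claim to an equation of integers.
fromℤ-+ : ∀ i j → fromℤ (i ℤ.+ j) ≡ fromℤ i ℚ.+ fromℤ j
fromℤ-+ i j = ℚ.toℚᵘ-injective (ℚᵘ.≃-trans (toℚᵘ-fromℤ (i ℤ.+ j)) (ℚᵘ.≃-sym (ℚᵘ.≃-trans
  (ℚ.toℚᵘ-homo-+ (fromℤ i) (fromℤ j)) (ℚᵘ.≃-trans
  (ℚᵘ.+-cong (toℚᵘ-fromℤ i) (toℚᵘ-fromℤ j))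
  (ℚᵘ.*≡* (cong (ℤ._* ℤ.1ℤ) (cong₂ ℤ._+_ (ℤ.*-identityʳ i) (ℤ.*-identityʳ j))))))))

fromℤ-* : ∀ i j → fromℤ (i ℤ.* j) ≡ fromℤ i ℚ.* fromℤ j
fromℤ-* i j = ℚ.toℚᵘ-injective (ℚᵘ.≃-trans (toℚᵘ-fromℤ (i ℤ.* j)) (ℚᵘ.≃-sym (ℚᵘ.≃-trans
  (ℚ.toℚᵘ-homo-* (fromℤ i) (fromℤ j)) (ℚᵘ.*-cong (toℚᵘ-fromℤ i) (toℚᵘ-fromℤ j)))))

fromℕ-+ : ∀ m n → fromℕ (m ℕ.+ n) ≡ fromℕ m ℚ.+ fromℕ n
fromℕ-+ m n = fromℤ-+ (ℤ.+ m) (ℤ.+ n)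

fromℕ-* : ∀ m n → fromℕ (m ℕ.* n) ≡ fromℕ m ℚ.* fromℕ n
fromℕ-* m n = trans (cong fromℤ (ℤ.pos-* m n)) (fromℤ-* (ℤ.+ m) (ℤ.+ n))

-- The first index of the indeterminates is threaded through the list: `next` is `suc` from row to
-- row of a monomial and `id` within a row.
weightedSum : (ℕ → ℕ) → (ℕ → A → ℕ) → ℕ → List A → ℕ
weightedSum next D i []       = 0
weightedSum next D i (x ∷ xs) = D i x ℕ.+ weightedSum next D (next i) xs

-- The sum of Q over the entries x such that all other entries vanish.
atSole : {Z : A → Set} → Decidable Z → (ℕ → ℕ) → (ℕ → A → ℚ) → ℕ → List A → ℚ
atSole Z? next Q i []       = 0ℚ
atSole Z? next Q i (x ∷ xs) = when (All.all? Z? xs) (Q i x) ℚ.+ when (Z? x) (atSole Z? next Q (next i) xs)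

module _ {A : Set} {s : Splitting A} {S Z : A → Set} (S? : Decidable S) (Z? : Decidable Z) (next : ℕ → ℕ)
         (D : ℕ → A → ℕ) (Q : ℕ → A → ℚ) (comm : Cocommutative s) (unit : Counital s Z?) where

  private
    S*? = All.all? S?
    Z*? = All.all? Z?
    D* = weightedSum next D
    Q* = atSole Z? next Q

  -- The product rule for a logarithmic derivative. If `Q*` singles out the head of `bs`, the tail
  -- is a unit, the counit law fixes the splitting of `xs`, and the hypothesis applies to `x`. If it
  -- singles out an entry of the tail, the head is a unit and the induction applies. These are the
  -- two summands of `D* i (x ∷ xs)`.
  splits-newton : (∀ i x → ∑² (s x) (λ a b → when (S? a) (Q i b)) ≡ when (S? x) (fromℕ (D i x))) →
                  ∀ i xs → ∑² (splits s xs) (λ as bs → when (S*? as) (Q* i bs)) ≡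
                           when (S*? xs) (fromℕ (D* i xs))
  splits-newton newton i []       = refl
  splits-newton newton i (x ∷ xs) = begin
    ∑² (splits s (x ∷ xs)) (λ as bs → when (S*? as) (Q* i bs))
      ≡⟨ ∑²-splits s x xs _ ⟩
    ∑² (s x) (λ a b → ∑² ss (λ as bs → when (S? a ×-dec S*? as)
      (when (Z*? bs) (Q i b) ℚ.+ when (Z? b) (Q* (next i) bs))))
      ≡⟨ ∑²-cong (s x) (λ a b → trans (∑²-cong ss (λ as bs → rearrange a as b bs))
           (trans (∑-+ ss _ _) (cong₂ ℚ._+_
             (trans (∑-when (S? a) ss _) (when-cong (S? a) (λ _ →
               counitalʳ {s = splits s} {Z? = Z*?} (splits-cocommutative {s = s} comm)
                 (splits-counital {s = s} {Z? = Z?} unit) xs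
                 (λ as → when (S*? as) (Q i b)))))
             (trans (∑-when (Z? b) ss _) (when-cong (Z? b) (λ _ →
               trans (∑-when (S? a) ss _)
                     (when-cong (S? a) (λ _ → splits-newton newton (next i) xs)))))))) ⟩
    ∑² (s x) (λ a b → when (S? a) (when (S*? xs) (Q i b)) ℚ.+ when (Z? b) (when (S? a) (when (S*? xs) d*)))
      ≡⟨ ∑-+ (s x) _ _ ⟩
    ∑² (s x) (λ a b → when (S? a) (when (S*? xs) (Q i b))) ℚ.+
    ∑² (s x) (λ a b → when (Z? b) (when (S? a) (when (S*? xs) d*)))
      ≡⟨ cong₂ ℚ._+_
           (trans (∑²-cong (s x) (λ a b → when-swap (S? a) (S*? xs) (Q i b)))
             (trans (∑-when (S*? xs) (s x) _)
               (trans (when-cong (S*? xs) (λ _ → newton i x)) (when-swap (S*? xs) (S? x) _))))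
           (counitalʳ {s = s} {Z? = Z?} comm unit x (λ a → when (S? a) (when (S*? xs) d*))) ⟩
    when (S? x) (when (S*? xs) (fromℕ (D i x))) ℚ.+ when (S? x) (when (S*? xs) d*)
      ≡⟨ when-+ (S? x) _ _ ⟨
    when (S? x) (when (S*? xs) (fromℕ (D i x)) ℚ.+ when (S*? xs) d*)
      ≡⟨ when-cong (S? x) (λ _ → trans (sym (when-+ (S*? xs) _ _))
           (when-cong (S*? xs) (λ _ → sym (fromℕ-+ (D i x) (D* (next i) xs))))) ⟩
    when (S? x) (when (S*? xs) (fromℕ (D* i (x ∷ xs))))
      ≡⟨ when-× (S? x) (S*? xs) _ ⟨
    when (S*? (x ∷ xs)) (fromℕ (D* i (x ∷ xs))) ∎
    where
    ss = splits s xs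
    d* = fromℕ (D* (next i) xs)

    rearrange : ∀ a as b bs →
      when (S? a ×-dec S*? as) (when (Z*? bs) (Q i b) ℚ.+ when (Z? b) (Q* (next i) bs)) ≡
      when (S? a) (when (Z*? bs) (when (S*? as) (Q i b))) ℚ.+
      when (Z? b) (when (S? a) (when (S*? as) (Q* (next i) bs)))
    rearrange a as b bs = begin
      when (S? a ×-dec S*? as) (when (Z*? bs) (Q i b) ℚ.+ when (Z? b) (Q* (next i) bs))
        ≡⟨ when-+ (S? a ×-dec S*? as) _ _ ⟩
      when (S? a ×-dec S*? as) (when (Z*? bs) (Q i b)) ℚ.+
      when (S? a ×-dec S*? as) (when (Z? b) (Q* (next i) bs))
        ≡⟨ cong₂ ℚ._+_
             (trans (when-× (S? a) (S*? as) _) (when-cong (S? a) (λ _ → when-swap (S*? as) (Z*? bs) _)))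
             (trans (when-swap (S? a ×-dec S*? as) (Z? b) _)
                    (when-cong (Z? b) (λ _ → when-× (S? a) (S*? as) _))) ⟩
      when (S? a) (when (Z*? bs) (when (S*? as) (Q i b))) ℚ.+
      when (Z? b) (when (S? a) (when (S*? as) (Q* (next i) bs))) ∎

module _ {A : Set} {Z : A → Set} (Z? : Decidable Z) (next : ℕ → ℕ) where

  atSole-linear : ∀ {Q Q′ Q″ : ℕ → A → ℚ} c → (∀ i x → Q i x ≡ Q′ i x ℚ.+ c ℚ.* Q″ i x) →
    ∀ i xs → atSole Z? next Q i xs ≡ atSole Z? next Q′ i xs ℚ.+ c ℚ.* atSole Z? next Q″ i xs
  atSole-linear c Q≡ i [] = sym (trans (ℚ.+-identityˡ _) (ℚ.*-zeroʳ c))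
  atSole-linear {Q} {Q′} {Q″} c Q≡ i (x ∷ xs) = begin
    when zs? (Q i x) ℚ.+ when (Z? x) (q Q)
      ≡⟨ cong₂ ℚ._+_
           (trans (when-cong zs? (λ _ → Q≡ i x)) (distrib zs? (Q′ i x) (Q″ i x)))
           (trans (when-cong (Z? x) (λ _ → atSole-linear c Q≡ (next i) xs)) (distrib (Z? x) (q Q′) (q Q″))) ⟩
    (when zs? (Q′ i x) ℚ.+ c ℚ.* when zs? (Q″ i x)) ℚ.+ (when (Z? x) (q Q′) ℚ.+ c ℚ.* when (Z? x) (q Q″))
      ≡⟨ solve 5 (λ c a b d e → (a :+ c :* b) :+ (d :+ c :* e) := (a :+ d) :+ c :* (b :+ e)) refl
           c (when zs? (Q′ i x)) (when zs? (Q″ i x)) (when (Z? x) (q Q′)) (when (Z? x) (q Q″)) ⟩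
    (when zs? (Q′ i x) ℚ.+ when (Z? x) (q Q′)) ℚ.+ c ℚ.* (when zs? (Q″ i x) ℚ.+ when (Z? x) (q Q″)) ∎
    where
    zs? = All.all? Z? xs

    q : (ℕ → A → ℚ) → ℚ
    q Q = atSole Z? next Q (next i) xs

    distrib : {P : Set} (P? : Dec P) (a b : ℚ) → when P? (a ℚ.+ c ℚ.* b) ≡ when P? a ℚ.+ c ℚ.* when P? b
    distrib P? a b = trans (when-+ P? a (c ℚ.* b)) (cong (when P? a ℚ.+_) (sym (when-*ʳ P? c b)))

  module _ {R : A → Set} (R? : Decidable R) (q : A → A) where

    all?-vanish : (∀ x h → when (R? x) (when (Z? (q x)) h) ≡ when (Z? x) h) →
                  ∀ xs h → when (All.all? R? xs) (when (All.all? Z? (map q xs)) h) ≡ when (All.all? Z? xs) h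
    all?-vanish vanish []       h = refl
    all?-vanish vanish (x ∷ xs) h = begin
      when (R? x ×-dec All.all? R? xs) (when (Z? (q x) ×-dec All.all? Z? (map q xs)) h)
        ≡⟨ trans (when-× (R? x) (All.all? R? xs) _) (when-cong (R? x) (λ _ →
             trans (when-cong (All.all? R? xs) (λ _ → when-× (Z? (q x)) (All.all? Z? (map q xs)) h))
                   (when-swap (All.all? R? xs) (Z? (q x)) _))) ⟩
      when (R? x) (when (Z? (q x)) (when (All.all? R? xs) (when (All.all? Z? (map q xs)) h)))
        ≡⟨ vanish x _ ⟩
      when (Z? x) (when (All.all? R? xs) (when (All.all? Z? (map q xs)) h))
        ≡⟨ when-cong (Z? x) (λ _ → all?-vanish vanish xs h) ⟩
      when (Z? x) (when (All.all? Z? xs) h)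
        ≡⟨ when-× (Z? x) (All.all? Z? xs) h ⟨
      when (Z? x ×-dec All.all? Z? xs) h ∎

    -- By `vanish` an entry is zero exactly when it is divisible with quotient zero. Hence dividing
    -- the entries leaves the conditions on the others as they were, and only the value at the sole
    -- entry is affected.
    atSole-dilate : ∀ {Q Q′ : ℕ → A → ℚ} →
      (∀ x h → when (R? x) (when (Z? (q x)) h) ≡ when (Z? x) h) →
      (∀ i x → when (R? x) (Q i (q x)) ≡ Q′ i x) →
      ∀ i xs → when (All.all? R? xs) (atSole Z? next Q i (map q xs)) ≡ atSole Z? next Q′ i xs
    atSole-dilate vanish Q≡ i []       = refl
    atSole-dilate {Q} {Q′} vanish Q≡ i (x ∷ xs) = begin
      when (R? x ×-dec rs?) (when zs/? (Q i (q x)) ℚ.+ when (Z? (q x)) t)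
        ≡⟨ when-+ (R? x ×-dec rs?) _ _ ⟩
      when (R? x ×-dec rs?) (when zs/? (Q i (q x))) ℚ.+ when (R? x ×-dec rs?) (when (Z? (q x)) t)
        ≡⟨ cong₂ ℚ._+_
             (trans (when-× (R? x) rs? _)
               (trans (when-cong (R? x) (λ _ → all?-vanish vanish xs _))
               (trans (when-swap (R? x) (All.all? Z? xs) _)
                 (when-cong (All.all? Z? xs) (λ _ → Q≡ i x)))))
             (trans (when-× (R? x) rs? _)
               (trans (when-cong (R? x) (λ _ → when-swap rs? (Z? (q x)) t))
               (trans (vanish x _)
                 (when-cong (Z? x) (λ _ → atSole-dilate vanish Q≡ (next i) xs))))) ⟩
      when (All.all? Z? xs) (Q′ i x) ℚ.+ when (Z? x) (atSole Z? next Q′ (next i) xs) ∎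
      where
      rs?  = All.all? R? xs
      zs/? = All.all? Z? (map q xs)
      t    = atSole Z? next Q (next i) (map q xs)

weightedSum-dilate : ∀ {R : A → Set} {q : A → A} next D r → (∀ i {x} → R x → D i x ≡ r ℕ.* D i (q x)) →
  ∀ i {xs} → All R xs → weightedSum next D i xs ≡ r ℕ.* weightedSum next D i (map q xs)
weightedSum-dilate         next D r D≡ i []                 = sym (ℕ.*-zeroʳ r)
weightedSum-dilate {q = q} next D r D≡ i (_∷_ {x} {xs} p ps) = trans
  (cong₂ ℕ._+_ (D≡ i p) (weightedSum-dilate next D r D≡ (next i) ps))
  (sym (ℕ.*-distribˡ-+ r (D i (q x)) (weightedSum next D (next i) (map q xs))))

weightedSum-splits : ∀ {s : Splitting A} next D →
  (∀ i {x a b} → (a , b) ∈ s x → D i a ℕ.+ D i b ≡ D i x) →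
  ∀ i {xs as bs} → (as , bs) ∈ splits s xs →
  weightedSum next D i as ℕ.+ weightedSum next D i bs ≡ weightedSum next D i xs
weightedSum-splits         next D D+ i {[]}     (here refl) = refl
weightedSum-splits {s = s} next D D+ i {x ∷ xs} asbs∈
  with (a , b) , (as , bs) , ab∈ , as∈ , refl ← ∈-cartesianProductWith⁻ _ (s x) (splits s xs) asbs∈ = trans
  (interchange (D i a) (w as) (D i b) (w bs))
  (cong₂ ℕ._+_ (D+ i ab∈) (weightedSum-splits next D D+ (next i) {xs} as∈))
  where w = weightedSum next D (next i)

rowDeg : ℕ → List ℕ → ℕ
rowDeg = weightedSum id ℕ._*_

degFrom : ℕ → Monomial → ℕ
degFrom = weightedSum suc rowDeg

sole-row : (ℕ → ℚ) → ℕ → List ℕ → ℚ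
sole-row c = atSole (ℕ._≟ 0) id (λ i e → fromℕ i ℚ.* c e)

-- The series ∑ i c(e) x_{i,j}^e.
sole : (ℕ → ℚ) → ℕ → Monomial → ℚ
sole c = atSole (All.all? (ℕ._≟ 0)) suc (sole-row c)

entryWeight : ℕ × ℕ × ℕ → ℕ
entryWeight (i , _ , e) = i ℕ.* e

rowDeg-support : ∀ i j es → sum (map entryWeight (rowSupport i j es)) ≡ rowDeg i es
rowDeg-support i j []           = refl
rowDeg-support i j (zero ∷ es)  = trans (rowDeg-support i (suc j) es) (cong (ℕ._+ rowDeg i es) (sym (ℕ.*-zeroʳ i)))
rowDeg-support i j (suc e ∷ es) = cong (i ℕ.* suc e ℕ.+_) (rowDeg-support i (suc j) es)

degFrom-support : ∀ i m → sum (map entryWeight (supportFrom i m)) ≡ degFrom i m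
degFrom-support i []       = refl
degFrom-support i (es ∷ m) = begin
  sum (map entryWeight (rowSupport i 1 es ++ supportFrom (suc i) m))
    ≡⟨ cong sum (List.map-++ entryWeight (rowSupport i 1 es) _) ⟩
  sum (map entryWeight (rowSupport i 1 es) ++ map entryWeight (supportFrom (suc i) m))
    ≡⟨ ℕ.sum-++ (map entryWeight (rowSupport i 1 es)) _ ⟩
  sum (map entryWeight (rowSupport i 1 es)) ℕ.+ sum (map entryWeight (supportFrom (suc i) m))
    ≡⟨ cong₂ ℕ._+_ (rowDeg-support i 1 es) (degFrom-support (suc i) m) ⟩
  rowDeg i es ℕ.+ degFrom (suc i) m ∎

deg≡ : ∀ m → deg m ≡ degFrom 1 m
deg≡ = degFrom-support 1

deg-splits : ∀ {m a b} → (a , b) ∈ factorisations m → deg a ℕ.+ deg b ≡ deg m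
deg-splits {m} {a} {b} ab∈ = trans (cong₂ ℕ._+_ (deg≡ a) (deg≡ b)) (trans
  (weightedSum-splits suc rowDeg (λ i {es} → weightedSum-splits id ℕ._*_ (λ i {e} {a} {b} p →
    trans (sym (ℕ.*-distribˡ-+ i a b)) (cong (i ℕ.*_) (∈-splitsℕ⁻ p))) i {es}) 1 {m} ab∈)
  (sym (deg≡ m)))

deg-dilate : ∀ r .{{_ : NonZero r}} {m} → All (All (r ∣_)) m → deg m ≡ r ℕ.* deg (map (map (ℕ._/ r)) m)
deg-dilate r {m} r∣m = trans (deg≡ m) (trans
  (weightedSum-dilate suc rowDeg r (weightedSum-dilate id ℕ._*_ r entry) 1 r∣m)
  (cong (r ℕ.*_) (sym (deg≡ (map (map (ℕ._/ r)) m)))))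
  where
  entry : ∀ i {e} → r ∣ e → i ℕ.* e ≡ r ℕ.* (i ℕ.* (e ℕ./ r))
  entry i (divides q refl) = begin
    i ℕ.* (q ℕ.* r)               ≡⟨ ℕ.*-assoc i q r ⟨
    i ℕ.* q ℕ.* r                 ≡⟨ ℕ.*-comm (i ℕ.* q) r ⟩
    r ℕ.* (i ℕ.* q)               ≡⟨ cong (λ z → r ℕ.* (i ℕ.* z)) (ℕ.m*n/n≡m q r) ⟨
    r ℕ.* (i ℕ.* (q ℕ.* r ℕ./ r)) ∎

-- Newton's identity

-- The coefficients of x/(1 - x), which turn `sole` into the power sums. The value 0 at exponent 0
-- lets absent indeterminates contribute nothing.
pos : ℕ → ℚ
pos zero    = 0ℚ
pos (suc _) = 1ℚ

-- The coefficients of x/(1 + x), that is, of x d/dx log(1 + x).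
alt : ℕ → ℚ
alt zero          = 0ℚ
alt (suc zero)    = 1ℚ
alt (suc (suc e)) = ℚ.- alt (suc e)

-- The homogeneous component of degree d of t d/dt log E⁺(t), where
-- E⁺(t) = ∏ (1 + x_{i,j} t^i).
Q : ℕ → PowerSeries
Q d m = when (deg m ℕ.≟ d) (sole alt 1 m)

-- e [e ≤ 1] = [1 ≤ e] (-1)^{e-1} + [2 ≤ e] (-1)^{e-2}
newton-ℕ : ∀ i e → ∑² (splitsℕ e) (λ a b → when (a ℕ.≤? 1) (fromℕ i ℚ.* alt b)) ≡ when (e ℕ.≤? 1) (fromℕ (i ℕ.* e))
newton-ℕ i zero    = begin
  fromℕ i ℚ.* 0ℚ ℚ.+ 0ℚ    ≡⟨ trans (ℚ.+-identityʳ _) (ℚ.*-zeroʳ (fromℕ i)) ⟩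
  0ℚ                   ≡⟨ cong fromℕ (ℕ.*-zeroʳ i) ⟨
  fromℕ (i ℕ.* 0)      ∎
newton-ℕ i (suc e) = begin
  ∑² (splitsℕ (suc e)) (λ a b → when (a ℕ.≤? 1) (fromℕ i ℚ.* alt b))
    ≡⟨ ∑²-splitsℕ-suc e (λ a b → when (a ℕ.≤? 1) (fromℕ i ℚ.* alt b)) ⟩
  fromℕ i ℚ.* alt (suc e) ℚ.+ ∑² (splitsℕ e) (λ a b → when (suc a ℕ.≤? 1) (fromℕ i ℚ.* alt b))
    ≡⟨ cong (fromℕ i ℚ.* alt (suc e) ℚ.+_) (trans
         (∑²-cong (splitsℕ e) (λ a b → when-⇔ (suc a ℕ.≤? 1) (a ℕ.≟ 0) {fromℕ i ℚ.* alt b}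
           (λ { (s≤s z≤n) → refl }) (λ { refl → s≤s z≤n })))
         (splitsℕ-counital e (λ b → fromℕ i ℚ.* alt b))) ⟩
  fromℕ i ℚ.* alt (suc e) ℚ.+ fromℕ i ℚ.* alt e
    ≡⟨ last e ⟩
  when (suc e ℕ.≤? 1) (fromℕ (i ℕ.* suc e)) ∎
  where
  last : ∀ e → fromℕ i ℚ.* alt (suc e) ℚ.+ fromℕ i ℚ.* alt e ≡ when (suc e ℕ.≤? 1) (fromℕ (i ℕ.* suc e))
  last zero    = trans (solve 1 (λ x → x :* con 1ℚ :+ x :* con 0ℚ := x) refl (fromℕ i))
                       (cong fromℕ (sym (ℕ.*-identityʳ i)))
  last (suc e) = solve 2 (λ x y → x :* (:- y) :+ x :* y := con 0ℚ) refl (fromℕ i) (alt (suc e))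

-- E⁺ · (t d/dt log E⁺) = t d/dt E⁺ with all degrees together. It comes from `newton-ℕ` by two
-- liftings: along a row, where the index is fixed, and along the rows, where it grows.
newton : ∀ m → ∑² (factorisations m) (λ a b → when (squareFree? a) (sole alt 1 b)) ≡
               when (squareFree? m) (fromℕ (deg m))
newton m = trans
  (splits-newton {s = splits splitsℕ} (All.all? (ℕ._≤? 1)) (All.all? (ℕ._≟ 0)) suc rowDeg (sole-row alt)
    (splits-cocommutative {s = splitsℕ} splitsℕ-cocommutative)
    (splits-counital {s = splitsℕ} {Z? = ℕ._≟ 0} splitsℕ-counital)
    (splits-newton {s = splitsℕ} (ℕ._≤? 1) (ℕ._≟ 0) id ℕ._*_ (λ i e → fromℕ i ℚ.* alt e)
      splitsℕ-cocommutative splitsℕ-counital newton-ℕ)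
    1 m)
  (cong (λ d → when (squareFree? m) (fromℕ d)) (sym (deg≡ m)))

∑²-splitsℕ-grading : ∀ d i j (q : ℚ) →
  ∑² (splitsℕ d) (λ a b → when (i ℕ.≟ a) (when (j ℕ.≟ b) q)) ≡ when (i ℕ.+ j ℕ.≟ d) q
∑²-splitsℕ-grading d i j q with i ℕ.+ j ℕ.≟ d
... | yes refl = trans
  (∑-isolate (λ p → when (i ℕ.≟ proj₁ p) (when (j ℕ.≟ proj₂ p) q)) (splitsℕ-unique (i ℕ.+ j)) (∈-splitsℕ⁺ i j)
    (λ {p} _ p≢ → trans (sym (when-× (i ℕ.≟ proj₁ p) (j ℕ.≟ proj₂ p) q))
      (when-false (i ℕ.≟ proj₁ p ×-dec j ℕ.≟ proj₂ p) (λ { (refl , refl) → p≢ refl }))))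
  (trans (when-true (i ℕ.≟ i) refl) (trans (when-true (j ℕ.≟ j) refl)
    (sym (when-true (i ℕ.+ j ℕ.≟ i ℕ.+ j) refl))))
... | no i+j≢d = trans (∑-zero (splitsℕ d) (λ {p} p∈ →
  trans (sym (when-× (i ℕ.≟ proj₁ p) (j ℕ.≟ proj₂ p) q))
    (when-false (i ℕ.≟ proj₁ p ×-dec j ℕ.≟ proj₂ p) (λ { (refl , refl) → i+j≢d (∈-splitsℕ⁻ p∈) }))))
  (sym (when-false (i ℕ.+ j ℕ.≟ d) i+j≢d))

-- For given factors, a single pair (i, j) can match their degrees, so the sum over pairs merges
-- both degree conditions into one on the product. The degree is constant along `factorisations m`,
-- so that condition leaves the sum and `newton` applies.
newton-homogeneous : ∀ d m → ∑² (splitsℕ d) (λ i j → (E⁺ i · Q j) m) ≡ fromℕ d ℚ.* E⁺ d m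
newton-homogeneous d m = begin
  ∑² (splitsℕ d) (λ i j → ∑² (factorisations m) (λ a b → E⁺ i a ℚ.* Q j b))
    ≡⟨ ∑-swap (splitsℕ d) (factorisations m) _ ⟩
  ∑² (factorisations m) (λ a b → ∑² (splitsℕ d) (λ i j → E⁺ i a ℚ.* Q j b))
    ≡⟨ ∑²-cong (factorisations m) (λ a b → trans
         (∑²-cong (splitsℕ d) (λ i j → coefficient a b i j))
         (∑²-splitsℕ-grading d (deg a) (deg b) _)) ⟩
  ∑² (factorisations m) (λ a b → when (deg a ℕ.+ deg b ℕ.≟ d) (g a b))
    ≡⟨ ∑-cong-∈ (factorisations m) (λ {p} p∈ →
         cong (λ k → when (k ℕ.≟ d) (g (proj₁ p) (proj₂ p))) (deg-splits {m} p∈)) ⟩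
  ∑² (factorisations m) (λ a b → when (deg m ℕ.≟ d) (g a b))
    ≡⟨ ∑-when (deg m ℕ.≟ d) (factorisations m) _ ⟩
  when (deg m ℕ.≟ d) (∑² (factorisations m) g)
    ≡⟨ when-cong (deg m ℕ.≟ d) (λ _ → newton m) ⟩
  when (deg m ℕ.≟ d) (when (squareFree? m) (fromℕ (deg m)))
    ≡⟨ when-cong (deg m ℕ.≟ d) (λ deg≡d → trans
         (cong (λ k → when (squareFree? m) (fromℕ k)) deg≡d)
         (cong (when (squareFree? m)) (sym (ℚ.*-identityʳ (fromℕ d))))) ⟩
  when (deg m ℕ.≟ d) (when (squareFree? m) (fromℕ d ℚ.* 1ℚ))
    ≡⟨ when-swap (deg m ℕ.≟ d) (squareFree? m) _ ⟩
  when (squareFree? m) (when (deg m ℕ.≟ d) (fromℕ d ℚ.* 1ℚ))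
    ≡⟨ when-× (squareFree? m) (deg m ℕ.≟ d) _ ⟨
  when (squareFree? m ×-dec deg m ℕ.≟ d) (fromℕ d ℚ.* 1ℚ)
    ≡⟨ when-*ʳ (squareFree? m ×-dec deg m ℕ.≟ d) (fromℕ d) 1ℚ ⟨
  fromℕ d ℚ.* E⁺ d m ∎
  where
  g : Monomial → Monomial → ℚ
  g a b = when (squareFree? a) (sole alt 1 b)

  coefficient : ∀ a b i j → E⁺ i a ℚ.* Q j b ≡ when (deg a ℕ.≟ i) (when (deg b ℕ.≟ j) (g a b))
  coefficient a b i j = begin
    when (squareFree? a ×-dec deg a ℕ.≟ i) 1ℚ ℚ.* Q j b
      ≡⟨ when-*ˡ (squareFree? a ×-dec deg a ℕ.≟ i) 1ℚ (Q j b) ⟩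
    when (squareFree? a ×-dec deg a ℕ.≟ i) (1ℚ ℚ.* Q j b)
      ≡⟨ cong (when (squareFree? a ×-dec deg a ℕ.≟ i)) (ℚ.*-identityˡ (Q j b)) ⟩
    when (squareFree? a ×-dec deg a ℕ.≟ i) (Q j b)
      ≡⟨ when-× (squareFree? a) (deg a ℕ.≟ i) _ ⟩
    when (squareFree? a) (when (deg a ℕ.≟ i) (when (deg b ℕ.≟ j) (sole alt 1 b)))
      ≡⟨ when-swap (squareFree? a) (deg a ℕ.≟ i) _ ⟩
    when (deg a ℕ.≟ i) (when (squareFree? a) (when (deg b ℕ.≟ j) (sole alt 1 b)))
      ≡⟨ when-cong (deg a ℕ.≟ i) (λ _ → when-swap (squareFree? a) (deg b ℕ.≟ j) _) ⟩
    when (deg a ℕ.≟ i) (when (deg b ℕ.≟ j) (g a b)) ∎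

IsOne⇒deg≡0 : ∀ {m} → IsOne m → deg m ≡ 0
IsOne⇒deg≡0 one rewrite supportFrom-[]⁺ 1 one = refl

weightedSum≡0 : ∀ {Z : A → Set} {next D} → (∀ i .{{_ : NonZero i}} x → D i x ≡ 0 → Z x) →
  (∀ i .{{_ : NonZero i}} → NonZero (next i)) →
  ∀ i .{{_ : NonZero i}} xs → weightedSum next D i xs ≡ 0 → All Z xs
weightedSum≡0              D0 nz i []       eq = []
weightedSum≡0 {next = next} {D} D0 nz i (x ∷ xs) eq =
  D0 i x (ℕ.m+n≡0⇒m≡0 (D i x) eq) ∷ weightedSum≡0 D0 nz (next i) {{nz i}} xs (ℕ.m+n≡0⇒n≡0 (D i x) eq)

deg≡0⇒IsOne : ∀ m → deg m ≡ 0 → IsOne m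
deg≡0⇒IsOne m deg≡0 = weightedSum≡0 {next = suc}
  (λ i → weightedSum≡0 {next = id} (λ { (suc i) x eq → ℕ.m+n≡0⇒m≡0 x eq }) (λ { (suc i) → _ }) i)
  (λ i → _) 1 m (trans (sym (deg≡ m)) deg≡0)

E⁺-zero : E⁺ 0 ≈ 𝟙
E⁺-zero m = trans (when-⇔ (squareFree? m ×-dec deg m ℕ.≟ 0) (isOne? m)
  (λ (_ , deg≡0) → deg≡0⇒IsOne m deg≡0)
  (λ one → All.map (All.map (λ { refl → z≤n })) one , IsOne⇒deg≡0 one))
  (sym (𝟙≈ m))

-- The term i = 0 of Newton's identity is `Q (suc n)` itself, because `E⁺ 0` is 1.
Q-suc : ∀ n m → Q (suc n) m ≡ fromℕ (suc n) ℚ.* E⁺ (suc n) m ℚ.- ∑² (splitsℕ n) (λ i j → (E⁺ (suc i) · Q j) m)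
Q-suc n m = begin
  Q (suc n) m
    ≡⟨ solve 2 (λ q r → q := (q :+ r) :+ (:- r)) refl (Q (suc n) m) R ⟩
  (Q (suc n) m ℚ.+ R) ℚ.- R
    ≡⟨ cong (ℚ._- R) (begin
         Q (suc n) m ℚ.+ R               ≡⟨ cong (ℚ._+ R) (trans (·-cong {G = Q (suc n)} E⁺-zero (λ _ → refl) m)
                                            (·-identityˡ (Q (suc n)) m)) ⟨
         (E⁺ 0 · Q (suc n)) m ℚ.+ R      ≡⟨ ∑²-splitsℕ-suc n (λ i j → (E⁺ i · Q j) m) ⟨
         ∑² (splitsℕ (suc n)) (λ i j → (E⁺ i · Q j) m)
                                       ≡⟨ newton-homogeneous (suc n) m ⟩
         fromℕ (suc n) ℚ.* E⁺ (suc n) m  ∎) ⟩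
  fromℕ (suc n) ℚ.* E⁺ (suc n) m ℚ.- R ∎
  where R = ∑² (splitsℕ n) (λ i j → (E⁺ (suc i) · Q j) m)

Q-zero : ∀ m → Q 0 m ≡ 0ℚ
Q-zero m = trans (when-cong (deg m ℕ.≟ 0) (λ deg≡0 → sole≡0 1 (deg≡0⇒IsOne m deg≡0))) (when-0 (deg m ℕ.≟ 0))
  where
  sole-row≡0 : ∀ i {es} → All (_≡ 0) es → sole-row alt i es ≡ 0ℚ
  sole-row≡0 i []          = refl
  sole-row≡0 i {_ ∷ es} (refl ∷ zs) = trans (cong₂ ℚ._+_
    (trans (cong (when (All.all? (ℕ._≟ 0) es)) (ℚ.*-zeroʳ (fromℕ i))) (when-0 (All.all? (ℕ._≟ 0) es)))
    (sole-row≡0 i zs)) (ℚ.+-identityʳ 0ℚ)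

  sole≡0 : ∀ i {m} → IsOne m → sole alt i m ≡ 0ℚ
  sole≡0 i [] = refl
  sole≡0 i {es ∷ m} (z ∷ zs) = trans (cong₂ ℚ._+_
    (trans (cong (when (isOne? m)) (sole-row≡0 i z)) (when-0 (isOne? m)))
    (trans (cong (when (All.all? (ℕ._≟ 0) es)) (sole≡0 (suc i) zs)) (when-0 (All.all? (ℕ._≟ 0) es))))
    (ℚ.+-identityʳ 0ℚ)

-- The coefficients of x/(1 - x) = x/(1 + x) + 2 x²/(1 - x²). Raising a positive exponent by 2
-- changes no term: `alt` has period 2 there, parity is kept, and the half of an even one stays
-- positive. From 0 to 2 `pos` jumps, which makes 2 a base case.
pos-alt : ∀ e → pos e ≡ alt e ℚ.+ fromℕ 2 ℚ.* when (2 ∣? e) (pos (e ℕ./ 2))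
pos-alt 0 = refl
pos-alt 1 = refl
pos-alt 2 = refl
pos-alt (suc (suc (suc e))) = trans (pos-alt (suc e)) (cong₂ (λ x y → x ℚ.+ fromℕ 2 ℚ.* y)
  (solve 1 (λ x → x := :- (:- x)) refl (alt (suc e)))
  (trans (when-cong (2 ∣? suc e) halves)
    (when-⇔ (2 ∣? suc e) (2 ∣? suc (suc (suc e))) (∣m∣n⇒∣m+n (divides 1 refl))
      (λ p → ∣m+n∣m⇒∣n p (divides 1 refl)))))
  where
  halves : 2 ∣ suc e → pos (suc e ℕ./ 2) ≡ pos (suc (suc (suc e)) ℕ./ 2)
  halves (divides (suc q) eq) = trans
    (cong pos (trans (cong (ℕ._/ 2) eq) (ℕ.m*n/n≡m (suc q) 2)))
    (sym (cong pos (trans (cong (λ k → (2 ℕ.+ k) ℕ./ 2) eq) (ℕ.m*n/n≡m (suc (suc q)) 2))))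

sole-pos : ∀ m → sole pos 1 m ≡ sole alt 1 m ℚ.+ fromℕ 2 ℚ.* dilate 2 (sole pos 1) m
sole-pos m = trans
  (atSole-linear zeros? suc (fromℕ 2)
    (atSole-linear (ℕ._≟ 0) id {Q = λ i e → fromℕ i ℚ.* pos e} (fromℕ 2) (λ i e → trans (cong (fromℕ i ℚ.*_) (pos-alt e))
      (solve 4 (λ i a t p → i :* (a :+ t :* p) := i :* a :+ t :* (i :* p)) refl
        (fromℕ i) (alt e) (fromℕ 2) (when (2 ∣? e) (pos (e ℕ./ 2))))))
    1 m)
  (cong (λ x → sole alt 1 m ℚ.+ fromℕ 2 ℚ.* x) (sym
    (atSole-dilate zeros? suc (All.all? (2 ∣?_)) (map (ℕ._/ 2))
      (all?-vanish (ℕ._≟ 0) id (2 ∣?_) (ℕ._/ 2) vanish)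
      (atSole-dilate (ℕ._≟ 0) id (2 ∣?_) (ℕ._/ 2) vanish (λ i e → sym (when-*ʳ (2 ∣? e) (fromℕ i) _)))
      1 m)))
  where
  zeros? = All.all? (ℕ._≟ 0)

  vanish : ∀ e h → when (2 ∣? e) (when (e ℕ./ 2 ℕ.≟ 0) h) ≡ when (e ℕ.≟ 0) h
  vanish e h = trans (sym (when-× (2 ∣? e) (e ℕ./ 2 ℕ.≟ 0) h))
    (when-⇔ (2 ∣? e ×-dec e ℕ./ 2 ℕ.≟ 0) (e ℕ.≟ 0)
      (λ { (divides q refl , eq) → cong (ℕ._* 2) (trans (sym (ℕ.m*n/n≡m q 2)) eq) })
      (λ { refl → divides 0 refl , refl }))

-- Reading the sole exponent off the support.

soleEntry : (ℕ → ℚ) → List (ℕ × ℕ × ℕ) → ℚ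
soleEntry c []                  = 0ℚ
soleEntry c ((i , _ , e) ∷ [])  = fromℕ i ℚ.* c e
soleEntry c (_ ∷ _ ∷ _)         = 0ℚ

soleEntry-++ : ∀ c xs ys → soleEntry c (xs ++ ys) ≡
               when (ys ≟ˢ []) (soleEntry c xs) ℚ.+ when (xs ≟ˢ []) (soleEntry c ys)
soleEntry-++ c []           []       = refl
soleEntry-++ c []           (y ∷ ys) = sym (ℚ.+-identityˡ _)
soleEntry-++ c (x ∷ [])     []       = sym (ℚ.+-identityʳ _)
soleEntry-++ c (x ∷ [])     (y ∷ ys) = refl
soleEntry-++ c (x ∷ _ ∷ xs) []       = refl
soleEntry-++ c (x ∷ _ ∷ xs) (y ∷ ys) = refl

-- The support omits exponents 0, whence the hypothesis on `c 0`: such entries must contribute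
-- nothing on the left either.
sole-row-support : ∀ c → c 0 ≡ 0ℚ → ∀ i j es → sole-row c i es ≡ soleEntry c (rowSupport i j es)
sole-row-support c c0 i j []           = refl
sole-row-support c c0 i j (zero ∷ es)  = trans
  (cong (ℚ._+ sole-row c i es) (trans (cong (when (All.all? (ℕ._≟ 0) es))
    (trans (cong (fromℕ i ℚ.*_) c0) (ℚ.*-zeroʳ (fromℕ i)))) (when-0 (All.all? (ℕ._≟ 0) es))))
  (trans (ℚ.+-identityˡ _) (sole-row-support c c0 i (suc j) es))
sole-row-support c c0 i j (suc e ∷ es) = begin
  when (All.all? (ℕ._≟ 0) es) (fromℕ i ℚ.* c (suc e)) ℚ.+ 0ℚ
    ≡⟨ ℚ.+-identityʳ _ ⟩
  when (All.all? (ℕ._≟ 0) es) (fromℕ i ℚ.* c (suc e))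
    ≡⟨ when-⇔ (All.all? (ℕ._≟ 0) es) (rs ≟ˢ []) (rowSupport-[]⁺ i (suc j)) (rowSupport-[]⁻ i (suc j) es) ⟩
  when (rs ≟ˢ []) (fromℕ i ℚ.* c (suc e))
    ≡⟨ ℚ.+-identityʳ _ ⟨
  when (rs ≟ˢ []) (fromℕ i ℚ.* c (suc e)) ℚ.+ 0ℚ
    ≡⟨ soleEntry-++ c ((i , j , suc e) ∷ []) rs ⟨
  soleEntry c ((i , j , suc e) ∷ rs) ∎
  where rs = rowSupport i (suc j) es

sole-support : ∀ c → c 0 ≡ 0ℚ → ∀ i m → sole c i m ≡ soleEntry c (supportFrom i m)
sole-support c c0 i []       = refl
sole-support c c0 i (es ∷ m) = begin
  when (isOne? m) (sole-row c i es) ℚ.+ when (All.all? (ℕ._≟ 0) es) (sole c (suc i) m)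
    ≡⟨ cong₂ ℚ._+_
         (trans (when-⇔ (isOne? m) (ss ≟ˢ []) (supportFrom-[]⁺ (suc i)) (supportFrom-[]⁻ (suc i) m))
                (cong (when (ss ≟ˢ [])) (sole-row-support c c0 i 1 es)))
         (trans (when-⇔ (All.all? (ℕ._≟ 0) es) (rs ≟ˢ []) (rowSupport-[]⁺ i 1) (rowSupport-[]⁻ i 1 es))
                (cong (when (rs ≟ˢ [])) (sole-support c c0 (suc i) m))) ⟩
  when (ss ≟ˢ []) (soleEntry c rs) ℚ.+ when (rs ≟ˢ []) (soleEntry c ss)
    ≡⟨ soleEntry-++ c rs ss ⟨
  soleEntry c (rs ++ ss) ∎
  where
  rs = rowSupport i 1 es
  ss = supportFrom (suc i) m

-- P in terms of Q

-- `P` cuts off its sum over j at the width of the monomial; with `w` that width, this says that the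
-- cut loses nothing.
InRange : ℕ → ℕ × ℕ × ℕ → Set
InRange w (i , j , e) = 0 < i × 0 < j × j ≤ w × 0 < e

rowSupport-inRange : ∀ {w} i j es → 0 < i → 0 < j → length es ℕ.+ j ≤ suc w → All (InRange w) (rowSupport i j es)
rowSupport-inRange i j []           0<i 0<j le = []
rowSupport-inRange {w} i j (e ∷ es) 0<i 0<j le with rest ← rowSupport-inRange i (suc j) es 0<i (s≤s z≤n)
                                                      (subst (_≤ suc w) (sym (ℕ.+-suc (length es) j)) le) | e
... | zero  = rest
... | suc _ = (0<i , 0<j , ℕ.≤-trans (ℕ.m≤n+m j (length es)) (ℕ.≤-pred le) , s≤s z≤n) ∷ rest

supportFrom-inRange : ∀ {w} i m → 0 < i → width m ≤ w → All (InRange w) (supportFrom i m)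
supportFrom-inRange     i []       0<i le = []
supportFrom-inRange {w} i (es ∷ m) 0<i le = All.++⁺
  (rowSupport-inRange i 1 es 0<i (s≤s z≤n)
    (subst (_≤ suc w) (ℕ.+-comm 1 (length es)) (s≤s (ℕ.≤-trans (ℕ.m≤m⊔n (length es) (width m)) le))))
  (supportFrom-inRange (suc i) m (s≤s z≤n) (ℕ.≤-trans (ℕ.m≤n⊔m (length es) (width m)) le))

singleton-injective : ∀ {i j e i′ j′ e′ : ℕ} →
                      _≡_ {A = List (ℕ × ℕ × ℕ)} ((i , j , e) ∷ []) ((i′ , j′ , e′) ∷ []) → i ≡ i′ × j ≡ j′ × e ≡ e′
singleton-injective refl = refl , refl , refl

-- When the support is a single power x_{i,j}^e with i e = d, the double sum matches only at k = i
-- and this j, which is in range since i ≤ i e and j is at most the width. Every other monomial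
-- matches no term.
P≡ : ∀ d m → P d m ≡ when (deg m ℕ.≟ d) (sole pos 1 m)
P≡ d m = trans (pure (support m) (supportFrom-inRange 1 m (s≤s z≤n) ℕ.≤-refl))
  (cong (when (deg m ℕ.≟ d)) (sym (sole-support pos refl 1 m)))
  where
  term : List (ℕ × ℕ × ℕ) → ℕ → ℕ → ℚ
  term xs k j = when (suc k ∣? d ×-dec xs ≟ˢ ((suc k , suc j , d ℕ./ suc k) ∷ [])) (fromℕ (suc k))

  total : List (ℕ × ℕ × ℕ) → ℚ
  total xs = ∑ (upTo d) (λ k → ∑ (upTo (width m)) (term xs k))

  total≡0 : ∀ xs → (∀ k j → suc k ∣ d → xs ≢ (suc k , suc j , d ℕ./ suc k) ∷ []) → total xs ≡ 0ℚ
  total≡0 xs xs≢ = ∑-zero (upTo d) (λ {k} _ → ∑-zero (upTo (width m)) (λ {j} _ →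
    when-false (suc k ∣? d ×-dec xs ≟ˢ ((suc k , suc j , d ℕ./ suc k) ∷ []))
               (λ (k∣d , eq) → xs≢ k j k∣d eq)))

  pure : ∀ xs → All (InRange (width m)) xs →
         total xs ≡ when (sum (map entryWeight xs) ℕ.≟ d) (soleEntry pos xs)
  pure [] [] = trans (total≡0 [] (λ _ _ _ ())) (sym (when-0 (0 ℕ.≟ d)))
  pure xs@(_ ∷ _ ∷ _) _ = trans (total≡0 xs (λ _ _ _ ())) (sym (when-0 (sum (map entryWeight xs) ℕ.≟ d)))
  pure xs@((suc i , suc j , suc e) ∷ []) ((_ , _ , j<w , _) ∷ []) with suc i ℕ.* suc e ℕ.≟ d
  ... | no ie≢d = trans
    (total≡0 xs (λ k j′ k∣d eq → let i≡k , _ , e≡ = singleton-injective {i = suc i} eq in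
      ie≢d (trans (cong₂ ℕ._*_ i≡k e≡) (ℕ.m*[n/m]≡n {suc k} k∣d))))
    (sym (when-false (suc i ℕ.* suc e ℕ.+ 0 ℕ.≟ d) (λ eq → ie≢d (trans (sym (ℕ.+-identityʳ _)) eq))))
  ... | yes refl = begin
    ∑ (upTo d) (λ k → ∑ (upTo (width m)) (term xs k))
      ≡⟨ ∑-isolate (λ k → ∑ (upTo (width m)) (term xs k)) (Unique.upTo⁺ d)
           (∈-upTo⁺ (ℕ.m≤m*n (suc i) (suc e)))
           (λ {k} _ k≢i → ∑-zero (upTo (width m)) (λ {j′} _ → when-false
             (suc k ∣? d ×-dec xs ≟ˢ ((suc k , suc j′ , d ℕ./ suc k) ∷ [])) (λ (_ , eq) →
               k≢i (sym (ℕ.suc-injective (proj₁ (singleton-injective eq))))))) ⟩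
    ∑ (upTo (width m)) (term xs i)
      ≡⟨ ∑-isolate (term xs i) (Unique.upTo⁺ (width m)) (∈-upTo⁺ j<w)
           (λ {j′} _ j′≢j → when-false
             (suc i ∣? d ×-dec xs ≟ˢ ((suc i , suc j′ , d ℕ./ suc i) ∷ [])) (λ (_ , eq) →
               j′≢j (sym (ℕ.suc-injective (proj₁ (proj₂ (singleton-injective eq))))))) ⟩
    term xs i j
      ≡⟨ when-true (suc i ∣? d ×-dec xs ≟ˢ ((suc i , suc j , d ℕ./ suc i) ∷ []))
           (m∣m*n (suc e) , cong (λ q → (suc i , suc j , q) ∷ []) (sym cancel)) ⟩
    fromℕ (suc i)
      ≡⟨ ℚ.*-identityʳ _ ⟨
    fromℕ (suc i) ℚ.* 1ℚ
      ≡⟨ when-true (suc i ℕ.* suc e ℕ.+ 0 ℕ.≟ d) (ℕ.+-identityʳ _) ⟨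
    when (suc i ℕ.* suc e ℕ.+ 0 ℕ.≟ d) (fromℕ (suc i) ℚ.* 1ℚ) ∎
    where
    cancel : d ℕ./ suc i ≡ suc e
    cancel = trans (cong (ℕ._/ suc i) (ℕ.*-comm (suc i) (suc e))) (ℕ.m*n/n≡m (suc e) (suc i))

-- `sole-pos` in degree d. A monomial with even exponents has twice the degree of its square root,
-- so having degree d means that d is even and the root has degree d / 2.
P-rec : ∀ d m → P d m ≡ Q d m ℚ.+ fromℕ 2 ℚ.* when (2 ∣? d) (dilate 2 (P (d ℕ./ 2)) m)
P-rec d m = begin
  P d m
    ≡⟨ trans (P≡ d m) (cong (when (deg m ℕ.≟ d)) (sole-pos m)) ⟩
  when (deg m ℕ.≟ d) (sole alt 1 m ℚ.+ fromℕ 2 ℚ.* dilate 2 (sole pos 1) m)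
    ≡⟨ trans (when-+ (deg m ℕ.≟ d) _ _) (cong (Q d m ℚ.+_) (sym (when-*ʳ (deg m ℕ.≟ d) (fromℕ 2) _))) ⟩
  Q d m ℚ.+ fromℕ 2 ℚ.* when (deg m ℕ.≟ d) (when (divisible? 2 m) (sole pos 1 m/2))
    ≡⟨ cong (λ x → Q d m ℚ.+ fromℕ 2 ℚ.* x) (begin
         when (deg m ℕ.≟ d) (when (divisible? 2 m) (sole pos 1 m/2))
           ≡⟨ when-swap (deg m ℕ.≟ d) (divisible? 2 m) _ ⟩
         when (divisible? 2 m) (when (deg m ℕ.≟ d) (sole pos 1 m/2))
           ≡⟨ when-cong (divisible? 2 m) halve ⟩
         when (divisible? 2 m) (when (2 ∣? d) (P (d ℕ./ 2) m/2))
           ≡⟨ when-swap (divisible? 2 m) (2 ∣? d) _ ⟩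
         when (2 ∣? d) (dilate 2 (P (d ℕ./ 2)) m) ∎) ⟩
  Q d m ℚ.+ fromℕ 2 ℚ.* when (2 ∣? d) (dilate 2 (P (d ℕ./ 2)) m) ∎
  where
  m/2 = map (map (ℕ._/ 2)) m

  halve : All (All (2 ∣_)) m → when (deg m ℕ.≟ d) (sole pos 1 m/2) ≡ when (2 ∣? d) (P (d ℕ./ 2) m/2)
  halve 2∣m = begin
    when (deg m ℕ.≟ d) (sole pos 1 m/2)
      ≡⟨ when-⇔ (deg m ℕ.≟ d) (2 ∣? d ×-dec deg m/2 ℕ.≟ d ℕ./ 2)
           (λ { refl → divides (deg m/2) (trans (deg-dilate 2 2∣m) (ℕ.*-comm 2 (deg m/2))) ,
                       sym (trans (cong (ℕ._/ 2) (trans (deg-dilate 2 2∣m) (ℕ.*-comm 2 (deg m/2))))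
                                  (ℕ.m*n/n≡m (deg m/2) 2)) })
           (λ (2∣d , eq) → trans (deg-dilate 2 2∣m) (trans (cong (2 ℕ.*_) eq) (ℕ.m*[n/m]≡n 2∣d))) ⟩
    when (2 ∣? d ×-dec deg m/2 ℕ.≟ d ℕ./ 2) (sole pos 1 m/2)
      ≡⟨ when-× (2 ∣? d) (deg m/2 ℕ.≟ d ℕ./ 2) _ ⟩
    when (2 ∣? d) (when (deg m/2 ℕ.≟ d ℕ./ 2) (sole pos 1 m/2))
      ≡⟨ cong (when (2 ∣? d)) (P≡ (d ℕ./ 2) m/2) ⟨
    when (2 ∣? d) (P (d ℕ./ 2) m/2) ∎

-- Expansion of P over singular rows

last-∷⁺ : ∀ (x : A) xs → List⁺.last (x ∷⁺ xs) ≡ List⁺.last xs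
last-∷⁺ x (y ∷ ys) with initLast ys
... | []       = refl
... | _ ∷ʳ′ _  = refl

last-map : ∀ (f : A → B) x xs → List⁺.last (List⁺.map f (x ∷ xs)) ≡ f (List⁺.last (x ∷ xs))
last-map f x []       = refl
last-map f x (y ∷ ys) = trans (last-∷⁺ (f x) (f y ∷ map f ys))
  (trans (last-map f y ys) (cong f (sym (last-∷⁺ x (y ∷ ys)))))

-- The share of one row in the coefficient. The sign counts the bricks after the first, as the row
-- itself is one block of σ.
rowWeight : List⁺ Brick → ℤ
rowWeight bs = -1ℤ ℤ.^ length (List⁺.tail bs) ℤ.* ℤ.+ brickLength (List⁺.last bs)

rowWeight-∷⁺ : ∀ b bs → rowWeight (b ∷⁺ bs) ≡ ℤ.- rowWeight bs
rowWeight-∷⁺ b bs@(_ ∷ cs) = begin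
  -1ℤ ℤ.* s ℤ.* ℤ.+ brickLength (List⁺.last (b ∷⁺ bs))  ≡⟨ cong (λ c → -1ℤ ℤ.* s ℤ.* ℤ.+ brickLength c) (last-∷⁺ b bs) ⟩
  -1ℤ ℤ.* s ℤ.* ℤ.+ brickLength (List⁺.last bs)         ≡⟨ ℤ.*-assoc -1ℤ s _ ⟩
  -1ℤ ℤ.* rowWeight bs                                  ≡⟨ ℤ.-1*i≡-i (rowWeight bs) ⟩
  ℤ.- rowWeight bs                                      ∎
  where s = -1ℤ ℤ.^ length cs

-- The quotient stays and the multiplicity of the resulting block doubles, so on products of `E⁺`
-- this is the substitution of x² for x.
double : Brick → Brick
double (brick k b) = brick (suc k) b

brickLength-double : ∀ b → brickLength (double b) ≡ 2 ℕ.* brickLength b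
brickLength-double (brick k b) = ℕ.*-assoc 2 (2 ℕ.^ k) b

rowWeight-double : ∀ bs → rowWeight (List⁺.map double bs) ≡ ℤ.+ 2 ℤ.* rowWeight bs
rowWeight-double bs@(c ∷ cs) = begin
  -1ℤ ℤ.^ length (map double cs) ℤ.* ℤ.+ brickLength (List⁺.last (List⁺.map double bs))
    ≡⟨ cong₂ (λ l c → -1ℤ ℤ.^ l ℤ.* ℤ.+ brickLength c) (List.length-map double cs) (last-map double c cs) ⟩
  s ℤ.* ℤ.+ brickLength (double (List⁺.last bs))
    ≡⟨ cong (s ℤ.*_) (trans (cong ℤ.+_ (brickLength-double (List⁺.last bs)))
         (ℤ.pos-* 2 (brickLength (List⁺.last bs)))) ⟩
  s ℤ.* (ℤ.+ 2 ℤ.* ℤ.+ brickLength (List⁺.last bs))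
    ≡⟨ ℤ.*-assoc s (ℤ.+ 2) _ ⟨
  s ℤ.* ℤ.+ 2 ℤ.* ℤ.+ brickLength (List⁺.last bs)
    ≡⟨ cong (ℤ._* ℤ.+ brickLength (List⁺.last bs)) (ℤ.*-comm s (ℤ.+ 2)) ⟩
  ℤ.+ 2 ℤ.* s ℤ.* ℤ.+ brickLength (List⁺.last bs)
    ≡⟨ ℤ.*-assoc (ℤ.+ 2) s _ ⟩
  ℤ.+ 2 ℤ.* rowWeight bs ∎
  where s = -1ℤ ℤ.^ length cs

rowProduct : (r : ℕ) .{{_ : NonZero r}} → List⁺ Brick → PowerSeries
rowProduct r bs = blockProduct E⁺ (map (brickBlock r) (toList bs))

block-cong : ∀ {d d′ r r′} .{{_ : NonZero r}} .{{_ : NonZero r′}} → d ≡ d′ → r ≡ r′ → block d r ≡ block d′ r′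
block-cong refl refl = refl

dilate-cong-ℕ : ∀ {r r′} .{{_ : NonZero r}} .{{_ : NonZero r′}} → r ≡ r′ → ∀ F → dilate r F ≈ dilate r′ F
dilate-cong-ℕ refl F m = refl

-- The rows of n + h + 1 cells made of 0-bricks, the first having at least h + 1 cells.
compositions : ℕ → ℕ → List (List⁺ Brick)
compositions h zero    = (brick 0 (suc h) ∷ []) ∷ []
compositions h (suc n) = compositions (suc h) n ++ map (brick 0 (suc h) ∷⁺_) (compositions 0 n)

module _ (r : ℕ) .{{_ : NonZero r}} where

  rowTerm : Monomial → List⁺ Brick → ℚ
  rowTerm m bs = fromℤ (rowWeight bs) ℚ.* rowProduct r bs m

  dilate-neg-∑² : ∀ (c : ℚ) E (xs : List (A × B)) (F : A → B → PowerSeries) m →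
    when (divisible? r m) (c ℚ.* E (map (map (ℕ._/ r)) m) ℚ.- ∑² xs (λ i j → F i j (map (map (ℕ._/ r)) m))) ≡
    c ℚ.* dilate r E m ℚ.- ∑² xs (λ i j → dilate r (F i j) m)
  dilate-neg-∑² c E xs F m with does (divisible? r m)
  ... | true  = refl
  ... | false = sym (trans (cong (λ x → c ℚ.* 0ℚ ℚ.- x) (∑-zero xs (λ _ → refl)))
    (solve 1 (λ c → c :* con 0ℚ :+ (:- con 0ℚ) := con 0ℚ) refl c))

  -- Induction on `n` for all `h`, along the two halves of `compositions`. A first brick longer than
  -- h + 1 raises `h`. A first brick of exactly h + 1 cells changes the sign and multiplies the sum
  -- over all rows of the remaining cells, a dilated `Q`, by the dilated `E⁺ (suc h)`: this is the
  -- term i = 0 on the right.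
  ∑-compositions : ∀ h n m → ∑ (compositions h n) (rowTerm m) ≡
    fromℕ (n ℕ.+ suc h) ℚ.* dilate r (E⁺ (n ℕ.+ suc h)) m ℚ.-
    ∑² (splitsℕ n) (λ i j → (dilate r (E⁺ (i ℕ.+ suc h)) · dilate r (Q j)) m)

  -- For h = 0 the right side becomes that of `Q-suc`. The proof is mutual with `∑-compositions`,
  -- which needs this case for the cells after the first brick.
  ∑-compositions-0 : ∀ n m → ∑ (compositions 0 n) (rowTerm m) ≡ dilate r (Q (suc n)) m
  ∑-compositions-0 n m = begin
    ∑ (compositions 0 n) (rowTerm m)
      ≡⟨ ∑-compositions 0 n m ⟩
    fromℕ (n ℕ.+ 1) ℚ.* dilate r (E⁺ (n ℕ.+ 1)) m ℚ.-
    ∑² (splitsℕ n) (λ i j → (dilate r (E⁺ (i ℕ.+ 1)) · dilate r (Q j)) m)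
      ≡⟨ cong₂ (λ k s → fromℕ k ℚ.* dilate r (E⁺ k) m ℚ.- s) (ℕ.+-comm n 1)
           (∑²-cong (splitsℕ n) (λ i j → trans
             (cong (λ k → (dilate r (E⁺ k) · dilate r (Q j)) m) (ℕ.+-comm i 1))
             (sym (dilate-· r (E⁺ (suc i)) (Q j) m)))) ⟩
    fromℕ (suc n) ℚ.* dilate r (E⁺ (suc n)) m ℚ.- ∑² (splitsℕ n) (λ i j → dilate r (E⁺ (suc i) · Q j) m)
      ≡⟨ dilate-neg-∑² (fromℕ (suc n)) (E⁺ (suc n)) (splitsℕ n) (λ i j → E⁺ (suc i) · Q j) m ⟨
    when (divisible? r m) (fromℕ (suc n) ℚ.* E⁺ (suc n) m/r ℚ.- ∑² (splitsℕ n) (λ i j → (E⁺ (suc i) · Q j) m/r))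
      ≡⟨ when-cong (divisible? r m) (λ _ → sym (Q-suc n m/r)) ⟩
    dilate r (Q (suc n)) m ∎
    where m/r = map (map (ℕ._/ r)) m

  ∑-compositions h zero m = begin
    fromℤ (rowWeight (b ∷ [])) ℚ.* (dilate (1 ℕ.* r) {{ℕ.m*n≢0 1 r}} (E⁺ (suc h)) · 𝟙) m ℚ.+ 0ℚ
      ≡⟨ ℚ.+-identityʳ _ ⟩
    fromℤ (rowWeight (b ∷ [])) ℚ.* (dilate (1 ℕ.* r) {{ℕ.m*n≢0 1 r}} (E⁺ (suc h)) · 𝟙) m
      ≡⟨ cong₂ ℚ._*_
           (cong fromℤ (trans (ℤ.*-identityˡ (ℤ.+ (1 ℕ.* suc h))) (cong ℤ.+_ (ℕ.*-identityˡ (suc h)))))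
           (trans (·-identityʳ (dilate (1 ℕ.* r) {{ℕ.m*n≢0 1 r}} (E⁺ (suc h))) m)
                  (dilate-cong-ℕ {{ℕ.m*n≢0 1 r}} (ℕ.*-identityˡ r) (E⁺ (suc h)) m)) ⟩
    fromℕ (suc h) ℚ.* dilate r (E⁺ (suc h)) m
      ≡⟨ solve 1 (λ x → x := x :+ (:- (con 0ℚ :+ con 0ℚ))) refl _ ⟩
    fromℕ (suc h) ℚ.* dilate r (E⁺ (suc h)) m ℚ.- (0ℚ ℚ.+ 0ℚ)
      -- The only pair with sum 0 is (0, 0), and its product vanishes because `Q 0` does.
      ≡⟨ cong (λ z → fromℕ (suc h) ℚ.* dilate r (E⁺ (suc h)) m ℚ.- (z ℚ.+ 0ℚ)) (sym (∑-zero (factorisations m) (λ {p} _ →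
           trans (cong (dilate r (E⁺ (suc h)) (proj₁ p) ℚ.*_)
             (trans (when-cong (divisible? r (proj₂ p)) (λ _ → Q-zero (map (map (ℕ._/ r)) (proj₂ p))))
                    (when-0 (divisible? r (proj₂ p)))))
             (ℚ.*-zeroʳ (dilate r (E⁺ (suc h)) (proj₁ p)))))) ⟩
    fromℕ (suc h) ℚ.* dilate r (E⁺ (suc h)) m ℚ.- ((dilate r (E⁺ (suc h)) · dilate r (Q 0)) m ℚ.+ 0ℚ) ∎
    where
    b = brick 0 (suc h)
  ∑-compositions h (suc n) m = begin
    ∑ (compositions (suc h) n ++ map (b ∷⁺_) (compositions 0 n)) (rowTerm m)
      ≡⟨ trans (∑-++ (compositions (suc h) n) _ (rowTerm m))
           (cong (∑ (compositions (suc h) n) (rowTerm m) ℚ.+_) (∑-map (b ∷⁺_) (compositions 0 n) (rowTerm m))) ⟩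
    ∑ (compositions (suc h) n) (rowTerm m) ℚ.+ ∑ (compositions 0 n) (λ bs → rowTerm m (b ∷⁺ bs))
      ≡⟨ cong₂ ℚ._+_ (trans (∑-compositions (suc h) n m) (cong₂ (λ k s → fromℕ k ℚ.* dilate r (E⁺ k) m ℚ.- s)
           (ℕ.+-suc n (suc h))
           (∑²-cong (splitsℕ n) (λ i j → cong (λ k → (dilate r (E⁺ k) · dilate r (Q j)) m) (ℕ.+-suc i (suc h))))))
         (begin
           ∑ (compositions 0 n) (λ bs → rowTerm m (b ∷⁺ bs))
             ≡⟨ ∑-cong (compositions 0 n) prepend ⟩
           ∑ (compositions 0 n) (λ bs → ℚ.- 1ℚ ℚ.* (fromℤ (rowWeight bs) ℚ.* (E · rowProduct r bs) m))
             ≡⟨ ∑-*ˡ (ℚ.- 1ℚ) (compositions 0 n) _ ⟩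
           ℚ.- 1ℚ ℚ.* ∑ (compositions 0 n) (λ bs → fromℤ (rowWeight bs) ℚ.* (E · rowProduct r bs) m)
             ≡⟨ cong (ℚ.- 1ℚ ℚ.*_) (sym (·-distribˡ-∑ E (compositions 0 n) (fromℤ ∘ rowWeight) (rowProduct r) m)) ⟩
           ℚ.- 1ℚ ℚ.* (E · (λ m′ → ∑ (compositions 0 n) (rowTerm m′))) m
             ≡⟨ cong (ℚ.- 1ℚ ℚ.*_) (·-cong {F = E} (λ _ → refl) (∑-compositions-0 n) m) ⟩
           ℚ.- 1ℚ ℚ.* (E · dilate r (Q (suc n))) m ∎) ⟩
    (c ℚ.* e ℚ.- S) ℚ.+ ℚ.- 1ℚ ℚ.* (E · dilate r (Q (suc n))) m
      ≡⟨ solve 4 (λ c e s x → (c :* e :+ (:- s)) :+ (con (ℚ.- 1ℚ)) :* x := c :* e :+ (:- (x :+ s))) refl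
           c e S ((E · dilate r (Q (suc n))) m) ⟩
    c ℚ.* e ℚ.- ((E · dilate r (Q (suc n))) m ℚ.+ S)
      ≡⟨ cong (λ x → c ℚ.* e ℚ.- x) (∑²-splitsℕ-suc n (λ i j → (dilate r (E⁺ (i ℕ.+ suc h)) · dilate r (Q j)) m)) ⟨
    c ℚ.* e ℚ.- ∑² (splitsℕ (suc n)) (λ i j → (dilate r (E⁺ (i ℕ.+ suc h)) · dilate r (Q j)) m) ∎
    where
    b = brick 0 (suc h)
    c = fromℕ (suc n ℕ.+ suc h)
    e = dilate r (E⁺ (suc n ℕ.+ suc h)) m
    E = dilate r (E⁺ (suc h))
    S = ∑² (splitsℕ n) (λ i j → (dilate r (E⁺ (suc i ℕ.+ suc h)) · dilate r (Q j)) m)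

    prepend : ∀ bs → rowTerm m (b ∷⁺ bs) ≡ ℚ.- 1ℚ ℚ.* (fromℤ (rowWeight bs) ℚ.* (E · rowProduct r bs) m)
    prepend bs@(_ ∷ _) = trans
      (cong₂ ℚ._*_
        (trans (cong fromℤ (trans (rowWeight-∷⁺ b bs) (sym (ℤ.-1*i≡-i (rowWeight bs)))))
               (fromℤ-* -1ℤ (rowWeight bs)))
        (·-cong {G = rowProduct r bs} (dilate-cong-ℕ {{ℕ.m*n≢0 1 r}} (ℕ.*-identityˡ r) (E⁺ (suc h))) (λ _ → refl) m))
      (ℚ.*-assoc (ℚ.- 1ℚ) (fromℤ (rowWeight bs)) _)

keep : {P : Set} → Dec P → List A → List A
keep (yes _) xs = xs
keep (no _)  xs = []

∑-keep : {P : Set} (P? : Dec P) (xs : List A) (f : A → ℚ) → ∑ (keep P? xs) f ≡ when P? (∑ xs f)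
∑-keep (yes _) xs f = refl
∑-keep (no _)  xs f = refl

-- The singular rows of d cells, for 0 < d ≤ f.
singularRows : ℕ → ℕ → List (List⁺ Brick)
singularRows zero    d = []
singularRows (suc f) d =
  compositions 0 (pred d) ++ keep (2 ∣? d) (map (List⁺.map double) (singularRows f (d ℕ./ 2)))

-- A factor 2 moves from the marking to the tensor factor: marking k + 1 in factor r and marking k
-- in factor 2 r give the same multiplicity.
rowProduct-double : ∀ r .{{_ : NonZero r}} .{{_ : NonZero (r ℕ.* 2)}} bs →
                    rowProduct r (List⁺.map double bs) ≡ rowProduct (r ℕ.* 2) bs
rowProduct-double r (b ∷ bs) = cong (blockProduct E⁺)
  (cong₂ _∷_ (blocks≡ b) (trans (sym (List.map-∘ bs)) (List.map-cong blocks≡ bs)))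
  where
  blocks≡ : ∀ b → brickBlock r (double b) ≡ brickBlock (r ℕ.* 2) b
  blocks≡ (brick k b) = block-cong
    {{ℕ.m*n≢0 (2 ℕ.^ suc k) r {{ℕ.m^n≢0 2 (suc k)}}}} {{ℕ.m*n≢0 (2 ℕ.^ k) (r ℕ.* 2) {{ℕ.m^n≢0 2 k}}}} refl (begin
    2 ℕ.^ suc k ℕ.* r      ≡⟨ cong (ℕ._* r) (ℕ.*-comm 2 (2 ℕ.^ k)) ⟩
    2 ℕ.^ k ℕ.* 2 ℕ.* r    ≡⟨ ℕ.*-assoc (2 ℕ.^ k) 2 r ⟩
    2 ℕ.^ k ℕ.* (2 ℕ.* r)  ≡⟨ cong (2 ℕ.^ k ℕ.*_) (ℕ.*-comm 2 r) ⟩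
    2 ℕ.^ k ℕ.* (r ℕ.* 2)  ∎)

d/2<d : ∀ {d} → 0 < d → d ℕ./ 2 < d
d/2<d {suc d} _ = ℕ.m/n<m (suc d) 2 (s≤s (s≤s z≤n))

0<d/2 : ∀ {d} → 0 < d → 2 ∣ d → 0 < d ℕ./ 2
0<d/2 _ (divides (suc q) refl) = subst (0 <_) (sym (ℕ.m*n/n≡m (suc q) 2)) (s≤s z≤n)

-- The two parts of the list are the two terms of `P-rec`: rows of 0-bricks give `Q d`, doubled rows
-- of d / 2 cells the rest, with the factor 2 coming from the last brick. All `r` are needed, as
-- doubling leads from `r` to `r * 2`; `f` bounds the depth of the halving.
∑-singularRows : ∀ f d r .{{_ : NonZero r}} → 0 < d → d ≤ f → ∀ m →
  ∑ (singularRows f d) (rowTerm r m) ≡ dilate r (P d) m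
∑-singularRows zero    (suc d) r 0<d () m
∑-singularRows (suc f) d@(suc d′) r 0<d d≤f m = begin
  ∑ (compositions 0 d′ ++ keep (2 ∣? d) (map (List⁺.map double) (singularRows f (d ℕ./ 2)))) (rowTerm r m)
    ≡⟨ trans (∑-++ (compositions 0 d′) _ (rowTerm r m)) (cong₂ ℚ._+_
         (∑-compositions-0 r d′ m)
         (trans (∑-keep (2 ∣? d) _ (rowTerm r m)) (when-cong (2 ∣? d) doubled))) ⟩
  dilate r (Q d) m ℚ.+ when (2 ∣? d) (fromℕ 2 ℚ.* dilate (r ℕ.* 2) (P (d ℕ./ 2)) m)
    ≡⟨ cong (dilate r (Q d) m ℚ.+_) (trans
         (when-cong (2 ∣? d) (λ _ → cong (fromℕ 2 ℚ.*_) (sym (dilate-dilate r 2 (P (d ℕ./ 2)) m))))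
         (trans (sym (when-*ʳ (2 ∣? d) (fromℕ 2) _)) (cong (fromℕ 2 ℚ.*_) (when-swap (2 ∣? d) (divisible? r m) _)))) ⟩
  dilate r (Q d) m ℚ.+ fromℕ 2 ℚ.* when (divisible? r m) (when (2 ∣? d) (dilate 2 (P (d ℕ./ 2)) m/r))
    ≡⟨ cong (dilate r (Q d) m ℚ.+_) (when-*ʳ (divisible? r m) (fromℕ 2) _) ⟩
  dilate r (Q d) m ℚ.+ when (divisible? r m) (fromℕ 2 ℚ.* when (2 ∣? d) (dilate 2 (P (d ℕ./ 2)) m/r))
    ≡⟨ when-+ (divisible? r m) _ _ ⟨
  when (divisible? r m) (Q d m/r ℚ.+ fromℕ 2 ℚ.* when (2 ∣? d) (dilate 2 (P (d ℕ./ 2)) m/r))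
    ≡⟨ when-cong (divisible? r m) (λ _ → sym (P-rec d m/r)) ⟩
  dilate r (P d) m ∎
  where
  instance
    r2≢0 : NonZero (r ℕ.* 2)
    r2≢0 = ℕ.m*n≢0 r 2
  m/r = map (map (ℕ._/ r)) m
  rows/2 = singularRows f (d ℕ./ 2)

  term : ∀ bs → rowTerm r m (List⁺.map double bs) ≡ fromℕ 2 ℚ.* rowTerm (r ℕ.* 2) m bs
  term bs = trans
    (cong₂ ℚ._*_ (trans (cong fromℤ (rowWeight-double bs)) (fromℤ-* (ℤ.+ 2) (rowWeight bs)))
               (cong (λ F → F m) (rowProduct-double r bs)))
    (ℚ.*-assoc (fromℕ 2) (fromℤ (rowWeight bs)) _)

  doubled : 2 ∣ d → ∑ (map (List⁺.map double) rows/2) (rowTerm r m) ≡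
                    fromℕ 2 ℚ.* dilate (r ℕ.* 2) (P (d ℕ./ 2)) m
  doubled 2∣d = begin
    ∑ (map (List⁺.map double) rows/2) (rowTerm r m)
      ≡⟨ ∑-map (List⁺.map double) rows/2 (rowTerm r m) ⟩
    ∑ rows/2 (λ bs → rowTerm r m (List⁺.map double bs))
      ≡⟨ trans (∑-cong rows/2 term) (∑-*ˡ (fromℕ 2) rows/2 (rowTerm (r ℕ.* 2) m)) ⟩
    fromℕ 2 ℚ.* ∑ rows/2 (rowTerm (r ℕ.* 2) m)
      ≡⟨ cong (fromℕ 2 ℚ.*_) (∑-singularRows f (d ℕ./ 2) (r ℕ.* 2) (0<d/2 0<d 2∣d)
           (ℕ.≤-pred (ℕ.≤-trans (d/2<d 0<d) d≤f)) m) ⟩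
    fromℕ 2 ℚ.* dilate (r ℕ.* 2) (P (d ℕ./ 2)) m ∎

-- Enumeration of the singular rows

∈-keep⁺ : {P : Set} (P? : Dec P) {xs : List A} {x : A} → P → x ∈ xs → x ∈ keep P? xs
∈-keep⁺ (yes _) p x∈ = x∈
∈-keep⁺ (no ¬p) p x∈ = contradiction p ¬p

∈-keep⁻ : {P : Set} (P? : Dec P) {xs : List A} {x : A} → x ∈ keep P? xs → P × x ∈ xs
∈-keep⁻ (yes p) x∈ = p , x∈

rowLength : List⁺ Brick → ℕ
rowLength bs = sum (map brickLength (toList bs))

HasMarking : ℕ → List⁺ Brick → Set
HasMarking k bs = All (λ b → marking b ≡ k) (toList bs)

-- The bound on the first brick is what keeps the two halves of `compositions h (suc n)` apart in
-- `compositions-unique`.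
compositions-sound : ∀ h n {bs} → bs ∈ compositions h n →
  HasMarking 0 bs × rowLength bs ≡ n ℕ.+ suc h × suc h ≤ quotient (List⁺.head bs)
compositions-sound h zero    (here refl) =
  refl ∷ [] , trans (ℕ.+-identityʳ _) (ℕ.+-identityʳ (suc h)) , ℕ.≤-refl
compositions-sound h (suc n) bs∈ with ∈-++⁻ (compositions (suc h) n) bs∈
... | inj₁ bs∈₁ with mk , len , le ← compositions-sound (suc h) n bs∈₁ =
  mk , trans len (ℕ.+-suc n (suc h)) , ℕ.≤-trans (ℕ.n≤1+n (suc h)) le
... | inj₂ bs∈₂ with cs@(_ ∷ _) , cs∈ , refl ← ∈-map⁻ _ bs∈₂ with mk , len , _ ← compositions-sound 0 n cs∈ =
  refl ∷ mk , trans (cong₂ ℕ._+_ (ℕ.+-identityʳ (suc h)) (trans len (ℕ.+-comm n 1))) (ℕ.+-comm (suc h) (suc n)) ,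
  ℕ.≤-refl

∷⁺-injectiveʳ : ∀ {x y : A} {xs ys} → x ∷⁺ xs ≡ y ∷⁺ ys → xs ≡ ys
∷⁺-injectiveʳ {xs = _ ∷ _} {_ ∷ _} refl = refl

compositions-unique : ∀ h n → Unique (compositions h n)
compositions-unique h zero    = [] ∷ []
compositions-unique h (suc n) = Unique.++⁺ (compositions-unique (suc h) n)
  (Unique.map⁺ ∷⁺-injectiveʳ (compositions-unique 0 n))
  λ (∈₁ , ∈₂) → disjoint ∈₁ ∈₂
  where
  disjoint : ∀ {bs} → bs ∈ compositions (suc h) n → ¬ (bs ∈ map (brick 0 (suc h) ∷⁺_) (compositions 0 n))
  disjoint ∈₁ ∈₂ with _ ∷ _ , _ , refl ← ∈-map⁻ _ ∈₂ =
    ℕ.1+n≰n (proj₂ (proj₂ (compositions-sound (suc h) n ∈₁)))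

rowLength>0 : ∀ bs → 0 < rowLength bs
rowLength>0 (b ∷ bs) = ℕ.≤-trans (0<brickLength b) (ℕ.m≤m+n _ _)

-- Whether the first brick has exactly h + 1 cells decides which half contains the row. For n = 0
-- there is no room for a second brick.
compositions-complete : ∀ h n {bs} → HasMarking 0 bs → rowLength bs ≡ n ℕ.+ suc h →
                        suc h ≤ quotient (List⁺.head bs) → bs ∈ compositions h n
compositions-complete h zero    {brick 0 q ∷ []}     (refl ∷ mk) len le
  with refl ← trans (sym (trans (ℕ.+-identityʳ _) (ℕ.+-identityʳ q))) len = here refl
compositions-complete h zero    {brick 0 q ∷ b ∷ bs} (refl ∷ mk) len le =
  contradiction (ℕ.+-mono-≤ le (rowLength>0 (b ∷ bs)))
    (ℕ.<⇒≱ (ℕ.≤-reflexive (trans (cong suc (trans (cong (ℕ._+ rowLength (b ∷ bs)) (sym (ℕ.+-identityʳ q))) len))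
      (ℕ.+-comm 1 (suc h)))))
compositions-complete h (suc n) {brick 0 q ∷ bs} (refl ∷ mk) len le with suc h ℕ.≟ q
... | no h≢q = ∈-++⁺ˡ (compositions-complete (suc h) n (refl ∷ mk)
  (trans len (sym (ℕ.+-suc n (suc h)))) (ℕ.≤∧≢⇒< le h≢q))
... | yes refl with bs
...   | []     = contradiction (ℕ.+-cancelʳ-≡ (suc h) 0 (suc n)
                   (trans (sym (trans (ℕ.+-identityʳ _) (ℕ.+-identityʳ (suc h)))) len)) λ ()
...   | b ∷ cs = ∈-++⁺ʳ (compositions (suc h) n) (∈-map⁺ (brick 0 (suc h) ∷⁺_) (compositions-complete 0 n mk
  (trans (ℕ.+-cancelˡ-≡ (suc h) _ (suc n)
    (trans (cong (ℕ._+ rowLength (b ∷ cs)) (sym (ℕ.+-identityʳ (suc h)))) (trans len (ℕ.+-comm (suc n) (suc h)))))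
    (ℕ.+-comm 1 n))
  (ℕ.>-nonZero⁻¹ (quotient b) {{nz b}})))
  where
  nz : ∀ b → NonZero (quotient b)
  nz (brick _ (suc _)) = _

sum-double : ∀ bs → sum (map brickLength (map double bs)) ≡ 2 ℕ.* sum (map brickLength bs)
sum-double []       = refl
sum-double (b ∷ bs) = trans (cong₂ ℕ._+_ (brickLength-double b) (sum-double bs))
  (sym (ℕ.*-distribˡ-+ 2 (brickLength b) _))

double-injective : ∀ {b c} → double b ≡ double c → b ≡ c
double-injective {brick _ _} {brick _ _} refl = refl

map-double-injective : ∀ {bs cs} → List⁺.map double bs ≡ List⁺.map double cs → bs ≡ cs
map-double-injective {_ ∷ _} {_ ∷ _} eq = cong₂ _∷_
  (double-injective (cong List⁺.head eq))
  (List.map-injective double-injective (cong List⁺.tail eq))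

singularRows-sound : ∀ f d {bs} → 0 < d → bs ∈ singularRows f d → SingularRow bs × Fills d bs
singularRows-sound (suc f) d@(suc d′) 0<d bs∈ with ∈-++⁻ (compositions 0 d′) bs∈
... | inj₁ bs∈₁ with mk , len , _ ← compositions-sound 0 d′ bs∈₁ = (0 , mk) , trans len (ℕ.+-comm d′ 1)
... | inj₂ bs∈₂ with 2∣d , bs∈₃ ← ∈-keep⁻ (2 ∣? d) bs∈₂ with cs@(c ∷ cs′) , cs∈ , refl ← ∈-map⁻ _ bs∈₃
  with (k , mk) , len ← singularRows-sound f (d ℕ./ 2) (0<d/2 0<d 2∣d) cs∈ =
  (suc k , All.map⁺ (All.map (cong suc) mk)) ,
  trans (sum-double (c ∷ cs′)) (trans (cong (2 ℕ.*_) len) (ℕ.m*[n/m]≡n 2∣d))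

singularRows-unique : ∀ f d → 0 < d → Unique (singularRows f d)
singularRows-unique zero    d            0<d = []
singularRows-unique (suc f) d@(suc d′) 0<d with 2 ∣? d
... | no _    = subst Unique (sym (List.++-identityʳ (compositions 0 d′))) (compositions-unique 0 d′)
... | yes 2∣d = Unique.++⁺ (compositions-unique 0 d′)
  (Unique.map⁺ map-double-injective (singularRows-unique f (d ℕ./ 2) (0<d/2 0<d 2∣d)))
  λ (∈₁ , ∈₂) → disjoint ∈₁ ∈₂
  where
  disjoint : ∀ {bs} → bs ∈ compositions 0 d′ → ¬ (bs ∈ map (List⁺.map double) (singularRows f (d ℕ./ 2)))
  disjoint ∈₁ ∈₂ with brick _ _ ∷ _ , _ , refl ← ∈-map⁻ _ ∈₂ with () ∷ _ , _ ← compositions-sound 0 d′ ∈₁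

halve-marking : ∀ {k} bs → All (λ b → marking b ≡ suc k) bs →
                ∃ λ cs → bs ≡ map double cs × All (λ b → marking b ≡ k) cs
halve-marking []                     []          = [] , refl , []
halve-marking (brick (suc k) q ∷ bs) (refl ∷ mk) with cs , refl , mk′ ← halve-marking bs mk =
  brick k q ∷ cs , refl , refl ∷ mk′

-- A row with marking k + 1 has even length and is the double of a row with marking k, for which `f`
-- suffices since d / 2 < d.
singularRows-complete : ∀ f d {bs} → d ≤ f → SingularRow bs → Fills d bs → bs ∈ singularRows f d
singularRows-complete zero    d {bs} z≤n _ len = contradiction (rowLength>0 bs)
  (subst (λ n → ¬ (0 < n)) (sym len) λ ())
singularRows-complete (suc f) d {b ∷ bs} d≤f (zero , mk) refl with rowLength (b ∷ bs) in eq
... | zero   = contradiction (rowLength>0 (b ∷ bs)) (subst (λ n → ¬ (0 < n)) (sym eq) λ ())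
... | suc d′ = ∈-++⁺ˡ (compositions-complete 0 d′ mk (trans eq (ℕ.+-comm 1 d′)) (ℕ.>-nonZero⁻¹ (quotient b) {{nz b}}))
  where
  nz : ∀ b → NonZero (quotient b)
  nz (brick _ (suc _)) = _
singularRows-complete (suc f) d {bs@(_ ∷ _)} d≤f (suc k , mk) len
  with c ∷ cs , refl , mk′ ← halve-marking (toList bs) mk =
  ∈-++⁺ʳ (compositions 0 (pred d)) (∈-keep⁺ (2 ∣? d) 2∣d (∈-map⁺ (List⁺.map double)
    (singularRows-complete f (d ℕ./ 2) (ℕ.≤-pred (ℕ.≤-trans (d/2<d 0<d) d≤f)) (k , mk′) (sym d/2≡))))
  where
  s = rowLength (c ∷ cs)
  d≡ : d ≡ s ℕ.* 2
  d≡ = trans (sym len) (trans (sum-double (c ∷ cs)) (ℕ.*-comm 2 s))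
  2∣d : 2 ∣ d
  2∣d = divides s d≡
  0<d : 0 < d
  0<d = subst (0 <_) len (rowLength>0 bs)
  d/2≡ : d ℕ./ 2 ≡ s
  d/2≡ = trans (cong (ℕ._/ 2) d≡) (ℕ.m*n/n≡m s 2)

-- Hence filtering `singularRows` by `isRow?` discards nothing.
singular⇒increasing : ∀ {bs} → SingularRow bs → MarkingsIncrease bs
singular⇒increasing (k , mk) = go mk
  where
  go : ∀ {bs} → All (λ b → marking b ≡ k) bs → AllPairs (λ b c → marking b ≤ marking c) bs
  go []          = []
  go (refl ∷ mk) = All.map (λ eq → ℕ.≤-reflexive (sym eq)) mk ∷ go mk

-- Enumeration of the singular tabloids

value-injective : {P : A → Set} {x y : Refinement A P} → value x ≡ value y → x ≡ y
value-injective refl = refl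

module _ {A : Set} {P : A → Set} (P? : Decidable P) where

  ∑-refine : ∀ xs (f : A → ℚ) → ∑ (refine P? xs) (f ∘ value) ≡ ∑ xs (λ x → when (P? x) (f x))
  ∑-refine []       f = refl
  ∑-refine (x ∷ xs) f with P? x
  ... | yes _ = cong (f x ℚ.+_) (∑-refine xs f)
  ... | no _  = trans (∑-refine xs f) (sym (ℚ.+-identityˡ _))

  ∈-refine⁻ : ∀ xs {y} → y ∈ refine P? xs → value y ∈ xs
  ∈-refine⁻ (x ∷ xs) y∈ with P? x
  ∈-refine⁻ (x ∷ xs) (here refl) | yes _ = here refl
  ∈-refine⁻ (x ∷ xs) (there y∈)  | yes _ = there (∈-refine⁻ xs y∈)
  ∈-refine⁻ (x ∷ xs) y∈          | no _  = there (∈-refine⁻ xs y∈)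

  refine-unique : ∀ {xs} → Unique xs → Unique (refine P? xs)
  refine-unique {[]}     []           = []
  refine-unique {x ∷ xs} (x∉ ∷ xs!) with P? x
  ... | yes _ = All.tabulate (λ y∈ x≡y → All.lookup x∉ (∈-refine⁻ xs y∈) (cong value x≡y)) ∷ refine-unique xs!
  ... | no _  = refine-unique xs!

-- The proof stored in a refinement is irrelevant, but the property is decidable and can be
-- recomputed.
rowFills : ∀ {d} (row : Row d) → Fills d (value row)
rowFills {d} (bs , [ p ]) = proj₁ (recompute (isRow? d bs) p)

rowList : ∀ d → List (Row d)
rowList d = refine (isRow? d) (singularRows d d)

-- Not tied to a content, hence a product of one list per block, over which sums factorise. The
-- content is imposed afterwards as a condition.
singularTabloidsOn : ∀ βs → List (TabloidOn βs)
singularTabloidsOn []       = [] ∷ []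
singularTabloidsOn (β ∷ βs) = cartesianProductWith _∷_ (rowList (degree β)) (singularTabloidsOn βs)

Positive : List Block → Set
Positive = All (λ β → 0 < degree β)

singularTabloidsOn-unique : ∀ {βs} → Positive βs → Unique (singularTabloidsOn βs)
singularTabloidsOn-unique []               = [] ∷ []
singularTabloidsOn-unique {β ∷ βs} (p ∷ ps) = Unique.cartesianProductWith⁺ _∷_ (λ { refl → refl , refl })
  (refine-unique (isRow? (degree β)) (singularRows-unique (degree β) (degree β) p)) (singularTabloidsOn-unique ps)

singularTabloidsOn-complete : ∀ {βs} (T : TabloidOn βs) → Singular T → T ∈ singularTabloidsOn βs
singularTabloidsOn-complete []        []       = here refl
singularTabloidsOn-complete {β ∷ βs} (row@(bs , [ p ]) ∷ T) (s ∷ ss) = ∈-cartesianProductWith⁺ _∷_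
  (∈-refine (isRow? (degree β)) p (singularRows-complete (degree β) (degree β) ℕ.≤-refl s (rowFills row)))
  (singularTabloidsOn-complete T ss)

singularTabloidsOn-sound : ∀ {βs} → Positive βs → (T : TabloidOn βs) → T ∈ singularTabloidsOn βs → Singular T
singularTabloidsOn-sound []       []        _  = []
singularTabloidsOn-sound {β ∷ βs} (p ∷ ps) (row ∷ T) T∈
  with _ , _ , row∈ , T∈′ , refl ← ∈-cartesianProductWith⁻ _∷_ (rowList (degree β)) (singularTabloidsOn βs) T∈ =
  proj₁ (singularRows-sound (degree β) (degree β) p (∈-refine⁻ (isRow? (degree β)) _ row∈)) ∷
  singularTabloidsOn-sound ps T T∈′

-- Signs and weights of tabloids.

tabloidWeight : ∀ {βs} → TabloidOn βs → ℤ
tabloidWeight T = foldr ℤ._*_ 1ℤ (map rowWeight (rows T))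

surplus : ∀ {βs} → TabloidOn βs → ℕ
surplus T = sum (map (length ∘ List⁺.tail) (rows T))

length-content : ∀ {βs} (T : TabloidOn βs) → length (content T) ≡ length βs ℕ.+ surplus T
length-content []                          = refl
length-content {β ∷ βs} ((b ∷ bs , _) ∷ T) = cong suc (begin
  length (map (brickBlock r) bs ++ content T)           ≡⟨ List.length-++ (map (brickBlock r) bs) ⟩
  length (map (brickBlock r) bs) ℕ.+ length (content T) ≡⟨ cong₂ ℕ._+_ (List.length-map (brickBlock r) bs)
                                                             (length-content T) ⟩
  length bs ℕ.+ (length βs ℕ.+ surplus T)               ≡⟨ ℕ.+-assoc (length bs) (length βs) _ ⟨
  length bs ℕ.+ length βs ℕ.+ surplus T                 ≡⟨ cong (ℕ._+ surplus T) (ℕ.+-comm (length bs) (length βs)) ⟩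
  length βs ℕ.+ length bs ℕ.+ surplus T                 ≡⟨ ℕ.+-assoc (length βs) (length bs) _ ⟩
  length βs ℕ.+ (length bs ℕ.+ surplus T)               ∎)
  where r = multiplicity β

tabloidWeight-surplus : ∀ {βs} (T : TabloidOn βs) → tabloidWeight T ≡ -1ℤ ℤ.^ surplus T ℤ.* ℤ.+ 𝔏* T
tabloidWeight-surplus []              = refl
tabloidWeight-surplus ((bs , _) ∷ T) = begin
  s ℤ.* l ℤ.* tabloidWeight T                   ≡⟨ cong (s ℤ.* l ℤ.*_) (tabloidWeight-surplus T) ⟩
  s ℤ.* l ℤ.* (S ℤ.* L)                         ≡⟨ ℤ.*-assoc s l _ ⟩
  s ℤ.* (l ℤ.* (S ℤ.* L))                       ≡⟨ cong (s ℤ.*_) (trans (sym (ℤ.*-assoc l S L))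
                                                     (trans (cong (ℤ._* L) (ℤ.*-comm l S)) (ℤ.*-assoc S l L))) ⟩
  s ℤ.* (S ℤ.* (l ℤ.* L))                       ≡⟨ ℤ.*-assoc s S _ ⟨
  s ℤ.* S ℤ.* (l ℤ.* L)                         ≡⟨ cong₂ ℤ._*_
                                                     (sym (ℤ.^-distribˡ-+-* -1ℤ (length (List⁺.tail bs)) (surplus T)))
                                                     (sym (ℤ.pos-* (brickLength (List⁺.last bs)) (𝔏* T))) ⟩
  -1ℤ ℤ.^ (length (List⁺.tail bs) ℕ.+ surplus T) ℤ.* ℤ.+ (brickLength (List⁺.last bs) ℕ.* 𝔏* T) ∎
  where
  s = -1ℤ ℤ.^ length (List⁺.tail bs)
  l = ℤ.+ brickLength (List⁺.last bs)
  S = -1ℤ ℤ.^ surplus T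
  L = ℤ.+ 𝔏* T

-- Every row has a brick, so the content is at least as long as `βs` and the absolute difference is
-- the true one, namely `surplus T`.
tabloidWeight≡ : ∀ {βs} (T : TabloidOn βs) →
                 -1ℤ ℤ.^ ∣ length (content T) - length βs ∣ ℤ.* ℤ.+ 𝔏* T ≡ tabloidWeight T
tabloidWeight≡ {βs} T = trans (cong (λ k → -1ℤ ℤ.^ k ℤ.* ℤ.+ 𝔏* T)
  (trans (cong (λ k → ∣ k - length βs ∣) (length-content T))
    (trans (ℕ.∣-∣-comm (length βs ℕ.+ surplus T) (length βs)) (ℕ.∣m-m+n∣≡n (length βs) (surplus T)))))
  (sym (tabloidWeight-surplus T))

∑-rowList : ∀ d r .{{_ : NonZero r}} → 0 < d → ∀ m →
            ∑ (rowList d) (λ row → rowTerm r m (value row)) ≡ dilate r (P d) m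
∑-rowList d r 0<d m = begin
  ∑ (rowList d) (λ row → rowTerm r m (value row))
    ≡⟨ ∑-refine (isRow? d) (singularRows d d) (rowTerm r m) ⟩
  ∑ (singularRows d d) (λ bs → when (isRow? d bs) (rowTerm r m bs))
    ≡⟨ ∑-cong-∈ (singularRows d d) (λ {bs} bs∈ → when-true (isRow? d bs)
         (let s , fills = singularRows-sound d d 0<d bs∈ in fills , singular⇒increasing s)) ⟩
  ∑ (singularRows d d) (rowTerm r m)
    ≡⟨ ∑-singularRows d d r 0<d ℕ.≤-refl m ⟩
  dilate r (P d) m ∎

-- A tabloid chooses its rows independently, so the sum of products is a product of sums, with the
-- factor `dilate r (P d)` for each block by `∑-rowList`.
∑-singularTabloidsOn : ∀ {βs} → Positive βs → ∀ m →
  ∑ (singularTabloidsOn βs) (λ T → fromℤ (tabloidWeight T) ℚ.* blockProduct E⁺ (content T) m) ≡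
  blockProduct P βs m
∑-singularTabloidsOn []                          m = trans (ℚ.+-identityʳ _) (ℚ.*-identityˡ (𝟙 m))
∑-singularTabloidsOn {block d r ∷ βs} (0<d ∷ ps) m = begin
  ∑ (singularTabloidsOn (block d r ∷ βs)) term
    ≡⟨ ∑-cartesianProductWith _∷_ (rowList d) (singularTabloidsOn βs) term ⟩
  ∑ (rowList d) (λ row → ∑ (singularTabloidsOn βs) (λ T → term (row ∷ T)))
    ≡⟨ ∑-cong (rowList d) (λ row → begin
         ∑ (singularTabloidsOn βs) (λ T → term (row ∷ T))
           ≡⟨ ∑-cong (singularTabloidsOn βs) (factor row) ⟩
         ∑ (singularTabloidsOn βs) (λ T → w row ℚ.* (fromℤ (tabloidWeight T) ℚ.* (R row · blockProduct E⁺ (content T)) m))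
           ≡⟨ ∑-*ˡ (w row) (singularTabloidsOn βs) _ ⟩
         w row ℚ.* ∑ (singularTabloidsOn βs) (λ T → fromℤ (tabloidWeight T) ℚ.* (R row · blockProduct E⁺ (content T)) m)
           ≡⟨ cong (w row ℚ.*_) (·-distribˡ-∑ (R row) (singularTabloidsOn βs) (fromℤ ∘ tabloidWeight)
                (λ T → blockProduct E⁺ (content T)) m) ⟨
         w row ℚ.* (R row · (λ m′ → ∑ (singularTabloidsOn βs) (λ T →
           fromℤ (tabloidWeight T) ℚ.* blockProduct E⁺ (content T) m′))) m
           ≡⟨ cong (w row ℚ.*_) (·-cong {F = R row} (λ _ → refl) (∑-singularTabloidsOn ps) m) ⟩
         w row ℚ.* (R row · blockProduct P βs) m ∎) ⟩
  ∑ (rowList d) (λ row → w row ℚ.* (R row · blockProduct P βs) m)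
    ≡⟨ ·-distribʳ-∑ (rowList d) w R (blockProduct P βs) m ⟨
  ((λ m′ → ∑ (rowList d) (λ row → rowTerm r m′ (value row))) · blockProduct P βs) m
    ≡⟨ ·-cong {G = blockProduct P βs} (∑-rowList d r 0<d) (λ _ → refl) m ⟩
  (dilate r (P d) · blockProduct P βs) m ∎
  where
  term : TabloidOn (block d r ∷ βs) → ℚ
  term T = fromℤ (tabloidWeight T) ℚ.* blockProduct E⁺ (content T) m

  w : Row d → ℚ
  w row = fromℤ (rowWeight (value row))

  R : Row d → PowerSeries
  R row = rowProduct r (value row)

  factor : ∀ row T → term (row ∷ T) ≡ w row ℚ.* (fromℤ (tabloidWeight T) ℚ.* (R row · blockProduct E⁺ (content T)) m)
  factor row T = trans
    (cong₂ ℚ._*_ (fromℤ-* (rowWeight (value row)) (tabloidWeight T))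
               (blockProduct-++ E⁺ (map (brickBlock r) (toList (value row))) (content T) m))
    (ℚ.*-assoc (w row) (fromℤ (tabloidWeight T)) _)

-- Types as multisets of blocks

≥-decTotalOrder : DecTotalOrder _ _ _
≥-decTotalOrder = Flip.decTotalOrder ℕ.≤-decTotalOrder

open Sort ≥-decTotalOrder using (sort; sort-↭; sort-↗)

isPartition : (μ : Partition) → All (0 <_) (parts μ) × Linked _≥_ (parts μ)
isPartition (λs , [ p ]) = recompute (isPartition? λs) p

partition-injective : ∀ {μ ν : Partition} → parts μ ↭ parts ν → μ ≡ ν
partition-injective {μ} {ν} p = value-injective (Pointwise.Pointwise-≡⇒≡ (Pointwise.map sym
  (Sorted.↗↭↗⇒≋ (DecTotalOrder.totalOrder ≥-decTotalOrder) (proj₂ (isPartition μ)) (proj₂ (isPartition ν))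
    (Homogeneous.map sym (↭⇒↭ₛ p)))))

sortedPartition : (λs : List ℕ) → All (0 <_) λs → Partition
sortedPartition λs ps = sort λs , [ Perm.All-resp-↭ (↭-sym (sort-↭ λs)) ps , sort-↗ λs ]

blockWeight : Block → ℕ
blockWeight (block d r) = r ℕ.* d

sum-blocksFrom : ∀ {n} i .{{_ : NonZero i}} (v : Vec Partition n) →
                 sum (map blockWeight (blocksFrom i v)) ≡ weightFrom i v
sum-blocksFrom i []      = refl
sum-blocksFrom i (μ ∷ v) = begin
  sum (map blockWeight (map (λ d → block d i) (parts μ) ++ blocksFrom (suc i) v))
    ≡⟨ cong sum (List.map-++ blockWeight (map (λ d → block d i) (parts μ)) _) ⟩
  sum (map blockWeight (map (λ d → block d i) (parts μ)) ++ map blockWeight (blocksFrom (suc i) v))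
    ≡⟨ ℕ.sum-++ (map blockWeight (map (λ d → block d i) (parts μ))) _ ⟩
  sum (map blockWeight (map (λ d → block d i) (parts μ))) ℕ.+ sum (map blockWeight (blocksFrom (suc i) v))
    ≡⟨ cong₂ ℕ._+_ (go (parts μ)) (sum-blocksFrom (suc i) v) ⟩
  i ℕ.* size μ ℕ.+ weightFrom (suc i) v ∎
  where
  go : ∀ λs → sum (map blockWeight (map (λ d → block d i) λs)) ≡ i ℕ.* sum λs
  go []       = sym (ℕ.*-zeroʳ i)
  go (d ∷ λs) = trans (cong (i ℕ.* d ℕ.+_) (go λs)) (sym (ℕ.*-distribˡ-+ i d (sum λs)))

blocksFrom-positive : ∀ {n} i .{{_ : NonZero i}} (v : Vec Partition n) → Positive (blocksFrom i v)
blocksFrom-positive i []      = []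
blocksFrom-positive i (μ ∷ v) = All.++⁺ (All.map⁺ (proj₁ (isPartition μ))) (blocksFrom-positive (suc i) v)

blocksFrom-multiplicity : ∀ {n} i .{{_ : NonZero i}} (v : Vec Partition n) →
                          All (λ β → i ≤ multiplicity β) (blocksFrom i v)
blocksFrom-multiplicity i []      = []
blocksFrom-multiplicity i (μ ∷ v) = All.++⁺ (All.map⁺ (All.universal (λ _ → ℕ.≤-refl) (parts μ)))
  (All.map ℕ.<⇒≤ (blocksFrom-multiplicity (suc i) v))

hasMultiplicity? : ∀ i → Decidable (λ β → multiplicity β ≡ i)
hasMultiplicity? i β = multiplicity β ℕ.≟ i

degrees-map : ∀ i .{{_ : NonZero i}} λs → map degree (map (λ d → block d i) λs) ≡ λs
degrees-map i []       = refl
degrees-map i (d ∷ λs) = cong (d ∷_) (degrees-map i λs)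

module _ {n : ℕ} (i : ℕ) .{{_ : NonZero i}} (μ : Partition) (v : Vec Partition n) where

  private
    βs γs : List Block
    βs = map (λ d → block d i) (parts μ)
    γs = blocksFrom (suc i) v

    βs-all : All (λ β → multiplicity β ≡ i) βs
    βs-all = All.map⁺ (All.universal (λ _ → refl) (parts μ))

    γs-none : All (λ β → ¬ multiplicity β ≡ i) γs
    γs-none = All.map (λ i<m m≡i → ℕ.<⇒≢ i<m (sym m≡i)) (blocksFrom-multiplicity (suc i) v)

  filter-head : map degree (filter (hasMultiplicity? i) (blocksFrom i (μ ∷ v))) ≡ parts μ
  filter-head = trans (cong (map degree) (trans (List.filter-++ (hasMultiplicity? i) βs γs)
    (trans (cong₂ _++_ (List.filter-all (hasMultiplicity? i) βs-all) (List.filter-none (hasMultiplicity? i) γs-none))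
           (List.++-identityʳ βs))))
    (degrees-map i (parts μ))

  filter-tail : filter (¬? ∘ hasMultiplicity? i) (blocksFrom i (μ ∷ v)) ≡ blocksFrom (suc i) v
  filter-tail = trans (List.filter-++ (¬? ∘ hasMultiplicity? i) βs γs)
    (cong₂ _++_ (List.filter-none (¬? ∘ hasMultiplicity? i) (All.map (λ eq ¬eq → ¬eq eq) βs-all))
                (List.filter-all (¬? ∘ hasMultiplicity? i) γs-none))

-- Blocks of multiplicity exactly `i` come from the first partition, all others have larger
-- multiplicity. Filtering splits the permutation accordingly, and decreasing lists that are
-- permutations of each other coincide.
blocksFrom-injective : ∀ {n} i .{{_ : NonZero i}} (v w : Vec Partition n) → blocksFrom i v ↭ blocksFrom i w → v ≡ w
blocksFrom-injective i []      []      p = refl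
blocksFrom-injective i (μ ∷ v) (ν ∷ w) p = cong₂ _∷_
  (partition-injective (subst₂ _↭_ (filter-head i μ v) (filter-head i ν w)
    (Perm.map⁺ degree (Perm.filter-↭ (hasMultiplicity? i) p))))
  (blocksFrom-injective (suc i) v w (subst₂ _↭_ (filter-tail i μ v) (filter-tail i ν w)
    (Perm.filter-↭ (¬? ∘ hasMultiplicity? i) p)))

blocks-injective : ∀ {n} {σ τ : Typ n} → blocks σ ↭ blocks τ → σ ≡ τ
blocks-injective {σ = σ} {τ} p = value-injective (blocksFrom-injective 1 (value σ) (value τ) p)

typeFrom : ∀ (i n : ℕ) βs → Positive βs → Vec Partition n
typeFrom i zero    βs ps = []
typeFrom i (suc n) βs ps =
  sortedPartition (map degree (filter (hasMultiplicity? i) βs)) (All.map⁺ (All.filter⁺ (hasMultiplicity? i) ps)) ∷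
  typeFrom (suc i) n (filter (¬? ∘ hasMultiplicity? i) βs) (All.filter⁺ (¬? ∘ hasMultiplicity? i) ps)

filter-↭-++ : {P : A → Set} (P? : Decidable P) (xs : List A) → filter P? xs ++ filter (¬? ∘ P?) xs ↭ xs
filter-↭-++ P? []       = ↭-refl
filter-↭-++ P? (x ∷ xs) with P? x
... | yes _ = prep x (filter-↭-++ P? xs)
... | no _  = ↭-trans (Perm.shift x (filter P? xs) _) (prep x (filter-↭-++ P? xs))

blocks-map-degree : ∀ i .{{_ : NonZero i}} βs → All (λ β → multiplicity β ≡ i) βs →
                    map (λ d → block d i) (map degree βs) ≡ βs
blocks-map-degree i []               []          = refl
blocks-map-degree i (block d r ∷ βs) (r≡i ∷ ps) = cong₂ _∷_ (block-cong refl (sym r≡i)) (blocks-map-degree i βs ps)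

-- The bounds ensure that the `n` classes by multiplicity exhaust the list: each step removes the
-- smallest multiplicity, and none is left at the end.
blocksFrom-typeFrom : ∀ i .{{_ : NonZero i}} n βs (ps : Positive βs) →
  All (λ β → i ≤ multiplicity β × multiplicity β < n ℕ.+ i) βs → blocksFrom i (typeFrom i n βs ps) ↭ βs
blocksFrom-typeFrom i zero    []       ps bounds             = ↭-refl
blocksFrom-typeFrom i zero    (β ∷ βs) ps ((i≤m , m<i) ∷ _) = contradiction i≤m (ℕ.<⇒≱ m<i)
blocksFrom-typeFrom i (suc n) βs       ps bounds             = ↭-trans
  (Perm.++⁺ (Perm.map⁺ (λ d → block d i) (sort-↭ (map degree βs₁))) (blocksFrom-typeFrom (suc i) n βs₂ _ bounds₂))
  (↭-trans (↭-reflexive (cong (_++ βs₂) (blocks-map-degree i βs₁ (All.all-filter (hasMultiplicity? i) βs))))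
    (filter-↭-++ (hasMultiplicity? i) βs))
  where
  βs₁ βs₂ : List Block
  βs₁ = filter (hasMultiplicity? i) βs
  βs₂ = filter (¬? ∘ hasMultiplicity? i) βs

  bounds₂ : All (λ β → suc i ≤ multiplicity β × multiplicity β < n ℕ.+ suc i) βs₂
  bounds₂ = All.map (λ { {β} ((i≤m , m<) , m≢i) →
      ℕ.≤∧≢⇒< i≤m (λ i≡m → m≢i (sym i≡m)) , subst (multiplicity β <_) (sym (ℕ.+-suc n i)) m< })
    (All.zip (All.filter⁺ (¬? ∘ hasMultiplicity? i) bounds , All.all-filter (¬? ∘ hasMultiplicity? i) βs))

-- Positive degrees give r ≤ r d ≤ n for each block, so a vector of length `n` has a place for every
-- multiplicity.
blocks-surjective : ∀ {n} βs → Positive βs → sum (map blockWeight βs) ≡ n → ∃ λ (τ : Typ n) → blocks τ ↭ βs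
blocks-surjective {n} βs ps weight≡n = (v , [ weight-v ]) , v↭βs
  where
  v : Vec Partition n
  v = typeFrom 1 n βs ps

  multiplicity≤ : ∀ β → 0 < degree β → multiplicity β ≤ blockWeight β
  multiplicity≤ (block d r) 0<d = ℕ.m≤m*n r d {{ℕ.>-nonZero 0<d}}

  multiplicity>0 : ∀ β → 0 < multiplicity β
  multiplicity>0 (block d (suc r)) = s≤s z≤n

  bounds : All (λ β → 1 ≤ multiplicity β × multiplicity β < n ℕ.+ 1) βs
  bounds = All.map (λ { {β} (0<d , w≤) → multiplicity>0 β ,
      subst (multiplicity β <_) (ℕ.+-comm 1 n)
        (s≤s (ℕ.≤-trans (multiplicity≤ β 0<d) (ℕ.≤-trans w≤ (ℕ.≤-reflexive weight≡n)))) })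
    (All.zip (ps , all≤sum blockWeight βs))

  v↭βs : blocksFrom 1 v ↭ βs
  v↭βs = blocksFrom-typeFrom 1 n βs ps bounds

  weight-v : weightFrom 1 v ≡ n
  weight-v = trans (sym (sum-blocksFrom 1 v)) (trans (ℕ.sum-↭ (Perm.map⁺ blockWeight v↭βs)) weight≡n)

-- Expansion of P

length-blocksFrom : ∀ {n} i .{{_ : NonZero i}} (v : Vec Partition n) →
                    length (blocksFrom i v) ≡ Vec.sum (Vec.map (length ∘ parts) v)
length-blocksFrom i []      = refl
length-blocksFrom i (μ ∷ v) = trans (List.length-++ (map (λ d → block d i) (parts μ)))
  (cong₂ ℕ._+_ (List.length-map (λ d → block d i) (parts μ)) (length-blocksFrom (suc i) v))

ℓ≡length : ∀ {n} (τ : Typ n) → ℓ τ ≡ length (blocks τ)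
ℓ≡length τ = sym (length-blocksFrom 1 (value τ))

weightFrom-value : ∀ {n} (τ : Typ n) → weightFrom 1 (value τ) ≡ n
weightFrom-value {n} (v , [ p ]) = recompute (weightFrom 1 v ℕ.≟ n) p

content-positive : ∀ {βs} (T : TabloidOn βs) → Positive (content T)
content-positive []                        = []
content-positive {β ∷ βs} ((bs , _) ∷ T) =
  All.++⁺ (All.map⁺ {f = brickBlock (multiplicity β)} 
      (All.universal (λ { (brick _ (suc _)) → s≤s z≤n }) (toList bs))) (content-positive T)

content-weight : ∀ {βs} (T : TabloidOn βs) → sum (map blockWeight (content T)) ≡ sum (map blockWeight βs)
content-weight []                                      = refl
content-weight {block d r ∷ βs} (row@(bs , _) ∷ T) = begin
  sum (map blockWeight (map (brickBlock r) (toList bs) ++ content T))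
    ≡⟨ trans (cong sum (List.map-++ blockWeight (map (brickBlock r) (toList bs)) _))
             (ℕ.sum-++ (map blockWeight (map (brickBlock r) (toList bs))) _) ⟩
  sum (map blockWeight (map (brickBlock r) (toList bs))) ℕ.+ sum (map blockWeight (content T))
    ≡⟨ cong₂ ℕ._+_ (trans (go (toList bs)) (cong (r ℕ.*_) (rowFills row))) (content-weight T) ⟩
  r ℕ.* d ℕ.+ sum (map blockWeight βs) ∎
  where
  brickWeight : ∀ b → blockWeight (brickBlock r b) ≡ r ℕ.* brickLength b
  brickWeight (brick k q) = trans (cong (ℕ._* q) (ℕ.*-comm (2 ℕ.^ k) r)) (ℕ.*-assoc r (2 ℕ.^ k) q)

  go : ∀ cs → sum (map blockWeight (map (brickBlock r) cs)) ≡ r ℕ.* sum (map brickLength cs)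
  go []       = sym (ℕ.*-zeroʳ r)
  go (c ∷ cs) = trans (cong₂ ℕ._+_ (brickWeight c) (go cs)) (sym (ℕ.*-distribˡ-+ r (brickLength c) _))

fromℤ-sum : ∀ (xs : List A) (f : A → ℤ) → fromℤ (sumℤ (map f xs)) ≡ ∑ xs (fromℤ ∘ f)
fromℤ-sum []       f = refl
fromℤ-sum (x ∷ xs) f = trans (fromℤ-+ (f x) _) (cong (fromℤ (f x) ℚ.+_) (fromℤ-sum xs f))

coefficient : ∀ {n} → Typ n → Typ n → ℚ
coefficient σ τ = fromℤ (∑ℤ (singularTabloids σ τ) (λ T → -1ℤ ℤ.^ ∣ ℓ τ - ℓ σ ∣ ℤ.* ℤ.+ 𝔏* (value T)))

module _ {n : ℕ} (σ : Typ n) where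

  private
    tabloids : List (Tabloid σ)
    tabloids = singularTabloidsOn (blocks σ)

    σ-positive : Positive (blocks σ)
    σ-positive = blocksFrom-positive 1 (value σ)

  -- Trades the enumeration that depends on `τ` for a fixed list with the content as a condition, so
  -- that the sums over types and tabloids can be exchanged.
  coefficient≡ : ∀ τ → coefficient σ τ ≡ ∑ tabloids (λ T → when (inPTdyad-sing? σ τ T) (fromℤ (tabloidWeight T)))
  coefficient≡ τ = begin
    coefficient σ τ
      ≡⟨ fromℤ-sum (elements (singularTabloids σ τ)) _ ⟩
    ∑ (elements (singularTabloids σ τ)) (g ∘ value)
      ≡⟨ ∑-set (g ∘ value) (unique (singularTabloids σ τ))
           (refine-unique (inPTdyad-sing? σ τ) (singularTabloidsOn-unique σ-positive))
           (λ {T} _ → ∈-refine′ (inPTdyad-sing? σ τ) (λ {T} p → singularTabloidsOn-complete T (proj₁ p)) T)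
           (λ {T} _ → complete (singularTabloids σ τ) T) ⟩
    ∑ (refine (inPTdyad-sing? σ τ) tabloids) (g ∘ value)
      ≡⟨ ∑-refine (inPTdyad-sing? σ τ) tabloids g ⟩
    ∑ tabloids (λ T → when (inPTdyad-sing? σ τ T) (g T))
      ≡⟨ ∑-cong tabloids (λ T → when-cong (inPTdyad-sing? σ τ T) (λ (_ , T↭τ) → cong fromℤ (begin
           -1ℤ ℤ.^ ∣ ℓ τ - ℓ σ ∣ ℤ.* ℤ.+ 𝔏* T
             ≡⟨ cong₂ (λ k l → -1ℤ ℤ.^ ∣ k - l ∣ ℤ.* ℤ.+ 𝔏* T)
                  (trans (ℓ≡length τ) (sym (Perm.↭-length T↭τ))) (ℓ≡length σ) ⟩
           -1ℤ ℤ.^ ∣ length (content T) - length (blocks σ) ∣ ℤ.* ℤ.+ 𝔏* T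
             ≡⟨ tabloidWeight≡ T ⟩
           tabloidWeight T ∎))) ⟩
    ∑ tabloids (λ T → when (inPTdyad-sing? σ τ T) (fromℤ (tabloidWeight T))) ∎
    where
    g : Tabloid σ → ℚ
    g T = fromℤ (-1ℤ ℤ.^ ∣ ℓ τ - ℓ σ ∣ ℤ.* ℤ.+ 𝔏* T)

  content-type : (T : Tabloid σ) → ∃ λ (ρ : Typ n) → blocks ρ ↭ content T
  content-type T = blocks-surjective (content T) (content-positive T)
    (trans (content-weight T) (trans (sum-blocksFrom 1 (value σ)) (weightFrom-value σ)))

  -- Exactly one type has the content of `T` as its blocks: it exists because the content has weight
  -- n, and it is unique because its blocks determine a type.
  ∑-contents : ∀ {T} → T ∈ tabloids → ∀ m →
    ∑ (elements (types n)) (λ ρ → when (inPTdyad-sing? σ ρ T) (fromℤ (tabloidWeight T)) ℚ.* E⁺[ ρ ] m) ≡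
    fromℤ (tabloidWeight T) ℚ.* blockProduct E⁺ (content T) m
  ∑-contents {T} T∈ m with ρ , ρ↭T ← content-type T = begin
    ∑ (elements (types n)) term
      ≡⟨ ∑-isolate term (unique (types n)) (complete (types n) ρ) (λ {π} _ π≢ρ →
           trans (cong (ℚ._* E⁺[ π ] m) (when-false (inPTdyad-sing? σ π T)
                   (λ (_ , T↭π) → π≢ρ (blocks-injective (↭-sym (↭-trans ρ↭T T↭π))))))
                 (ℚ.*-zeroˡ (E⁺[ π ] m))) ⟩
    when (inPTdyad-sing? σ ρ T) (fromℤ (tabloidWeight T)) ℚ.* E⁺[ ρ ] m
      ≡⟨ cong₂ ℚ._*_
           (when-true (inPTdyad-sing? σ ρ T) (singularTabloidsOn-sound σ-positive T T∈ , ↭-sym ρ↭T))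
           (blockProduct-↭ E⁺ ρ↭T m) ⟩
    fromℤ (tabloidWeight T) ℚ.* blockProduct E⁺ (content T) m ∎
    where
    term : Typ n → ℚ
    term ρ = when (inPTdyad-sing? σ ρ T) (fromℤ (tabloidWeight T)) ℚ.* E⁺[ ρ ] m

  P-expansion : P[ σ ] ≈ linearCombination (coefficient σ) E⁺[_]
  P-expansion m = begin
    P[ σ ] m
      ≡⟨ ∑-singularTabloidsOn σ-positive m ⟨
    ∑ tabloids (λ T → fromℤ (tabloidWeight T) ℚ.* blockProduct E⁺ (content T) m)
      ≡⟨ ∑-cong-∈ tabloids (λ T∈ → ∑-contents T∈ m) ⟨
    ∑ tabloids (λ T → ∑ (elements (types n)) (λ ρ → w ρ T ℚ.* E⁺[ ρ ] m))
      ≡⟨ ∑-swap tabloids (elements (types n)) _ ⟩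
    ∑ (elements (types n)) (λ ρ → ∑ tabloids (λ T → w ρ T ℚ.* E⁺[ ρ ] m))
      ≡⟨ ∑-cong (elements (types n)) (λ ρ → trans (∑-*ʳ (E⁺[ ρ ] m) tabloids (w ρ))
           (cong (ℚ._* E⁺[ ρ ] m) (sym (coefficient≡ ρ)))) ⟩
    ∑ (elements (types n)) (λ ρ → coefficient σ ρ ℚ.* E⁺[ ρ ] m) ∎
    where
    w : Typ n → Tabloid σ → ℚ
    w ρ T = when (inPTdyad-sing? σ ρ T) (fromℤ (tabloidWeight T))

-- Supports of the products of E⁺

collect : (ℕ → ℕ) → (ℕ → A → List Block) → ℕ → List A → List Block
collect next f i []       = []
collect next f i (x ∷ xs) = f i x ++ collect next f (next i) xs

entryBlocks : ℕ → ℕ → List Block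
entryBlocks i zero    = []
entryBlocks i (suc e) = block i (suc e) ∷ []

rowBlocks : ℕ → List ℕ → List Block
rowBlocks = collect id entryBlocks

monomialBlocksFrom : ℕ → Monomial → List Block
monomialBlocksFrom = collect suc rowBlocks

-- The type of a monomial: a block i^e for each x_{i,j}^e.
monomialBlocks : Monomial → List Block
monomialBlocks = monomialBlocksFrom 1

energy : List Block → ℕ
energy βs = sum (map (λ β → multiplicity β ℕ.* multiplicity β) βs)

energy-++ : ∀ βs γs → energy (βs ++ γs) ≡ energy βs ℕ.+ energy γs
energy-++ βs γs = trans (cong sum (List.map-++ _ βs γs)) (ℕ.sum-++ (map _ βs) _)

energy-↭ : ∀ {βs γs} → βs ↭ γs → energy βs ≡ energy γs
energy-↭ p = ℕ.sum-↭ (Perm.map⁺ _ p)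

+-squeeze : ∀ {a b c d} → a ≤ c → b ≤ d → a ℕ.+ b ≡ c ℕ.+ d → a ≡ c × b ≡ d
+-squeeze {a} {b} {c} {d} a≤c b≤d eq = a≡c , ℕ.+-cancelˡ-≡ a b d (trans eq (cong (ℕ._+ d) (sym a≡c)))
  where
  a≡c : a ≡ c
  a≡c = ℕ.≤-antisym a≤c (ℕ.+-cancelʳ-≤ b c a
    (ℕ.≤-trans (ℕ.+-monoʳ-≤ c b≤d) (ℕ.≤-reflexive (sym eq))))

-- The energy of a product is at least the sum of the energies of the factors,
-- with equality only if the factors have no indeterminate in common.
Superadditive : (βs γs δs : List Block) → Set
Superadditive βs γs δs =
  energy γs ℕ.+ energy δs ≤ energy βs × (energy γs ℕ.+ energy δs ≡ energy βs → βs ↭ γs ++ δs)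

superadditive-++ : ∀ {βs γs δs βs′ γs′ δs′} → Superadditive βs γs δs → Superadditive βs′ γs′ δs′ →
                   Superadditive (βs ++ βs′) (γs ++ γs′) (δs ++ δs′)
superadditive-++ {βs} {γs} {δs} {βs′} {γs′} {δs′} (le , eq) (le′ , eq′) =
  subst₂ _≤_ (sym lhs) (sym (energy-++ βs βs′)) (ℕ.+-mono-≤ le le′) ,
  λ e → let e₁ , e₂ = +-squeeze le le′ (trans (sym lhs) (trans e (energy-++ βs βs′))) in
    ↭-trans (Perm.++⁺ (eq e₁) (eq′ e₂)) rearrange
  where
  rearrange : (γs ++ δs) ++ γs′ ++ δs′ ↭ (γs ++ γs′) ++ δs ++ δs′
  rearrange = ↭-trans (↭-reflexive (List.++-assoc γs δs _))
    (↭-trans (Perm.++⁺ˡ γs (Perm.shifts δs γs′)) (↭-reflexive (sym (List.++-assoc γs γs′ _))))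

  lhs : energy (γs ++ γs′) ℕ.+ energy (δs ++ δs′) ≡ (energy γs ℕ.+ energy δs) ℕ.+ (energy γs′ ℕ.+ energy δs′)
  lhs = trans (cong₂ ℕ._+_ (energy-++ γs γs′) (energy-++ δs δs′)) 
    (interchange (energy γs) (energy γs′) (energy δs) (energy δs′))

collect-superadditive : ∀ {s : Splitting A} next f →
  (∀ i {x a b} → (a , b) ∈ s x → Superadditive (f i x) (f i a) (f i b)) →
  ∀ i xs {as bs} → (as , bs) ∈ splits s xs →
  Superadditive (collect next f i xs) (collect next f i as) (collect next f i bs)
collect-superadditive         next f super i []       (here refl) = z≤n , λ _ → ↭-refl
collect-superadditive {s = s} next f super i (x ∷ xs) as∈
  with (a , b) , (as , bs) , ab∈ , as∈′ , refl ← ∈-cartesianProductWith⁻ _ (s x) (splits s xs) as∈ =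
  superadditive-++ {γs = f i a} {δs = f i b} (super i ab∈) (collect-superadditive next f super (next i) xs as∈′)

-- For positive a and b the square of a + b exceeds a² + b², so equality leaves only splittings with
-- a part 0, which do not change the blocks.
entryBlocks-superadditive : ∀ i {e a b} → (a , b) ∈ splitsℕ e →
                            Superadditive (entryBlocks i e) (entryBlocks i a) (entryBlocks i b)
entryBlocks-superadditive i {e} {a} {b} ab∈ with refl ← ∈-splitsℕ⁻ {e} ab∈ = go a b
  where
  go : ∀ a b → Superadditive (entryBlocks i (a ℕ.+ b)) (entryBlocks i a) (entryBlocks i b)
  go zero    b       = ℕ.≤-refl , λ _ → ↭-refl
  go (suc a) zero    rewrite ℕ.+-identityʳ a = ℕ.≤-reflexive (ℕ.+-identityʳ _) , λ _ → ↭-refl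
  go (suc a) (suc b) = ℕ.<⇒≤ lt , λ eq → contradiction eq (ℕ.<⇒≢ lt)
    where
    x = suc a
    y = suc b
    lt : (x ℕ.* x ℕ.+ 0) ℕ.+ (y ℕ.* y ℕ.+ 0) < (x ℕ.+ y) ℕ.* (x ℕ.+ y) ℕ.+ 0
    lt = subst₂ _<_
      (sym (cong₂ ℕ._+_ (ℕ.+-identityʳ (x ℕ.* x)) (ℕ.+-identityʳ (y ℕ.* y))))
      (trans (sym (ℕ.*-distribʳ-+ (x ℕ.+ y) x y)) (sym (ℕ.+-identityʳ _)))
      (ℕ.+-mono-<-≤ (ℕ.*-monoʳ-< x (ℕ.m<m+n x (s≤s z≤n))) (ℕ.*-monoʳ-≤ y (ℕ.m≤n+m y x)))

monomialBlocks-superadditive : ∀ m {a b} → (a , b) ∈ factorisations m →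
  Superadditive (monomialBlocks m) (monomialBlocks a) (monomialBlocks b)
monomialBlocks-superadditive m = collect-superadditive suc rowBlocks
  (λ i {es} → collect-superadditive id entryBlocks entryBlocks-superadditive i es) 1 m

module _ (r : ℕ) .{{_ : NonZero r}} where

  -- By `entry-cases` this says that e is 0 or r. It is put in the form that `dilate` and
  -- `SquareFree` deliver.
  OneOrPower : ℕ → Set
  OneOrPower e = r ∣ e × e ℕ./ r ≤ 1

  All-oneOrPower⁺ : ∀ {es} → All (r ∣_) es → All (_≤ 1) (map (ℕ._/ r) es) → All OneOrPower es
  All-oneOrPower⁺ = All-join _,_

  collect-multiplicity : ∀ {R : A → Set} next f → (∀ i {x} → R x → All (λ β → multiplicity β ≡ r) (f i x)) →
    ∀ i {xs} → All R xs → All (λ β → multiplicity β ≡ r) (collect next f i xs)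
  collect-multiplicity next f R⇒ i []       = []
  collect-multiplicity next f R⇒ i (p ∷ ps) = All.++⁺ (R⇒ i p) (collect-multiplicity next f R⇒ (next i) ps)

  collect-multiplicity⁻ : ∀ {R : A → Set} next f → (∀ i x → All (λ β → multiplicity β ≡ r) (f i x) → R x) →
    ∀ i xs → All (λ β → multiplicity β ≡ r) (collect next f i xs) → All R xs
  collect-multiplicity⁻ next f R⇐ i []       ps = []
  collect-multiplicity⁻ next f R⇐ i (x ∷ xs) ps =
    R⇐ i x (All.++⁻ˡ (f i x) ps) ∷ collect-multiplicity⁻ next f R⇐ (next i) xs (All.++⁻ʳ (f i x) ps)

  collect-degrees : ∀ {R : A → Set} {q : A → A} next f D → (∀ i {x} → R x → D i (q x) ≡ sum (map degree (f i x))) →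
    ∀ i {xs} → All R xs → weightedSum next D i (map q xs) ≡ sum (map degree (collect next f i xs))
  collect-degrees next f D R⇒ i []                = refl
  collect-degrees next f D R⇒ i (_∷_ {x} {xs} p ps) = trans
    (cong₂ ℕ._+_ (R⇒ i p) (collect-degrees next f D R⇒ (next i) ps))
    (sym (trans (cong sum (List.map-++ degree (f i x) _)) (ℕ.sum-++ (map degree (f i x)) _)))

  entry-cases : ∀ {e} → OneOrPower e → e ≡ 0 ⊎ e ≡ r
  entry-cases (divides 0 refl , _)             = inj₁ refl
  entry-cases (divides 1 refl , _)             = inj₂ (ℕ.+-identityʳ r)
  entry-cases (divides (suc (suc q)) refl , le) = contradiction
    (subst (_≤ 1) (ℕ.m*n/n≡m (suc (suc q)) r) le) λ { (s≤s ()) }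

  entryBlocks-multiplicity : ∀ i {e} → OneOrPower e → All (λ β → multiplicity β ≡ r) (entryBlocks i e)
  entryBlocks-multiplicity i {e} p with entry-cases p
  entryBlocks-multiplicity i {zero}  p | _          = []
  entryBlocks-multiplicity i {suc e} p | inj₂ e≡r   = e≡r ∷ []

  entryBlocks-multiplicity⁻ : ∀ i e → All (λ β → multiplicity β ≡ r) (entryBlocks i e) → OneOrPower e
  entryBlocks-multiplicity⁻ i zero    []         = divides 0 refl , subst (_≤ 1) (sym (ℕ.0/n≡0 r)) z≤n
  entryBlocks-multiplicity⁻ i (suc e) (refl ∷ _) = divides 1 (sym (ℕ.+-identityʳ r)) , ℕ.≤-reflexive (ℕ.n/n≡1 r)

  entryBlocks-degrees : ∀ i {e} → OneOrPower e → i ℕ.* (e ℕ./ r) ≡ sum (map degree (entryBlocks i e))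
  entryBlocks-degrees i {e} p with entry-cases p
  entryBlocks-degrees i {zero}  p | _         = trans (cong (i ℕ.*_) (ℕ.0/n≡0 r)) (ℕ.*-zeroʳ i)
  entryBlocks-degrees i {suc e} p | inj₂ refl = trans (cong (i ℕ.*_) (ℕ.n/n≡1 (suc e))) (ℕ.*-comm i 1)

  monomialBlocks-multiplicity : ∀ {m} → All (All OneOrPower) m → All (λ β → multiplicity β ≡ r) (monomialBlocks m)
  monomialBlocks-multiplicity = collect-multiplicity suc rowBlocks
    (collect-multiplicity id entryBlocks entryBlocks-multiplicity) 1

  monomialBlocks-multiplicity⁻ : ∀ m → All (λ β → multiplicity β ≡ r) (monomialBlocks m) → All (All OneOrPower) m
  monomialBlocks-multiplicity⁻ = collect-multiplicity⁻ suc rowBlocks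
    (collect-multiplicity⁻ id entryBlocks entryBlocks-multiplicity⁻) 1

  monomialBlocks-degrees : ∀ {m} → All (All OneOrPower) m →
                           deg (map (map (ℕ._/ r)) m) ≡ sum (map degree (monomialBlocks m))
  monomialBlocks-degrees {m} ps = trans (deg≡ (map (map (ℕ._/ r)) m))
    (collect-degrees suc rowBlocks rowDeg (collect-degrees id entryBlocks ℕ._*_ entryBlocks-degrees) 1 ps)

  -- All blocks of `a` have multiplicity r, so its energy is r² times their number. As d > 0 there
  -- is at least one; if it is the only one, its degree is d.
  dilate-E⁺-≢0 : ∀ {d a} → 0 < d → dilate r (E⁺ d) a ≢ 0ℚ →
    r ℕ.* r ≤ energy (monomialBlocks a) × (r ℕ.* r ≡ energy (monomialBlocks a) → monomialBlocks a ≡ block d r ∷ [])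
  dilate-E⁺-≢0 {d} {a} 0<d ≢0
    with r∣a , E≢0 ← when-≢0 (divisible? r a) ≢0
    with (sf , deg≡d) , _ ← when-≢0 (squareFree? (map (map (ℕ._/ r)) a) ×-dec deg (map (map (ℕ._/ r)) a) ℕ.≟ d) E≢0 =
    go (monomialBlocks a) (monomialBlocks-multiplicity ps) (trans (sym deg≡d) (monomialBlocks-degrees ps))
    where
    ps : All (All OneOrPower) a
    ps = All-join All-oneOrPower⁺ r∣a sf

    0<r*r : 0 < r ℕ.* r
    0<r*r = ℕ.>-nonZero⁻¹ (r ℕ.* r) {{ℕ.m*n≢0 r r}}

    go : ∀ βs → All (λ β → multiplicity β ≡ r) βs → d ≡ sum (map degree βs) →
         r ℕ.* r ≤ energy βs × (r ℕ.* r ≡ energy βs → βs ≡ block d r ∷ [])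
    go []                 []               d≡0 = contradiction d≡0 (ℕ.>⇒≢ 0<d)
    go (β ∷ [])           (m≡r ∷ [])       d≡ =
      ℕ.≤-reflexive (trans (cong₂ ℕ._*_ (sym m≡r) (sym m≡r)) (sym (ℕ.+-identityʳ _))) ,
      λ _ → cong (_∷ []) (block-cong (trans (sym (ℕ.+-identityʳ (degree β))) (sym d≡)) m≡r)
    go (β ∷ γ ∷ βs)       (m≡r ∷ m′≡r ∷ _) d≡ = ℕ.<⇒≤ lt , λ eq → contradiction eq (ℕ.<⇒≢ lt)
      where
      lt : r ℕ.* r < energy (β ∷ γ ∷ βs)
      lt rewrite m≡r | m′≡r = ℕ.m<m+n (r ℕ.* r) (ℕ.≤-trans 0<r*r (ℕ.m≤m+n _ _))

  dilate-E⁺-block : ∀ {d a} → monomialBlocks a ≡ block d r ∷ [] → dilate r (E⁺ d) a ≡ 1ℚ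
  dilate-E⁺-block {d} {a} eq = trans (when-true (divisible? r a) (All.map (All.map proj₁) ps))
    (when-true (squareFree? (map (map (ℕ._/ r)) a) ×-dec deg (map (map (ℕ._/ r)) a) ℕ.≟ d)
      (All.map⁺ (All.map (λ qs → All.map⁺ (All.map proj₂ qs)) ps) ,
       trans (monomialBlocks-degrees ps) (trans (cong (λ βs → sum (map degree βs)) eq) (ℕ.+-identityʳ d))))
    where
    ps : All (All OneOrPower) a
    ps = monomialBlocks-multiplicity⁻ a (subst (All _) (sym eq) (refl ∷ []))

collect-[] : ∀ {Z : A → Set} next f → (∀ i {x} → Z x → f i x ≡ []) → ∀ i {xs} → All Z xs → collect next f i xs ≡ []
collect-[] next f Z⇒ i []       = refl
collect-[] next f Z⇒ i (z ∷ zs) = cong₂ _++_ (Z⇒ i z) (collect-[] next f Z⇒ (next i) zs)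

collect-[]⁻ : ∀ {Z : A → Set} next f → (∀ i x → f i x ≡ [] → Z x) → ∀ i xs → collect next f i xs ≡ [] → All Z xs
collect-[]⁻ next f Z⇐ i []       eq = []
collect-[]⁻ next f Z⇐ i (x ∷ xs) eq =
  Z⇐ i x (List.++-conicalˡ (f i x) _ eq) ∷ collect-[]⁻ next f Z⇐ (next i) xs (List.++-conicalʳ (f i x) _ eq)

monomialBlocks-[] : ∀ {m} → IsOne m → monomialBlocks m ≡ []
monomialBlocks-[] = collect-[] suc rowBlocks (collect-[] id entryBlocks (λ { i refl → refl })) 1

monomialBlocks-[]⁻ : ∀ m → monomialBlocks m ≡ [] → IsOne m
monomialBlocks-[]⁻ = collect-[]⁻ suc rowBlocks (collect-[]⁻ id entryBlocks λ { i zero _ → refl }) 1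

-- A nonzero coefficient of a product comes from a factorisation into two monomials with nonzero
-- coefficients. The energy bounds of the factors and superadditivity form a chain, and equality of
-- its ends forces equality at each link.
E⁺-support : ∀ {βs} → Positive βs → ∀ m → blockProduct E⁺ βs m ≢ 0ℚ →
  energy βs ≤ energy (monomialBlocks m) × (energy βs ≡ energy (monomialBlocks m) → monomialBlocks m ↭ βs)
E⁺-support []       m ≢0 = z≤n , λ _ → ↭-reflexive (monomialBlocks-[]
  (proj₁ (when-≢0 (isOne? m) (λ eq → ≢0 (trans (𝟙≈ m) eq)))))
E⁺-support {block d r ∷ βs} (0<d ∷ ps) m ≢0
  with (a , b) , ab∈ , ab≢0 ← ∑-≢0 (factorisations m) _ ≢0
  with le₁ , eq₁ ← dilate-E⁺-≢0 r {d} {a} 0<d (λ eq → ab≢0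
         (trans (cong (ℚ._* blockProduct E⁺ βs b) eq) (ℚ.*-zeroˡ (blockProduct E⁺ βs b))))
  with le₂ , eq₂ ← E⁺-support ps b (λ eq → ab≢0
         (trans (cong (dilate r (E⁺ d) a ℚ.*_) eq) (ℚ.*-zeroʳ (dilate r (E⁺ d) a))))
  with le₃ , eq₃ ← monomialBlocks-superadditive m ab∈ =
  ℕ.≤-trans (ℕ.+-mono-≤ le₁ le₂) le₃ ,
  λ eq → let ≥ = ℕ.≤-trans le₃ (ℕ.≤-reflexive (sym eq))
             sums≡ = ℕ.≤-antisym (ℕ.+-mono-≤ le₁ le₂) ≥
             e₁ , e₂ = +-squeeze le₁ le₂ sums≡ in
    ↭-trans (eq₃ (trans (sym sums≡) eq))
      (↭-trans (↭-reflexive (cong (_++ monomialBlocks b) (eq₁ e₁))) (prep (block d r) (eq₂ e₂)))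

-- Linear independence

-- Coefficients are tracked as natural numbers so that one positive summand makes a whole sum
-- nonzero.
IsPositive : ℚ → Set
IsPositive q = ∃ λ n → q ≡ fromℕ (suc n)

IsNatural : ℚ → Set
IsNatural q = ∃ λ n → q ≡ fromℕ n

positive⇒≢0 : ∀ {q} → IsPositive q → q ≢ 0ℚ
positive⇒≢0 (n , refl) eq with ℚᵘ.≃-trans (ℚᵘ.≃-sym (toℚᵘ-fromℤ (ℤ.+ suc n))) (ℚ.toℚᵘ-cong eq)
... | ℚᵘ.*≡* ()

natural-+ : ∀ {p q} → IsNatural p → IsNatural q → IsNatural (p ℚ.+ q)
natural-+ (m , refl) (n , refl) = m ℕ.+ n , sym (fromℕ-+ m n)

natural-* : ∀ {p q} → IsNatural p → IsNatural q → IsNatural (p ℚ.* q)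
natural-* (m , refl) (n , refl) = m ℕ.* n , sym (fromℕ-* m n)

positive-* : ∀ {p q} → IsPositive p → IsPositive q → IsPositive (p ℚ.* q)
positive-* (m , refl) (n , refl) = n ℕ.+ m ℕ.* suc n , sym (fromℕ-* (suc m) (suc n))

∑-natural : ∀ (xs : List A) f → (∀ x → IsNatural (f x)) → IsNatural (∑ xs f)
∑-natural []       f nat = 0 , refl
∑-natural (x ∷ xs) f nat = natural-+ (nat x) (∑-natural xs f nat)

∑-positive : ∀ {xs : List A} {x} f → (∀ x → IsNatural (f x)) → x ∈ xs → IsPositive (f x) → IsPositive (∑ xs f)
∑-positive {xs = x ∷ xs} f nat (here refl) (m , eq) with n , eq′ ← ∑-natural xs f nat =
  m ℕ.+ n , trans (cong₂ ℚ._+_ eq eq′) (sym (fromℕ-+ (suc m) n))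
∑-positive {xs = x ∷ xs} f nat (there x∈) pos with m , eq ← nat x | n , eq′ ← ∑-positive f nat x∈ pos =
  m ℕ.+ n , trans (cong₂ ℚ._+_ eq eq′) (trans (sym (fromℕ-+ m (suc n))) (cong fromℕ (ℕ.+-suc m n)))

when-natural : {P : Set} (P? : Dec P) {q : ℚ} → IsNatural q → IsNatural (when P? q)
when-natural (yes _) nat = nat
when-natural (no _)  nat = 0 , refl

dilate-E⁺-natural : ∀ r .{{_ : NonZero r}} d m → IsNatural (dilate r (E⁺ d) m)
dilate-E⁺-natural r d m = when-natural (divisible? r m)
  (when-natural (squareFree? (map (map (ℕ._/ r)) m) ×-dec deg (map (map (ℕ._/ r)) m) ℕ.≟ d) (1 , refl))

E⁺-natural : ∀ βs m → IsNatural (blockProduct E⁺ βs m)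
E⁺-natural []               m = when-natural (support m ≟ˢ []) (1 , refl)
E⁺-natural (block d r ∷ βs) m = ∑-natural (factorisations m) _
  (λ (a , b) → natural-* (dilate-E⁺-natural r d a) (E⁺-natural βs b))

module _ {A : Set} {s : Splitting A} {Z : A → Set} (next : ℕ → ℕ) (f : ℕ → A → List Block)
         (zero-split : ∀ x → ∃ λ z → (z , x) ∈ s x × Z z) where

  splits-zero : ∀ xs → ∃ λ zs → (zs , xs) ∈ splits s xs × All Z zs
  splits-zero []       = [] , here refl , []
  splits-zero (x ∷ xs) with z , z∈ , pz ← zero-split x | zs , zs∈ , pzs ← splits-zero xs =
    z ∷ zs , ∈-cartesianProductWith⁺ _ z∈ zs∈ , pz ∷ pzs

  -- Splits off the single power of an indeterminate that carries the block `β`; all other positions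
  -- are split trivially by `zero-split`.
  collect-extract : (∀ i {z} → Z z → f i z ≡ []) →
    (∀ i x {β} → β ∈ f i x → ∃₂ λ a b → (a , b) ∈ s x × f i a ≡ β ∷ [] × f i x ↭ β ∷ f i b) →
    ∀ i xs {β} → β ∈ collect next f i xs →
    ∃₂ λ as bs → (as , bs) ∈ splits s xs × collect next f i as ≡ β ∷ [] ×
                 collect next f i xs ↭ β ∷ collect next f i bs
  collect-extract Z⇒ extract i (x ∷ xs) {β} β∈ with ∈-++⁻ (f i x) β∈
  ... | inj₁ β∈x with a , b , ab∈ , fa≡ , fx↭ ← extract i x β∈x | zs , zs∈ , pzs ← splits-zero xs =
    a ∷ zs , b ∷ xs , ∈-cartesianProductWith⁺ _ ab∈ zs∈ ,
    cong₂ _++_ fa≡ (collect-[] next f Z⇒ (next i) pzs) , Perm.++⁺ʳ (collect next f (next i) xs) fx↭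
  ... | inj₂ β∈xs with z , z∈ , pz ← zero-split x
                     | as , bs , asbs∈ , Fas≡ , Fxs↭ ← collect-extract Z⇒ extract (next i) xs β∈xs =
    z ∷ as , x ∷ bs , ∈-cartesianProductWith⁺ _ z∈ asbs∈ ,
    cong₂ _++_ (Z⇒ i pz) Fas≡ , ↭-trans (Perm.++⁺ˡ (f i x) Fxs↭) (Perm.shift β (f i x) _)

monomialBlocks-extract : ∀ m {β} → β ∈ monomialBlocks m →
  ∃₂ λ a b → (a , b) ∈ factorisations m × monomialBlocks a ≡ β ∷ [] × monomialBlocks m ↭ β ∷ monomialBlocks b
monomialBlocks-extract = collect-extract suc rowBlocks (splits-zero id entryBlocks zero-split)
  (λ i → collect-[] id entryBlocks (λ { i refl → refl }) i)
  (collect-extract id entryBlocks zero-split (λ { i refl → refl }) extract) 1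
  where
  zero-split : ∀ e → ∃ λ z → (z , e) ∈ splitsℕ e × z ≡ 0
  zero-split e = 0 , ∈-splitsℕ⁺ 0 e , refl

  extract : ∀ i e {β} → β ∈ entryBlocks i e →
    ∃₂ λ a b → (a , b) ∈ splitsℕ e × entryBlocks i a ≡ β ∷ [] × entryBlocks i e ↭ β ∷ entryBlocks i b
  extract i (suc e) (here refl) = suc e , 0 ,
    subst (λ k → (suc e , 0) ∈ splitsℕ k) (ℕ.+-identityʳ (suc e)) (∈-splitsℕ⁺ (suc e) 0) , refl , ↭-refl

-- Splitting off the power that carries the first block gives one positive summand of the
-- convolution; the others are natural.
E⁺-positive : ∀ βs m → monomialBlocks m ↭ βs → IsPositive (blockProduct E⁺ βs m)
E⁺-positive []               m p = 0 , trans (𝟙≈ m) (when-true (isOne? m) (monomialBlocks-[]⁻ m (Perm.↭-empty-inv p)))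
E⁺-positive (block d r ∷ βs) m p
  with a , b , ab∈ , a≡ , m↭ ← monomialBlocks-extract m (Perm.∈-resp-↭ (↭-sym p) (here refl)) =
  ∑-positive _ (λ (a , b) → natural-* (dilate-E⁺-natural r d a) (E⁺-natural βs b)) ab∈
    (positive-* (0 , dilate-E⁺-block r {d} {a} a≡) (E⁺-positive βs b (Perm.drop-∷ (↭-trans (↭-sym m↭) p))))

-- The new exponent goes in front of its row and shifts the second indices of the others, to which
-- `monomialBlocks` is blind.
insertAt : ℕ → ℕ → Monomial → Monomial
insertAt zero    r []       = (r ∷ []) ∷ []
insertAt zero    r (es ∷ m) = (r ∷ es) ∷ m
insertAt (suc k) r []       = [] ∷ insertAt k r []
insertAt (suc k) r (es ∷ m) = es ∷ insertAt k r m

monomialBlocks-insertAt : ∀ i k r .{{_ : NonZero r}} m →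
  monomialBlocksFrom i (insertAt k r m) ↭ block (k ℕ.+ i) r ∷ monomialBlocksFrom i m
monomialBlocks-insertAt i zero    (suc r) []       = ↭-refl
monomialBlocks-insertAt i zero    (suc r) (es ∷ m) = ↭-refl
monomialBlocks-insertAt i (suc k) r       []       = ↭-trans (monomialBlocks-insertAt (suc i) k r [])
  (↭-reflexive (cong (λ d → block d r ∷ []) (ℕ.+-suc k i)))
monomialBlocks-insertAt i (suc k) r       (es ∷ m) = ↭-trans
  (Perm.++⁺ˡ (rowBlocks i es) (monomialBlocks-insertAt (suc i) k r m))
  (↭-trans (Perm.shift (block (k ℕ.+ suc i) r) (rowBlocks i es) _)
    (↭-reflexive (cong (λ d → block d r ∷ rowBlocks i es ++ monomialBlocksFrom (suc i) m) (ℕ.+-suc k i))))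

monomialBlocks-surjective : ∀ {βs} → Positive βs → ∃ λ m → monomialBlocks m ↭ βs
monomialBlocks-surjective []                            = [] , ↭-refl
monomialBlocks-surjective {block (suc k) r ∷ βs} (_ ∷ ps) with m , m↭ ← monomialBlocks-surjective ps =
  insertAt k r m , ↭-trans (monomialBlocks-insertAt 1 k r m)
    (↭-trans (↭-reflexive (cong (λ d → block d r ∷ monomialBlocks m) (ℕ.+-comm k 1))) (prep (block (suc k) r) m↭))

*-cancelʳ-0 : ∀ p {q} → q ≢ 0ℚ → p ℚ.* q ≡ 0ℚ → p ≡ 0ℚ
*-cancelʳ-0 p {q} q≢0 pq≡0 = begin
  p                 ≡⟨ ℚ.*-identityʳ p ⟨
  p ℚ.* 1ℚ            ≡⟨ cong (p ℚ.*_) (ℚ.*-inverseʳ q) ⟨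
  p ℚ.* (q ℚ.* ℚ.1/ q)  ≡⟨ ℚ.*-assoc p q (ℚ.1/ q) ⟨
  p ℚ.* q ℚ.* ℚ.1/ q    ≡⟨ cong (ℚ._* ℚ.1/ q) pq≡0 ⟩
  0ℚ ℚ.* ℚ.1/ q       ≡⟨ ℚ.*-zeroˡ (ℚ.1/ q) ⟩
  0ℚ                ∎
  where
  instance
    q-nonZero : ℚ.NonZero q
    q-nonZero = ℚ.≢-nonZero q≢0

module _ {n : ℕ} (a : Typ n → ℚ) (vanishes : ∀ m → linearCombination a E⁺[_] m ≡ 0ℚ) where

  -- Induction on the energy of `τ`, evaluating at a monomial with the blocks of `τ`. Any other `ρ`
  -- that is nonzero there has smaller energy, since equal energies would give it the blocks of `τ`;
  -- its coefficient is already known to vanish.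
  E⁺-independent : ∀ τ → a τ ≡ 0ℚ
  E⁺-independent τ = <-rec (λ e → ∀ τ → energy (blocks τ) ≡ e → a τ ≡ 0ℚ) step _ τ refl
    where
    step : ∀ e → (∀ {e′} → e′ < e → ∀ ρ → energy (blocks ρ) ≡ e′ → a ρ ≡ 0ℚ) →
           ∀ τ → energy (blocks τ) ≡ e → a τ ≡ 0ℚ
    step e rec τ refl with m , m↭τ ← monomialBlocks-surjective (blocksFrom-positive 1 (value τ)) =
      *-cancelʳ-0 (a τ) (positive⇒≢0 (E⁺-positive (blocks τ) m m↭τ)) (trans (sym isolated) (vanishes m))
      where
      others : ∀ ρ → ρ ≢ τ → a ρ ℚ.* E⁺[ ρ ] m ≡ 0ℚ
      others ρ ρ≢τ with E⁺[ ρ ] m ℚ.≟ 0ℚ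
      ... | yes ≡0 = trans (cong (a ρ ℚ.*_) ≡0) (ℚ.*-zeroʳ (a ρ))
      ... | no ≢0 with le , eq ← E⁺-support (blocksFrom-positive 1 (value ρ)) m ≢0 =
        trans (cong (ℚ._* E⁺[ ρ ] m) (rec lt ρ refl)) (ℚ.*-zeroˡ (E⁺[ ρ ] m))
        where
        lt : energy (blocks ρ) < energy (blocks τ)
        lt = subst (energy (blocks ρ) <_) (energy-↭ m↭τ) (ℕ.≤∧≢⇒< le
          (λ e≡ → ρ≢τ (blocks-injective (↭-trans (↭-sym (eq e≡)) m↭τ))))

      isolated : linearCombination a E⁺[_] m ≡ a τ ℚ.* E⁺[ τ ] m
      isolated = ∑-isolate (λ ρ → a ρ ℚ.* E⁺[ ρ ] m) (unique (types n)) (complete (types n) τ)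
        (λ {ρ} _ → others ρ)

linearCombination-difference : ∀ {n} (a b : Typ n → ℚ) B m →
  linearCombination (λ ρ → a ρ ℚ.- b ρ) B m ≡ linearCombination a B m ℚ.- linearCombination b B m
linearCombination-difference {n} a b B m = begin
  ∑ ts (λ ρ → (a ρ ℚ.- b ρ) ℚ.* B ρ m)
    ≡⟨ ∑-cong ts (λ ρ → solve 3 (λ a b x → (a :+ (:- b)) :* x := a :* x :+ con (ℚ.- 1ℚ) :* (b :* x)) refl
         (a ρ) (b ρ) (B ρ m)) ⟩
  ∑ ts (λ ρ → a ρ ℚ.* B ρ m ℚ.+ ℚ.- 1ℚ ℚ.* (b ρ ℚ.* B ρ m))
    ≡⟨ trans (∑-+ ts _ _) (cong (linearCombination a B m ℚ.+_) (∑-*ˡ (ℚ.- 1ℚ) ts _)) ⟩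
  linearCombination a B m ℚ.+ ℚ.- 1ℚ ℚ.* linearCombination b B m
    ≡⟨ solve 2 (λ x y → x :+ con (ℚ.- 1ℚ) :* y := x :+ (:- y)) refl
         (linearCombination a B m) (linearCombination b B m) ⟩
  linearCombination a B m ℚ.- linearCombination b B m ∎
  where ts = elements (types n)

E⁺-coefficients-unique : ∀ {n} (a b : Typ n → ℚ) →
  linearCombination a E⁺[_] ≈ linearCombination b E⁺[_] → ∀ τ → a τ ≡ b τ
E⁺-coefficients-unique a b a≈b τ = begin
  a τ                ≡⟨ solve 2 (λ x y → x := (x :+ (:- y)) :+ y) refl (a τ) (b τ) ⟩
  (a τ ℚ.- b τ) ℚ.+ b τ  ≡⟨ cong (ℚ._+ b τ) (E⁺-independent (λ ρ → a ρ ℚ.- b ρ) (λ m →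
                          trans (linearCombination-difference a b E⁺[_] m)
                            (trans (cong (ℚ._- linearCombination b E⁺[_] m) (a≈b m))
                              (ℚ.+-inverseʳ (linearCombination b E⁺[_] m)))) τ) ⟩
  0ℚ ℚ.+ b τ           ≡⟨ ℚ.+-identityˡ (b τ) ⟩
  b τ                ∎

theorem55 : (n : ℕ) (σ τ : Typ n) →
    IsCoefficient E⁺[_] P[ σ ] τ
    ((∑ℤ[ T ∈ singularTabloids σ τ ] (-1ℤ ^ ∣ ℓ τ - ℓ σ ∣ * + 𝔏* (value T))) / 1)
theorem55 n σ τ =
  (coefficient σ , P-expansion σ) ,
  λ a P≈ → E⁺-coefficients-unique a (coefficient σ) (λ m → trans (sym (P≈ m)) (P-expansion σ m)) τ
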